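{- Let $a,b,c$ be non-negative integers with $a\le b$. Then \[ M(S'_{a,b,c})=\frac{M(S_{a,b,c})}{2^{a+1}}\cdot\frac{2c+b+2}{c+b+1}\cdot\prod_{i=1}^{a}\frac{2c+b+1-i}{c+b+1-i}, \] where $M(S_{a,b,c})$ is the number of lozenge tilings of $S_{a,b,c}$. Moreover, for every non-negative integers $b,c$, $M(S'_{b+1,b,c})=M(S'_{b,b,c})$.
   Context: Work in the triangular lattice of unit equilateral triangles whose lattice lines are the horizontal lines $y=kh$ ($k\in\mathbb Z$, $h=\sqrt3/2$) and the lines at $60^\circ$ and $120^\circ$ to them; lattice points are $(i+k/2,\,kh)$, $i,k\in\mathbb Z$. A lozenge is the union of two unit triangles sharing an edge; a lozenge tiling of a region is a covering by non-overlapping lozenges. If each lozenge is assigned a positive weight, the weight of a tiling is the product of the weights of its lozenges, and $M(R)$ (the matching generating function) is the sum of the weights of all tilings of $R$; for an unweighted region (all weights $1$) $M(R)$ is the number of tilings. The region $S_{a,b,c}$ (for non-negative integers $a,b,c$ with $a\le b+1$): let $H$ be the lattice hexagon with vertices $B=(0,0)$, $C=(c+1,0)$, $D=(c+1+b/2,\,bh)$, $E=(c+(b-a)/2,\,(a+b+2)h)$, $F=((b-a)/2,\,(a+b+2)h)$, $A=(-(a+1)/2,\,(a+1)h)$ (side lengths $c+1,b,a+2,c,b+1,a+1$ for sides $BC,CD,DE,EF,FA,AB$). Let $Z$ be the zigzag lattice path from $B$ made of $2a+1$ unit steps alternating between $(-1/2,h)$ and $(1/2,h)$, starting and ending with $(-1/2,h)$,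 ending at $(-1/2,(2a+1)h)$ on side $FA$. Keep the part of $H$ bounded by $B\to C\to D\to E\to F$, then along $FA$ down to $(-1/2,(2a+1)h)$, then back along $Z$ to $B$; then remove the upward-pointing unit triangle with vertices $(c+(b-1)/2,(b+1)h)$, $(c+(b+1)/2,(b+1)h)$, $(c+b/2,(b+2)h)$ (the unit triangle with an edge on side $DE$, second from the corner $D$). This is $S_{a,b,c}$, unweighted. The weighted region $S'_{a,b,c}$: the same region, where for each $k=1,\dots,a+1$ the vertical lozenge $L_k$ formed by the down-pointing triangle with vertices $(-1/2,(2k-1)h),(1/2,(2k-1)h),(0,(2k-2)h)$ and the up-pointing triangle with vertices $(-1/2,(2k-1)h),(1/2,(2k-1)h),(0,2kh)$ is given weight $1/2$ whenever both of these triangles belong to the region (these are the vertical lozenges along the west side); all other lozenges have weight $1$. -}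

module Defs where

open import Data.Bool using (Bool; true; false; _∧_; _∨_; not; if_then_else_)
open import Data.Nat as ℕ using (ℕ; zero; suc; _∸_)
open import Data.Integer as ℤ using (ℤ; +_; -_; _≤ᵇ_)
open import Data.Rational as ℚ using (ℚ; 0ℚ; 1ℚ; ½)
open import Data.List using (List; []; _∷_; _++_; map; concatMap; filterᵇ; length; foldr; upTo)
open import Relation.Nullary.Decidable using (⌊_⌋)

-- Coordinates.
-- The lattice point (i + k/2 , k·h)  (i,k ∈ ℤ) is represented by (i , k).
-- In these coordinates the three lattice-line families are
--   k = const (horizontal),  i = const (60°),  i + k = const (120°).

data Orientation : Set where
  up down : Orientation

-- A unit triangle.
--  tri up   i k : vertices (i,k), (i+1,k), (i,k+1)       (up-pointing)
--  tri down i k : vertices (i+1,k), (i,k+1), (i+1,k+1)   (down-pointing)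
record Tri : Set where
  constructor tri
  field
    orient : Orientation
    col    : ℤ
    row    : ℤ

infix 4 _≡ᵇℤ_ _≡ᵇO_ _≡ᵇT_
_≡ᵇℤ_ : ℤ → ℤ → Bool
x ≡ᵇℤ y = ⌊ x ℤ.≟ y ⌋

_≡ᵇO_ : Orientation → Orientation → Bool
up   ≡ᵇO up   = true
down ≡ᵇO down = true
_    ≡ᵇO _    = false

_≡ᵇT_ : Tri → Tri → Bool
tri o i k ≡ᵇT tri o' i' k' = (o ≡ᵇO o') ∧ (i ≡ᵇℤ i') ∧ (k ≡ᵇℤ k')

ℤ1 : ℤ
ℤ1 = + 1

data Pt : Set where
  pt : ℤ → ℤ → Pt

vertices : Tri → List Pt
vertices (tri up   i k) = pt i k ∷ pt (i ℤ.+ ℤ1) k ∷ pt i (k ℤ.+ ℤ1) ∷ []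
vertices (tri down i k) = pt (i ℤ.+ ℤ1) k ∷ pt i (k ℤ.+ ℤ1) ∷ pt (i ℤ.+ ℤ1) (k ℤ.+ ℤ1) ∷ []

any? : {A : Set} → (A → Bool) → List A → Bool
any? p = foldr (λ x r → p x ∨ r) false

all? : {A : Set} → (A → Bool) → List A → Bool
all? p = foldr (λ x r → p x ∧ r) true

-- Lozenges.  Every lozenge contains exactly one up-pointing triangle;
-- it is determined by that up-triangle (i,k) and the edge it shares
-- with its down-pointing partner.

data Dir : Set where
  vert   : Dir   -- shared horizontal edge: partner tri down i (k-1)  ("vertical lozenge")
  leftL  : Dir   -- shared edge (i,k)-(i,k+1):   partner tri down (i-1) k
  rightL : Dir   -- shared edge (i+1,k)-(i,k+1): partner tri down i k

record Lozenge : Set where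
  constructor loz
  field
    dir : Dir
    col : ℤ
    row : ℤ

upTri : Lozenge → Tri
upTri (loz _ i k) = tri up i k

downTri : Lozenge → Tri
downTri (loz vert   i k) = tri down i (k ℤ.- ℤ1)
downTri (loz leftL  i k) = tri down (i ℤ.- ℤ1) k
downTri (loz rightL i k) = tri down i k

covers : Lozenge → Tri → Bool
covers l t = (t ≡ᵇT upTri l) ∨ (t ≡ᵇT downTri l)

intRange : ℤ → ℕ → List ℤ
intRange lo zero    = []
intRange lo (suc n) = lo ∷ intRange (lo ℤ.+ ℤ1) n

-- A region: a membership predicate, plus a finite bounding box
-- [i₀, i₀+w) × [k₀, k₀+h) of coordinates containing (the (i,k) of)
-- every triangle of the region.
record Region : Set where
  field
    mem : Tri → Bool
    i₀  : ℤ
    w   : ℕ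
    k₀  : ℤ
    h   : ℕ

module _ (R : Region) where
  open Region R

  boxTris : List Tri
  boxTris = concatMap (λ i → concatMap (λ k → tri up i k ∷ tri down i k ∷ [])
                                       (intRange k₀ h))
                      (intRange i₀ w)

  triangles : List Tri
  triangles = filterᵇ mem boxTris

  lozenges : List Lozenge
  lozenges = filterᵇ (λ l → mem (upTri l) ∧ mem (downTri l))
               (concatMap (λ i → concatMap (λ k → loz vert i k ∷ loz leftL i k ∷ loz rightL i k ∷ [])
                                           (intRange k₀ h))
                          (intRange i₀ w))

  isTiling : List Lozenge → Bool
  isTiling ls = all? (λ t → length (filterᵇ (λ l → covers l t) ls) ℕ.≡ᵇ 1) triangles

-- all sub-lists (= all subsets, for a duplicate-free list)
subsets : {A : Set} → List A → List (List A)
subsets []       = [] ∷ []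
subsets (x ∷ xs) = map (x ∷_) (subsets xs) ++ subsets xs

sumℚ : List ℚ → ℚ
sumℚ = foldr ℚ._+_ 0ℚ

weightOf : (Lozenge → ℚ) → List Lozenge → ℚ
weightOf wt = foldr (λ l r → wt l ℚ.* r) 1ℚ

M : Region → (Lozenge → ℚ) → ℚ
M R wt = sumℚ (map (λ ls → if isTiling R ls then weightOf wt ls else 0ℚ)
                   (subsets (lozenges R)))

ℕ→ℤ : ℕ → ℤ
ℕ→ℤ n = + n

-- lattice point in the hexagon H with corners (in (i,k) coordinates)
-- B(0,0) C(c+1,0) D(c+1,b) E(c-a-1,a+b+2) F(-a-1,a+b+2) A(-a-1,a+1):
--   0 ≤ k ≤ a+b+2,  -(a+1) ≤ i ≤ c+1,  0 ≤ i+k ≤ c+b+1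
inHex : ℕ → ℕ → ℕ → Pt → Bool
inHex a b c (pt i k) =
  (+ 0 ≤ᵇ k) ∧ (k ≤ᵇ + (a ℕ.+ b ℕ.+ 2)) ∧
  (- (+ (suc a)) ≤ᵇ i) ∧ (i ≤ᵇ + (suc c)) ∧
  (+ 0 ≤ᵇ i ℤ.+ k) ∧ (i ℤ.+ k ≤ᵇ + (c ℕ.+ b ℕ.+ 1))

-- The zigzag Z runs through the horizontal bands k = 0,…,2a (between heights
-- kh and (k+1)h) and inside each such band it is a single unit segment with
-- x-coordinates in [-1/2,0].  A unit triangle of such a band lies to the
-- right of Z (i.e. is kept) iff the x-coordinate of its centroid is ≥ 0:
--   up   (i,k): centroid x = i + k/2 + 1/2,  i.e.  2i + k + 1 ≥ 0
--   down (i,k): centroid x = i + k/2 + 1,    i.e.  2i + k + 2 ≥ 0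
rightOfZ : ℕ → Tri → Bool
rightOfZ a (tri o i k) =
  if k ≤ᵇ + (2 ℕ.* a)
  then (+ 0 ≤ᵇ (+ 2) ℤ.* i ℤ.+ k ℤ.+ + (offset o))
  else true
  where
  offset : Orientation → ℕ
  offset up   = 1
  offset down = 2

-- the removed up-triangle with vertices (c+(b-1)/2,(b+1)h), (c+(b+1)/2,(b+1)h), (c+b/2,(b+2)h),
-- i.e. tri up (c-1) (b+1) in (i,k) coordinates
removedTri : ℕ → ℕ → Tri
removedTri b c = tri up (+ c ℤ.- ℤ1) (+ (suc b))

memS : ℕ → ℕ → ℕ → Tri → Bool
memS a b c t = all? (inHex a b c) (vertices t) ∧ rightOfZ a t ∧ not (t ≡ᵇT removedTri b c)

S : ℕ → ℕ → ℕ → Region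
S a b c = record
  { mem = memS a b c
  ; i₀  = - (+ (suc a))
  ; w   = a ℕ.+ c ℕ.+ 3        -- i ∈ [-(a+1), c+1]
  ; k₀  = + 0
  ; h   = a ℕ.+ b ℕ.+ 3        -- k ∈ [0, a+b+2]
  }

-- L_k (k = 1,…,a+1): down triangle with vertices (-1/2,(2k-1)h),(1/2,(2k-1)h),(0,(2k-2)h)
-- = tri down (-k) (2k-2), together with the up triangle above it = tri up (-k) (2k-1);
-- i.e. the lozenge  loz vert (-k) (2k-1).
isWestVertical : ℕ → Lozenge → Bool
isWestVertical a (loz vert i r) =
  any? (λ k → (i ≡ᵇℤ - (+ k)) ∧ (r ≡ᵇℤ + (2 ℕ.* k ∸ 1))) (map suc (upTo (suc a)))
isWestVertical a (loz leftL  _ _) = false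
isWestVertical a (loz rightL _ _) = false

unweighted : Lozenge → ℚ
unweighted _ = 1ℚ

weightS' : ℕ → Lozenge → ℚ
weightS' a l = if isWestVertical a l then ½ else 1ℚ

MS : ℕ → ℕ → ℕ → ℚ
MS a b c = M (S a b c) unweighted

MS' : ℕ → ℕ → ℕ → ℚ
MS' a b c = M (S a b c) (weightS' a)

prodℚ : ℕ → (ℕ → ℚ) → ℚ
prodℚ zero    f = 1ℚ
prodℚ (suc n) f = prodℚ n f ℚ.* f (suc n)

_^ℚ_ : ℚ → ℕ → ℚ
q ^ℚ n = prodℚ n (λ _ → q)

{-# OPTIONS --safe #-}
module Submission where

-- Reading a tiling row by row, the horizontal edges that are not crossed by vertical lozenges form
-- c + 1 non-intersecting lattice paths with steps ±1: they start from the c + 1 edges of the side BC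
-- and end at the c edges of the side EF and at the removed triangle.  The zigzag side is a wall at 0.
-- Halving the weight of the vertical lozenges on the wall is, up to the factor 2^-(a+1), doubling
-- the weight of each visit of a path to 0.  Both path counts are determinants: in the unweighted case
-- by reflection, in the weighted case by folding a free path at the wall.  After column operations
-- their entries are ballot numbers and binomial coefficients C(L-2k, j-k), with L = t + 2c + 1.
--
-- Let p(j) be the determinant in which the path to the removed triangle ends instead at position j
-- at the top height (positions being counted from the right).  Since a row changes with the height
-- by Pascal's rule, the number of tilings is p(1) - (a+1) p(0).  As a function of j, p(j) is a
-- binomial weight times a polynomial in j (m - j) of degree c that vanishes at the c other end
-- points, hence it factors, and p(1) / p(0) is explicit.  Finally p(0) for c + 1 is p(a+1) for c,
-- so the ratio of the two values of p(0) follows by induction on c.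

open import Defs
open import Data.Bool using (Bool; true; false; _∧_; _∨_; not; if_then_else_; T; T?)
open import Data.Bool.Properties using (T-≡; ∧-assoc; ∧-comm; ∧-identityʳ; ∧-zeroʳ; ∨-assoc; ∨-identityʳ)
open import Data.Empty using (⊥-elim)
import Data.Integer as ℤ
open import Data.Integer using (ℤ; -[1+_])
import Data.Integer.Properties as ℤₚ
import Data.Integer.Tactic.RingSolver as ℤ-Ring
open import Data.List using (List; []; _∷_; _++_; map; length; filterᵇ; concatMap; upTo)
open import Data.List.Membership.Propositional using (_∈_; lose)
open import Data.List.Membership.Propositional.Properties using (∈-∃++; ∈-concatMap⁺; ∈-filter⁺; ∈-filter⁻; ∈-map⁺; ∈-map⁻; ∈-upTo⁺)
open import Data.List.Properties using (++-assoc; ++-identityʳ; length-++; length-map; map-++; map-∘)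
import Data.List.Relation.Unary.All as All
import Data.List.Relation.Unary.All.Properties as Allₚ
import Data.List.Relation.Unary.AllPairs.Properties as AllPairsₚ
open import Data.List.Relation.Unary.Any using (here; there)
import Data.Nat as ℕ
open import Data.Nat using (ℕ; zero; suc; _∸_; _≤_; _<_; _≤ᵇ_; _<ᵇ_; _≡ᵇ_; z≤n; s≤s)
import Data.Nat.Properties as ℕₚ
import Data.Nat.Tactic.RingSolver as ℕ-Ring
open import Data.Product using (_×_; _,_; proj₁; proj₂; ∃-syntax)
import Data.Rational as ℚ
open import Data.Rational using (ℚ; 0ℚ; 1ℚ; ½; _/_; NonZero; ≢-nonZero; 1/_; toℚᵘ)
import Data.Rational.Properties as ℚₚ
open import Data.Rational.Solver using (module +-*-Solver)
open +-*-Solver using (solve; con; _:+_; _:*_; _:-_; :-_; _:=_)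
import Data.Rational.Unnormalised as ℚᵘ
import Data.Rational.Unnormalised.Properties as ℚᵘₚ
open import Data.Sum using (_⊎_; inj₁; inj₂)
open import Function using (_∘_)
open import Function.Bundles using (Equivalence)
open import Relation.Binary.Definitions using (tri<; tri≈; tri>)
open import Relation.Binary.PropositionalEquality
open import Relation.Nullary using (yes; no; ¬_)

-- Non-intersection is not handled by an involution on families of paths. The determinant is
-- expanded by multilinearity while the region is swept downwards: as a particle moves by at most
-- one position, two particles can meet but cannot cross, and a meeting produces two equal rows. So
-- the sum over tilings and the expansion agree term by term.
--
-- Both counts use one table `row c t j k`, built from `ballot` or from `bin`. What tells them apart
-- is the value just behind the wall, which is θ times the value in front of it with θ = 0 or θ = 1.
-- A vertical lozenge on the wall then has to carry the weight η with η (1 + θ) = 1, and this is the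
-- origin of the weight 1/2.
--
-- Because of the removed triangle both counts contain the factor (b+1)(b+2c+2) - ac, which does not
-- split into linear factors. It is the same factor in both, so only quotients are needed, and the
-- constants left open by the factorisation of p cancel. The natural parameter is L for `bin` and L
-- + 1 for `ballot`; this shift by one is what makes the quotients telescope.

-- Determinants as iterated contractions.

module Determinants where

  open import Data.Rational using (-_; _+_; _*_; _-_)
  open import Data.Rational.Properties
  open All using (All; []; _∷_)

  Row : Set
  Row = ℕ → ℚ

  Form : Set
  Form = List ℕ → ℚ

  infixl 6 _⊕_
  infixr 7 _⊙_

  _⊕_ : {A : Set} → (A → ℚ) → (A → ℚ) → A → ℚ
  (f ⊕ g) x = f x + g x

  _⊙_ : {A : Set} → ℚ → (A → ℚ) → A → ℚ
  (q ⊙ f) x = q * f x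

  -- Interior product: the alternating sum over the column that is deleted from the list. The
  -- alternating sign comes from the nested subtraction. With the columns as an argument, a
  -- determinant is a function of its list of rows alone, and rows can be split, moved and compared
  -- without matrices.
  ι : Row → Form → Form
  ι r g []       = 0ℚ
  ι r g (k ∷ ks) = r k * g ks - ι r (g ∘ (k ∷_)) ks

  δ[] : Form
  δ[] []      = 1ℚ
  δ[] (_ ∷ _) = 0ℚ

  det : List Row → Form
  det []       = δ[]
  det (r ∷ rs) = ι r (det rs)

  ι-cong : ∀ {r s g h} → r ≗ s → g ≗ h → ι r g ≗ ι s h
  ι-cong r≗s g≗h []       = refl
  ι-cong r≗s g≗h (k ∷ ks) =
    cong₂ _-_ (cong₂ _*_ (r≗s k) (g≗h ks)) (ι-cong r≗s (g≗h ∘ (k ∷_)) ks)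

  ι-⊕ˡ : ∀ r s g → ι (r ⊕ s) g ≗ ι r g ⊕ ι s g
  ι-⊕ˡ r s g []       = refl
  ι-⊕ˡ r s g (k ∷ ks) = trans
    (cong (λ z → (r k + s k) * g ks - z) (ι-⊕ˡ r s (g ∘ (k ∷_)) ks))
    (solve 5 (λ x y w u v → (x :+ y) :* w :- (u :+ v) := (x :* w :- u) :+ (y :* w :- v)) refl
       (r k) (s k) (g ks) (ι r (g ∘ (k ∷_)) ks) (ι s (g ∘ (k ∷_)) ks))

  ι-⊙ˡ : ∀ q r g → ι (q ⊙ r) g ≗ q ⊙ ι r g
  ι-⊙ˡ q r g []       = sym (*-zeroʳ q)
  ι-⊙ˡ q r g (k ∷ ks) = trans
    (cong (λ z → q * r k * g ks - z) (ι-⊙ˡ q r (g ∘ (k ∷_)) ks))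
    (solve 4 (λ q x w u → q :* x :* w :- q :* u := q :* (x :* w :- u)) refl
       q (r k) (g ks) (ι r (g ∘ (k ∷_)) ks))

  ι-⊕ʳ : ∀ r g h → ι r (g ⊕ h) ≗ ι r g ⊕ ι r h
  ι-⊕ʳ r g h []       = refl
  ι-⊕ʳ r g h (k ∷ ks) = trans
    (cong (λ z → r k * (g ks + h ks) - z) (ι-⊕ʳ r (g ∘ (k ∷_)) (h ∘ (k ∷_)) ks))
    (solve 5 (λ x y w u v → x :* (y :+ w) :- (u :+ v) := (x :* y :- u) :+ (x :* w :- v)) refl
       (r k) (g ks) (h ks) (ι r (g ∘ (k ∷_)) ks) (ι r (h ∘ (k ∷_)) ks))

  ι-⊙ʳ : ∀ q r g → ι r (q ⊙ g) ≗ q ⊙ ι r g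
  ι-⊙ʳ q r g []       = sym (*-zeroʳ q)
  ι-⊙ʳ q r g (k ∷ ks) = trans
    (cong (λ z → r k * (q * g ks) - z) (ι-⊙ʳ q r (g ∘ (k ∷_)) ks))
    (solve 4 (λ q x w u → x :* (q :* w) :- q :* u := q :* (x :* w :- u)) refl
       q (r k) (g ks) (ι r (g ∘ (k ∷_)) ks))

  ι-0ʳ : ∀ r {g} → (∀ ks → g ks ≡ 0ℚ) → ∀ ks → ι r g ks ≡ 0ℚ
  ι-0ʳ r {g} g≡0 ks = trans
    (ι-cong (λ _ → refl) (λ m → trans (g≡0 m) (sym (*-zeroˡ (g m)))) ks)
    (trans (ι-⊙ʳ 0ℚ r g ks) (*-zeroˡ (ι r g ks)))

  -- Expanding both contractions at the first index leaves an antisymmetric remainder.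
  ι-expand : ∀ r s g k ks → ι r (ι s g) (k ∷ ks) ≡
    r k * ι s g ks - s k * ι r g ks + ι r (ι s (g ∘ (k ∷_))) ks
  ι-expand r s g k ks = trans
    (cong (λ z → r k * ι s g ks - z)
      (trans (ι-cong {r} {r} (λ _ → refl)
               (λ m → solve 2 (λ x y → x :- y := x :+ con (- 1ℚ) :* y) refl
                        (s k * g m) (ι s (g ∘ (k ∷_)) m)) ks)
      (trans (ι-⊕ʳ r (s k ⊙ g) ((- 1ℚ) ⊙ ι s (g ∘ (k ∷_))) ks)
             (cong₂ _+_ (ι-⊙ʳ (s k) r g ks) (ι-⊙ʳ (- 1ℚ) r (ι s (g ∘ (k ∷_))) ks)))))
    (solve 4 (λ x y u v → x :- (y :+ con (- 1ℚ) :* v) := x :- y :+ v) refl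
       (r k * ι s g ks) (s k * ι r g ks) 0ℚ (ι r (ι s (g ∘ (k ∷_))) ks))

  ι-anticomm : ∀ r s g ks → ι r (ι s g) ks ≡ - ι s (ι r g) ks
  ι-anticomm r s g []       = refl
  ι-anticomm r s g (k ∷ ks) = trans (ι-expand r s g k ks)
    (trans (cong (λ z → r k * ι s g ks - s k * ι r g ks + z) (ι-anticomm r s (g ∘ (k ∷_)) ks))
    (trans (solve 3 (λ x y u → x :- y :+ :- u := :- (y :- x :+ u)) refl
              (r k * ι s g ks) (s k * ι r g ks) (ι s (ι r (g ∘ (k ∷_))) ks))
           (cong -_ (sym (ι-expand s r g k ks)))))

  ι-square : ∀ r g ks → ι r (ι r g) ks ≡ 0ℚ
  ι-square r g []       = refl
  ι-square r g (k ∷ ks) = trans (ι-expand r r g k ks)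
    (trans (cong₂ _+_ (+-inverseʳ (r k * ι r g ks)) (ι-square r (g ∘ (k ∷_)) ks)) refl)

  det-prefix : ∀ pre {rs ss} → det rs ≗ det ss → det (pre ++ rs) ≗ det (pre ++ ss)
  det-prefix []        eq = eq
  det-prefix (r ∷ pre) eq = ι-cong (λ _ → refl) (det-prefix pre eq)

  det-⊕ : ∀ pre r s post →
    det (pre ++ (r ⊕ s) ∷ post) ≗ det (pre ++ r ∷ post) ⊕ det (pre ++ s ∷ post)
  det-⊕ []        r s post    = ι-⊕ˡ r s (det post)
  det-⊕ (p ∷ pre) r s post ks = trans
    (ι-cong (λ _ → refl) (det-⊕ pre r s post) ks)
    (ι-⊕ʳ p (det (pre ++ r ∷ post)) (det (pre ++ s ∷ post)) ks)

  det-⊙ : ∀ pre q r post → det (pre ++ (q ⊙ r) ∷ post) ≗ q ⊙ det (pre ++ r ∷ post)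
  det-⊙ []        q r post    = ι-⊙ˡ q r (det post)
  det-⊙ (p ∷ pre) q r post ks = trans
    (ι-cong (λ _ → refl) (det-⊙ pre q r post) ks)
    (ι-⊙ʳ q p (det (pre ++ r ∷ post)) ks)

  det-row-cong : ∀ pre {r s} post → r ≗ s → det (pre ++ r ∷ post) ≗ det (pre ++ s ∷ post)
  det-row-cong pre post r≗s = det-prefix pre (ι-cong r≗s (λ _ → refl))

  det-adjacent : ∀ pre r post ks → det (pre ++ r ∷ r ∷ post) ks ≡ 0ℚ
  det-adjacent []        r post = ι-square r (det post)
  det-adjacent (p ∷ pre) r post = ι-0ʳ p (det-adjacent pre r post)

  -- The first row is moved past `pre` by `ι-anticomm`, one row at a time, until it stands next to
  -- its copy.
  det-repeat : ∀ r pre post ks → det (r ∷ pre ++ r ∷ post) ks ≡ 0ℚ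
  det-repeat r []        post ks = ι-square r (det post) ks
  det-repeat r (p ∷ pre) post ks = trans (ι-anticomm r p (det (pre ++ r ∷ post)) ks)
    (cong -_ (ι-0ʳ p (det-repeat r pre post) ks))

  ι-map-suc : ∀ r g ks → ι r g (map suc ks) ≡ ι (r ∘ suc) (g ∘ map suc) ks
  ι-map-suc r g []       = refl
  ι-map-suc r g (k ∷ ks) = cong (λ z → r (suc k) * g (map suc ks) - z) (ι-map-suc r (g ∘ (suc k ∷_)) ks)

  -- Serves to renumber the columns once column 0 has been split off; see `minor-suc`.
  det-map-suc : ∀ rs ks → det rs (map suc ks) ≡ det (map (_∘ suc) rs) ks
  det-map-suc []       []      = refl
  det-map-suc []       (_ ∷ _) = refl
  det-map-suc (r ∷ rs) ks      = trans (ι-map-suc r (det rs) ks)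
    (ι-cong (λ _ → refl) (det-map-suc rs) ks)

  ι-zero : ∀ {r} g ks → All (λ k → r k ≡ 0ℚ) ks → ι r g ks ≡ 0ℚ
  ι-zero g []       []        = refl
  ι-zero g (k ∷ ks) (eq ∷ eqs) =
    cong₂ _-_ (trans (cong (_* g ks) eq) (*-zeroˡ (g ks))) (ι-zero (g ∘ (k ∷_)) ks eqs)

  prod : {A : Set} → (A → ℚ) → List A → ℚ
  prod f []       = 1ℚ
  prod f (x ∷ xs) = f x * prod f xs

  -- Rows already treated are moved into `pre`, so the induction always works on the row that
  -- directly follows an arbitrary prefix.
  det-scale : ∀ (s : ℕ → ℚ) (R S : ℕ → Row) pre X → All (λ x → S x ≗ s x ⊙ R x) X →
    det (pre ++ map S X) ≗ prod s X ⊙ det (pre ++ map R X)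
  det-scale s R S pre []      []         ks = sym (*-identityˡ _)
  det-scale s R S pre (x ∷ X) (eq ∷ eqs) ks = begin
    det (pre ++ S x ∷ map S X) ks
      ≡⟨ det-row-cong pre (map S X) eq ks ⟩
    det (pre ++ (s x ⊙ R x) ∷ map S X) ks
      ≡⟨ det-⊙ pre (s x) (R x) (map S X) ks ⟩
    s x * det (pre ++ R x ∷ map S X) ks
      ≡⟨ cong (λ rs → s x * det rs ks) (sym (++-assoc pre (R x ∷ []) (map S X))) ⟩
    s x * det ((pre ++ R x ∷ []) ++ map S X) ks
      ≡⟨ cong (s x *_) (det-scale s R S (pre ++ R x ∷ []) X eqs ks) ⟩
    s x * (prod s X * det ((pre ++ R x ∷ []) ++ map R X) ks)
      ≡⟨ cong (λ rs → s x * (prod s X * det rs ks)) (++-assoc pre (R x ∷ []) (map R X)) ⟩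
    s x * (prod s X * det (pre ++ R x ∷ map R X) ks)
      ≡⟨ sym (*-assoc (s x) (prod s X) _) ⟩
    s x * prod s X * det (pre ++ R x ∷ map R X) ks ∎
    where open ≡-Reasoning

-- Polynomial functions and their roots.

module Polynomials where

  open import Data.Rational using (-_; _+_; _*_; _-_)
  open import Data.Rational.Properties
  open All using (All; []; _∷_)
  open import Data.List.Relation.Unary.AllPairs using (AllPairs; []; _∷_)
  open Determinants

  *-cancelˡ-≢0 : ∀ {q x y} → q ≢ 0ℚ → q * x ≡ q * y → x ≡ y
  *-cancelˡ-≢0 {q} {x} {y} q≢0 eq = begin
    x                 ≡⟨ sym (*-identityˡ x) ⟩
    1ℚ * x            ≡⟨ cong (_* x) (sym (*-inverseˡ q)) ⟩
    (1/ q) * q * x    ≡⟨ *-assoc (1/ q) q x ⟩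
    (1/ q) * (q * x)  ≡⟨ cong ((1/ q) *_) eq ⟩
    (1/ q) * (q * y)  ≡⟨ sym (*-assoc (1/ q) q y) ⟩
    (1/ q) * q * y    ≡⟨ cong (_* y) (*-inverseˡ q) ⟩
    1ℚ * y            ≡⟨ *-identityˡ y ⟩
    y                 ∎
    where
    open ≡-Reasoning
    instance
      nz : NonZero q
      nz = ≢-nonZero q≢0

  *-≢0 : ∀ {x y} → x ≢ 0ℚ → y ≢ 0ℚ → x * y ≢ 0ℚ
  *-≢0 {x} x≢0 y≢0 eq = y≢0 (*-cancelˡ-≢0 x≢0 (trans eq (sym (*-zeroʳ x))))

  -- Degree at most d, as a property of functions in Horner form. Entries of determinants can then
  -- be shown to be polynomial without any arithmetic on coefficient lists.
  Poly : ℕ → (ℚ → ℚ) → Set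
  Poly zero    p = ∃[ c ] (∀ y → p y ≡ c)
  Poly (suc d) p = ∃[ c ] ∃[ q ] Poly d q × (∀ y → p y ≡ c + y * q y)

  poly-cong : ∀ d {p q} → p ≗ q → Poly d p → Poly d q
  poly-cong zero    p≗q (c , eq)         = c , λ y → trans (sym (p≗q y)) (eq y)
  poly-cong (suc d) p≗q (c , r , pr , eq) = c , r , pr , λ y → trans (sym (p≗q y)) (eq y)

  poly-const : ∀ d c → Poly d (λ _ → c)
  poly-const zero    c = c , λ _ → refl
  poly-const (suc d) c = c , (λ _ → 0ℚ) , poly-const d 0ℚ ,
    λ y → sym (trans (cong (c +_) (*-zeroʳ y)) (+-identityʳ c))

  poly-⊕ : ∀ d {p q} → Poly d p → Poly d q → Poly d (p ⊕ q)
  poly-⊕ zero    (c , eq) (e , eq′) = c + e , λ y → cong₂ _+_ (eq y) (eq′ y)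
  poly-⊕ (suc d) (c , p , pp , eq) (e , q , pq , eq′) =
    c + e , p ⊕ q , poly-⊕ d pp pq , λ y → trans (cong₂ _+_ (eq y) (eq′ y))
      (solve 5 (λ c e y p q → (c :+ y :* p) :+ (e :+ y :* q) := (c :+ e) :+ y :* (p :+ q)) refl
         c e y (p y) (q y))

  poly-⊙ : ∀ d s {p} → Poly d p → Poly d (s ⊙ p)
  poly-⊙ zero    s (c , eq) = s * c , λ y → cong (s *_) (eq y)
  poly-⊙ (suc d) s (c , p , pp , eq) =
    s * c , s ⊙ p , poly-⊙ d s pp , λ y → trans (cong (s *_) (eq y))
      (solve 4 (λ s c y p → s :* (c :+ y :* p) := s :* c :+ y :* (s :* p)) refl s c y (p y))

  poly-suc : ∀ d {p} → Poly d p → Poly (suc d) p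
  poly-suc zero    (c , eq) = poly-cong 1 (λ y → sym (eq y)) (poly-const 1 c)
  poly-suc (suc d) (c , q , pq , eq) = c , q , poly-suc d pq , eq

  poly-linear : ∀ d r {p} → Poly d p → Poly (suc d) (λ y → (y - r) * p y)
  poly-linear d r {p} pp = poly-cong (suc d)
    (λ y → solve 3 (λ r y p → (con 0ℚ :+ y :* p) :+ (:- r) :* p := (y :- r) :* p) refl r y (p y))
    (poly-⊕ (suc d) (0ℚ , p , pp , λ _ → refl) (poly-⊙ (suc d) (- r) (poly-suc d pp)))

  -- Synthetic division: for p y = c + y q(y), the difference p y - p r equals y (q y - q r) + (y -
  -- r) q r, and q y - q r is divided by y - r recursively.
  poly-factor : ∀ d {p} r → Poly (suc d) p → p r ≡ 0ℚ →
    ∃[ q ] Poly d q × (∀ y → p y ≡ (y - r) * q y)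
  poly-factor zero {p} r (c , q , (e , qe) , eq) pr≡0 = q , (e , qe) , λ y → begin
    p y                            ≡⟨ solve 1 (λ x → x := x :- con 0ℚ) refl (p y) ⟩
    p y - 0ℚ                       ≡⟨ cong (λ z → p y - z) (sym pr≡0) ⟩
    p y - p r                      ≡⟨ cong₂ _-_ (eq y) (eq r) ⟩
    (c + y * q y) - (c + r * q r)  ≡⟨ cong (λ z → (c + y * q y) - (c + r * z))
                                        (trans (qe r) (sym (qe y))) ⟩
    (c + y * q y) - (c + r * q y)  ≡⟨ solve 4 (λ c y r q → (c :+ y :* q) :- (c :+ r :* q)
                                        := (y :- r) :* q) refl c y r (q y) ⟩
    (y - r) * q y                  ∎
    where open ≡-Reasoning
  poly-factor (suc d) {p} r (c , q , pq , eq) pr≡0 = let (q′ , pq′ , eq′) = step in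
    (λ y → q r + y * q′ y) , (q r , q′ , pq′ , λ _ → refl) , λ y → begin
    p y                            ≡⟨ solve 1 (λ x → x := x :- con 0ℚ) refl (p y) ⟩
    p y - 0ℚ                       ≡⟨ cong (λ z → p y - z) (sym pr≡0) ⟩
    p y - p r                      ≡⟨ cong₂ _-_ (eq y) (eq r) ⟩
    (c + y * q y) - (c + r * q r)  ≡⟨ solve 5 (λ c y r q s → (c :+ y :* q) :- (c :+ r :* s)
                                        := y :* (q :+ :- s) :+ (y :- r) :* s) refl
                                        c y r (q y) (q r) ⟩
    y * (q y + - q r) + (y - r) * q r
                                   ≡⟨ cong (λ z → y * z + (y - r) * q r) (eq′ y) ⟩
    y * ((y - r) * q′ y) + (y - r) * q r
                                   ≡⟨ solve 4 (λ y r q s → y :* ((y :- r) :* q) :+ (y :- r) :* s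
                                        := (y :- r) :* (s :+ y :* q)) refl y r (q′ y) (q r) ⟩
    (y - r) * (q r + y * q′ y)     ∎
    where
    open ≡-Reasoning
    step : ∃[ q′ ] Poly d q′ × (∀ y → q y + - q r ≡ (y - r) * q′ y)
    step = poly-factor d r (poly-⊕ (suc d) pq (poly-const (suc d) (- q r))) (+-inverseʳ (q r))

  x-y≢0 : ∀ {x y} → x ≢ y → x - y ≢ 0ℚ
  x-y≢0 {x} {y} x≢y eq = x≢y (begin
    x            ≡⟨ solve 2 (λ x y → x := (x :- y) :+ y) refl x y ⟩
    (x - y) + y  ≡⟨ cong (_+ y) eq ⟩
    0ℚ + y       ≡⟨ +-identityˡ y ⟩
    y            ∎)
    where open ≡-Reasoning

  -- Each division by a root lowers the degree bound by one, until a constant is left. The other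
  -- roots pass to the quotient because their difference from the root divided out is non-zero.
  poly-roots : ∀ rs {p} → Poly (length rs) p → All (λ r → p r ≡ 0ℚ) rs → AllPairs _≢_ rs →
    ∃[ κ ] (∀ y → p y ≡ κ * prod (λ r → y - r) rs)
  poly-roots []       (c , eq) [] [] = c , λ y → trans (eq y) (sym (*-identityʳ c))
  poly-roots (r ∷ rs) {p} pp (pr ∷ prs) (r≢ ∷ ds) =
    let (q , pq , eq) = poly-factor (length rs) r pp pr
        qrs = All.zipWith (λ {s} (ps , r≢s) → *-cancelˡ-≢0 (x-y≢0 (r≢s ∘ sym))
                (trans (sym (eq s)) (trans ps (sym (*-zeroʳ (s - r)))))) (prs , r≢)
        (κ , eq′) = poly-roots rs pq qrs ds
    in κ , λ y → trans (eq y) (trans (cong ((y - r) *_) (eq′ y))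
         (solve 3 (λ x k z → x :* (k :* z) := k :* (x :* z)) refl
            (y - r) κ (prod (λ r → y - r) rs)))

  -- Only the first row depends on y, so its expansion is a linear combination of the entries with
  -- constant coefficients and the degree does not grow.
  poly-ι : ∀ d (φ : ℕ → ℚ → ℚ) g ks → All (λ k → Poly d (φ k)) ks →
    Poly d (λ y → ι (λ k → φ k y) g ks)
  poly-ι d φ g []       []         = poly-const d 0ℚ
  poly-ι d φ g (k ∷ ks) (pk ∷ pks) = poly-cong d
    (λ y → solve 3 (λ u w v → w :* u :+ con (- 1ℚ) :* v := u :* w :- v) refl
             (φ k y) (g ks) (ι (λ k → φ k y) (g ∘ (k ∷_)) ks))
    (poly-⊕ d (poly-⊙ d (g ks) pk) (poly-⊙ d (- 1ℚ) (poly-ι d φ (g ∘ (k ∷_)) ks pks)))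

-- Tilings as weighted exact covers.

module ExactCovers where

  open import Data.Rational using (_+_; _*_)
  open import Data.Rational.Properties
  open All using (All; []; _∷_)
  open Determinants

  ≡ᵇℤ-sound : ∀ x y → (x ≡ᵇℤ y) ≡ true → x ≡ y
  ≡ᵇℤ-sound x y eq with x ℤ.≟ y
  ... | yes p = p

  ≡ᵇℤ-refl : ∀ x → (x ≡ᵇℤ x) ≡ true
  ≡ᵇℤ-refl x with x ℤ.≟ x
  ... | yes _ = refl
  ... | no ¬p = ⊥-elim (¬p refl)

  ∧-true : ∀ {x y} → x ∧ y ≡ true → x ≡ true × y ≡ true
  ∧-true {true} eq = refl , eq

  ≡ᵇT-sound : ∀ s t → (s ≡ᵇT t) ≡ true → s ≡ t
  ≡ᵇT-sound (tri up i k) (tri up i′ k′) eq with ∧-true {i ≡ᵇℤ i′} eq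
  ... | p , q = cong₂ (tri up) (≡ᵇℤ-sound i i′ p) (≡ᵇℤ-sound k k′ q)
  ≡ᵇT-sound (tri down i k) (tri down i′ k′) eq with ∧-true {i ≡ᵇℤ i′} eq
  ... | p , q = cong₂ (tri down) (≡ᵇℤ-sound i i′ p) (≡ᵇℤ-sound k k′ q)

  ≡ᵇT-refl : ∀ t → (t ≡ᵇT t) ≡ true
  ≡ᵇT-refl (tri up i k)   = cong₂ _∧_ (≡ᵇℤ-refl i) (≡ᵇℤ-refl k)
  ≡ᵇT-refl (tri down i k) = cong₂ _∧_ (≡ᵇℤ-refl i) (≡ᵇℤ-refl k)

  covers-up : ∀ l → covers l (upTri l) ≡ true
  covers-up l rewrite ≡ᵇT-refl (upTri l) = refl

  ∨-trueʳ : ∀ x → x ∨ true ≡ true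
  ∨-trueʳ true  = refl
  ∨-trueʳ false = refl

  covers-down : ∀ l → covers l (downTri l) ≡ true
  covers-down l rewrite ≡ᵇT-refl (downTri l) = ∨-trueʳ _

  covers-sound : ∀ l t → covers l t ≡ true → t ≡ upTri l ⊎ t ≡ downTri l
  covers-sound l t eq with t ≡ᵇT upTri l in eqᵘ
  ... | true  = inj₁ (≡ᵇT-sound t _ eqᵘ)
  ... | false = inj₂ (≡ᵇT-sound t _ eq)

  TriSet : Set
  TriSet = Tri → Bool

  _∖_ : TriSet → Lozenge → TriSet
  (r ∖ l) t = r t ∧ not (covers l t)

  contains : TriSet → Lozenge → Bool
  contains r l = r (upTri l) ∧ r (downTri l)

  sum : {A : Set} → (A → ℚ) → List A → ℚ
  sum f []       = 0ℚ
  sum f (x ∷ xs) = f x + sum f xs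

  sum-cong : ∀ {A : Set} {f g : A → ℚ} → f ≗ g → sum f ≗ sum g
  sum-cong eq []       = refl
  sum-cong eq (x ∷ xs) = cong₂ _+_ (eq x) (sum-cong eq xs)

  sum-⊕ : ∀ {A : Set} (f g : A → ℚ) xs → sum (f ⊕ g) xs ≡ sum f xs + sum g xs
  sum-⊕ f g []       = refl
  sum-⊕ f g (x ∷ xs) = trans (cong (λ z → f x + g x + z) (sum-⊕ f g xs))
    (solve 4 (λ a b u v → (a :+ b) :+ (u :+ v) := (a :+ u) :+ (b :+ v)) refl
       (f x) (g x) (sum f xs) (sum g xs))

  sum-⊙ : ∀ {A : Set} q (f : A → ℚ) xs → sum (q ⊙ f) xs ≡ q * sum f xs
  sum-⊙ q f []       = sym (*-zeroʳ q)
  sum-⊙ q f (x ∷ xs) = trans (cong (λ z → q * f x + z) (sum-⊙ q f xs)) (sym (*-distribˡ-+ q (f x) (sum f xs)))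

  sum-0 : ∀ {A : Set} {f : A → ℚ} → (∀ x → f x ≡ 0ℚ) → ∀ xs → sum f xs ≡ 0ℚ
  sum-0 f≡0 []       = refl
  sum-0 f≡0 (x ∷ xs) = cong₂ _+_ (f≡0 x) (sum-0 f≡0 xs)

  sum-++ : ∀ {A : Set} (f : A → ℚ) xs ys → sum f (xs ++ ys) ≡ sum f xs + sum f ys
  sum-++ f []       ys = sym (+-identityˡ (sum f ys))
  sum-++ f (x ∷ xs) ys = trans (cong (f x +_) (sum-++ f xs ys)) (sym (+-assoc (f x) (sum f xs) (sum f ys)))

  sum-concatMap : ∀ {A B : Set} (f : B → ℚ) (g : A → List B) xs →
    sum f (concatMap g xs) ≡ sum (λ x → sum f (g x)) xs
  sum-concatMap f g []       = refl
  sum-concatMap f g (x ∷ xs) = trans (sum-++ f (g x) (concatMap g xs))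
    (cong (sum f (g x) +_) (sum-concatMap f g xs))

  sum-map : ∀ {A B : Set} (f : B → ℚ) (g : A → B) xs → sum f (map g xs) ≡ sum (f ∘ g) xs
  sum-map f g []       = refl
  sum-map f g (x ∷ xs) = cong (f (g x) +_) (sum-map f g xs)

  sum-filter : ∀ {A : Set} (f : A → ℚ) p → (∀ x → p x ≡ false → f x ≡ 0ℚ) →
    ∀ xs → sum f (filterᵇ p xs) ≡ sum f xs
  sum-filter f p z []       = refl
  sum-filter f p z (x ∷ xs) with p x in eq
  ... | true  = cong (f x +_) (sum-filter f p z xs)
  ... | false = trans (sum-filter f p z xs)
    (sym (trans (cong (_+ sum f xs) (z x eq)) (+-identityˡ (sum f xs))))

  all?-cong : ∀ {A : Set} {p q : A → Bool} xs → (∀ x → x ∈ xs → p x ≡ q x) → all? p xs ≡ all? q xs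
  all?-cong []       eq = refl
  all?-cong (x ∷ xs) eq = cong₂ _∧_ (eq x (here refl)) (all?-cong xs (λ y → eq y ∘ there))

  all?-false : ∀ {A : Set} {p : A → Bool} {x} xs → x ∈ xs → p x ≡ false → all? p xs ≡ false
  all?-false {p = p} (x ∷ xs) (here refl) eq rewrite eq = refl
  all?-false {p = p} (y ∷ xs) (there x∈)  eq =
    trans (cong (p y ∧_) (all?-false xs x∈ eq)) (∧-zeroʳ (p y))

  all?-true : ∀ {A : Set} {p : A → Bool} xs → (∀ x → p x ≡ true) → all? p xs ≡ true
  all?-true []       eq = refl
  all?-true (x ∷ xs) eq = cong₂ _∧_ (eq x) (all?-true xs eq)

  if-cong : ∀ {A : Set} {b b′ : Bool} {x y : A} → b ≡ b′ → (if b then x else y) ≡ (if b′ then x else y)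
  if-cong refl = refl

  -- Weighted exact covers of the set r by lozenges from a list; Ts lists the triangles to be covered.
  module Cover (Ts : List Tri) (wt : Lozenge → ℚ) where

    Z : List Lozenge → TriSet → ℚ
    Z []       r = if all? (not ∘ r) Ts then 1ℚ else 0ℚ
    Z (l ∷ ls) r = (if contains r l then wt l * Z ls (r ∖ l) else 0ℚ) + Z ls r

    Z-cong : ∀ ls {r s} → r ≗ s → Z ls r ≡ Z ls s
    Z-cong []       eq = if-cong (all?-cong Ts (λ t _ → cong not (eq t)))
    Z-cong (l ∷ ls) {r} {s} eq = cong₂ _+_
      (trans (cong (λ z → if contains r l then wt l * z else 0ℚ)
                (Z-cong ls (λ t → cong (_∧ not (covers l t)) (eq t))))
             (if-cong (cong₂ _∧_ (eq (upTri l)) (eq (downTri l)))))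
      (Z-cong ls eq)

    Z-empty : ∀ ls {r} → (∀ t → r t ≡ false) → Z ls r ≡ 1ℚ
    Z-empty []       eq = if-cong (all?-true Ts (λ t → cong not (eq t)))
    Z-empty (l ∷ ls) {r} eq = cong₂ _+_
      (if-cong {x = wt l * Z ls (r ∖ l)} {y = 0ℚ} (cong (_∧ r (downTri l)) (eq (upTri l)))) (Z-empty ls eq)

    -- The remaining choices run over all of `ls`, with l among them if it occurs there. This is
    -- harmless, since the triangles of l are gone, and it makes the summand independent of the
    -- place of l in the list.
    branch : List Lozenge → TriSet → Tri → Lozenge → ℚ
    branch ls r t l = if covers l t then (if contains r l then wt l * Z ls (r ∖ l) else 0ℚ) else 0ℚ

    private
      covered-dead : ∀ r l t → covers l t ≡ true → (r ∖ l) t ≡ false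
      covered-dead r l t eq rewrite eq = ∧-zeroʳ (r t)

      uncovered : ∀ r l t → covers l t ≡ false → (r ∖ l) t ≡ r t
      uncovered r l t eq rewrite eq = ∧-identityʳ (r t)

      contains-dead : ∀ {r} l t → covers l t ≡ true → r t ≡ false → contains r l ≡ false
      contains-dead {r} l t cv dead with covers-sound l t cv
      ... | inj₁ refl = cong (_∧ r (downTri l)) dead
      ... | inj₂ refl = trans (cong (r (upTri l) ∧_) dead) (∧-zeroʳ (r (upTri l)))

      Z-skip : ∀ l ls {r} → contains r l ≡ false → Z (l ∷ ls) r ≡ Z ls r
      Z-skip l ls {r} eq = trans (cong (_+ Z ls r) (if-cong eq)) (+-identityˡ (Z ls r))

      ∖-comm : ∀ r l l′ → ((r ∖ l) ∖ l′) ≗ ((r ∖ l′) ∖ l)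
      ∖-comm r l l′ t = trans (∧-assoc (r t) _ _)
        (trans (cong (r t ∧_) (∧-comm (not (covers l t)) _)) (sym (∧-assoc (r t) _ _)))

      -- Two lozenges can be placed in either order: each order is possible exactly when both
      -- lozenges lie in r and are disjoint. In `pivot` this moves the lozenge that covers t in
      -- front of the head of the list.
      exchange : ∀ r l l′ (z : ℚ) →
        (if contains r l then wt l * (if contains (r ∖ l) l′ then wt l′ * z else 0ℚ) else 0ℚ) ≡
        (if contains r l′ then wt l′ * (if contains (r ∖ l′) l then wt l * z else 0ℚ) else 0ℚ)
      exchange r l l′ z = trans (merge (contains r l) (contains (r ∖ l) l′) (wt l) (wt l′))
        (trans (if-cong disj)
        (trans (cong (λ x → if contains r l′ ∧ contains (r ∖ l′) l then x else 0ℚ)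
                 (solve 3 (λ a b c → a :* (b :* c) := b :* (a :* c)) refl (wt l) (wt l′) z))
               (sym (merge (contains r l′) (contains (r ∖ l′) l) (wt l′) (wt l)))))
        where
        merge : ∀ p q x y → (if p then x * (if q then y * z else 0ℚ) else 0ℚ) ≡
                            (if p ∧ q then x * (y * z) else 0ℚ)
        merge true  true  x y = refl
        merge true  false x y = *-zeroʳ x
        merge false q     x y = refl
        sub : ∀ m n → contains r m ∧ contains (r ∖ m) n ≡ true → contains r n ∧ contains (r ∖ n) m ≡ true
        sub m n h with ∧-true {contains r m} h
        ... | rm , h′ with ∧-true {r (upTri m)} rm | ∧-true {(r ∖ m) (upTri n)} h′
        ... | ru , rd | hu , hd with ∧-true {r (upTri n)} hu | ∧-true {r (downTri n)} hd
        ... | nu , nu′ | nd , nd′ =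
          cong₂ _∧_ (cong₂ _∧_ nu nd)
            (cong₂ _∧_ (cong₂ _∧_ ru (free (upTri m) (covers-up m)))
                       (cong₂ _∧_ rd (free (downTri m) (covers-down m))))
          where
          free : ∀ t → covers m t ≡ true → not (covers n t) ≡ true
          free t cm with covers n t in cn
          ... | false = refl
          ... | true with covers-sound n t cn
          ...   | inj₁ refl = trans (cong not (sym cm)) nu′
          ...   | inj₂ refl = trans (cong not (sym cm)) nd′
        disj : contains r l ∧ contains (r ∖ l) l′ ≡ contains r l′ ∧ contains (r ∖ l′) l
        disj with contains r l ∧ contains (r ∖ l) l′ in eq₁ | contains r l′ ∧ contains (r ∖ l′) l in eq₂
        ... | true  | true  = refl
        ... | false | false = refl
        ... | true  | false = trans (sym (sub l l′ eq₁)) eq₂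
        ... | false | true  = trans (sym eq₁) (sub l′ l eq₂)

    if-+ : ∀ b {x y} → (if b then x + y else 0ℚ) ≡ (if b then x else 0ℚ) + (if b then y else 0ℚ)
    if-+ true  = refl
    if-+ false = refl

    if-* : ∀ b {q x} → (if b then q * x else 0ℚ) ≡ q * (if b then x else 0ℚ)
    if-* true  = refl
    if-* false {q} = sym (*-zeroʳ q)

    -- Exactly one lozenge of a cover contains t. If the head of the list covers t, it is dead in
    -- every other branch; if not, the decision about the head commutes with the choice at t.
    pivot : ∀ ls {r} t → t ∈ Ts → r t ≡ true → Z ls r ≡ sum (branch ls r t) ls
    pivot []       {r} t t∈ rt = if-cong (all?-false Ts t∈ (cong not rt))
    pivot (l ∷ ls) {r} t t∈ rt with covers l t in cv
    ... | true  = cong₂ _+_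
      (cong (λ z → if contains r l then wt l * z else 0ℚ)
         (sym (Z-skip l ls (contains-dead {r ∖ l} l t cv (covered-dead r l t cv)))))
      (trans (pivot ls t t∈ rt) (sum-cong same ls))
      where
      same : ∀ l′ → branch ls r t l′ ≡ branch (l ∷ ls) r t l′
      same l′ with covers l′ t in cv′
      ... | false = refl
      ... | true  = cong (λ z → if contains r l′ then wt l′ * z else 0ℚ)
        (sym (Z-skip l ls (contains-dead {r ∖ l′} l t cv (covered-dead r l′ t cv′))))
    ... | false = begin
      (if contains r l then wt l * Z ls (r ∖ l) else 0ℚ) + Z ls r
        ≡⟨ cong₂ _+_ (cong (λ z → if contains r l then wt l * z else 0ℚ)
              (pivot ls t t∈ (trans (uncovered r l t cv) rt))) (pivot ls t t∈ rt) ⟩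
      (if contains r l then wt l * sum (branch ls (r ∖ l) t) ls else 0ℚ) + sum (branch ls r t) ls
        ≡⟨ cong (_+ sum (branch ls r t) ls) (inside (contains r l)) ⟩
      sum (λ l′ → if contains r l then wt l * branch ls (r ∖ l) t l′ else 0ℚ) ls + sum (branch ls r t) ls
        ≡⟨ sym (sum-⊕ _ (branch ls r t) ls) ⟩
      sum (λ l′ → (if contains r l then wt l * branch ls (r ∖ l) t l′ else 0ℚ) + branch ls r t l′) ls
        ≡⟨ sum-cong same ls ⟩
      sum (branch (l ∷ ls) r t) ls
        ≡⟨ sym (+-identityˡ _) ⟩
      0ℚ + sum (branch (l ∷ ls) r t) ls ∎
      where
      open ≡-Reasoning
      inside : ∀ b → (if b then wt l * sum (branch ls (r ∖ l) t) ls else 0ℚ) ≡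
               sum (λ l′ → if b then wt l * branch ls (r ∖ l) t l′ else 0ℚ) ls
      inside true  = sym (sum-⊙ (wt l) (branch ls (r ∖ l) t) ls)
      inside false = sym (sum-0 (λ _ → refl) ls)
      same : ∀ l′ → (if contains r l then wt l * branch ls (r ∖ l) t l′ else 0ℚ) + branch ls r t l′ ≡
             branch (l ∷ ls) r t l′
      same l′ with covers l′ t in cv′
      ... | false = trans (+-identityʳ _) (zero-if (contains r l))
        where
        zero-if : ∀ b → (if b then wt l * 0ℚ else 0ℚ) ≡ 0ℚ
        zero-if true  = *-zeroʳ (wt l)
        zero-if false = refl
      ... | true  = begin
        (if contains r l then wt l * (if contains (r ∖ l) l′ then wt l′ * Z ls ((r ∖ l) ∖ l′) else 0ℚ) else 0ℚ)
          + (if contains r l′ then wt l′ * Z ls (r ∖ l′) else 0ℚ)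
          ≡⟨ cong (_+ (if contains r l′ then wt l′ * Z ls (r ∖ l′) else 0ℚ))
               (trans (exchange r l l′ (Z ls ((r ∖ l) ∖ l′)))
                 (cong (λ z → if contains r l′ then wt l′ * (if contains (r ∖ l′) l then wt l * z else 0ℚ) else 0ℚ)
                   (Z-cong ls (∖-comm r l l′)))) ⟩
        (if contains r l′ then wt l′ * (if contains (r ∖ l′) l then wt l * Z ls ((r ∖ l′) ∖ l) else 0ℚ) else 0ℚ)
          + (if contains r l′ then wt l′ * Z ls (r ∖ l′) else 0ℚ)
          ≡⟨ sym (if-+ (contains r l′)) ⟩
        (if contains r l′ then wt l′ * (if contains (r ∖ l′) l then wt l * Z ls ((r ∖ l′) ∖ l) else 0ℚ)
                               + wt l′ * Z ls (r ∖ l′) else 0ℚ)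
          ≡⟨ cong (λ z → if contains r l′ then z else 0ℚ) (sym (*-distribˡ-+ (wt l′) _ _)) ⟩
        (if contains r l′ then wt l′ * Z (l ∷ ls) (r ∖ l′) else 0ℚ) ∎

    -- `isTiling` relative to the set r still to be covered: a triangle outside r has to be hit by
    -- no lozenge at all. In this form the condition passes from l ∷ ls with r to ls with r ∖ l.
    matches : TriSet → List Lozenge → Bool
    matches r ls = all? (λ t → length (filterᵇ (λ l → covers l t) ls) ℕ.≡ᵇ (if r t then 1 else 0)) Ts

    term : TriSet → List Lozenge → ℚ
    term r ls = if matches r ls then weightOf wt ls else 0ℚ

    private
      matches-∷ : ∀ r l ls → contains r l ≡ true → matches r (l ∷ ls) ≡ matches (r ∖ l) ls
      matches-∷ r l ls c = all?-cong Ts (λ t _ → pointwise t)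
        where
        pointwise : ∀ t → (length (filterᵇ (λ l → covers l t) (l ∷ ls)) ℕ.≡ᵇ (if r t then 1 else 0)) ≡
                          (length (filterᵇ (λ l → covers l t) ls) ℕ.≡ᵇ (if (r ∖ l) t then 1 else 0))
        pointwise t with covers l t in cv
        ... | false rewrite ∧-identityʳ (r t) = refl
        ... | true with covers-sound l t cv
        ...   | inj₁ refl rewrite proj₁ (∧-true {r (upTri l)} c) = refl
        ...   | inj₂ refl rewrite proj₂ (∧-true {r (upTri l)} c) = refl

      matches-dead : ∀ r l ls t → t ∈ Ts → covers l t ≡ true → r t ≡ false → matches r (l ∷ ls) ≡ false
      matches-dead r l ls t t∈ cv dead = all?-false Ts t∈ pointwise
        where
        pointwise : (length (filterᵇ (λ l → covers l t) (l ∷ ls)) ℕ.≡ᵇ (if r t then 1 else 0)) ≡ false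
        pointwise rewrite cv | dead = refl

      matches-¬contains : ∀ r l ls → upTri l ∈ Ts → downTri l ∈ Ts → contains r l ≡ false →
        matches r (l ∷ ls) ≡ false
      matches-¬contains r l ls u∈ d∈ c with r (upTri l) in ru
      ... | false = matches-dead r l ls (upTri l) u∈ (covers-up l) ru
      ... | true  = matches-dead r l ls (downTri l) d∈ (covers-down l) c

      term-∷ : ∀ r l ls → upTri l ∈ Ts → downTri l ∈ Ts →
        term r (l ∷ ls) ≡ (if contains r l then wt l * term (r ∖ l) ls else 0ℚ)
      term-∷ r l ls u∈ d∈ with contains r l in c
      ... | true  = trans (if-cong (matches-∷ r l ls c)) (if-* (matches (r ∖ l) ls) {wt l} {weightOf wt ls})
      ... | false = if-cong (matches-¬contains r l ls u∈ d∈ c)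

    -- Sub-lists are paired according to whether they contain the head. Both triangles of every
    -- lozenge have to occur in `Ts`, since otherwise the test would overlook a lozenge that sticks
    -- out of r.
    sum-subsets : ∀ ls r → All (λ l → upTri l ∈ Ts × downTri l ∈ Ts) ls →
      sum (term r) (subsets ls) ≡ Z ls r
    sum-subsets [] r [] = trans (+-identityʳ _) (if-cong (all?-cong Ts (λ t _ → base (r t))))
      where
      base : ∀ b → (0 ℕ.≡ᵇ (if b then 1 else 0)) ≡ not b
      base true  = refl
      base false = refl
    sum-subsets (l ∷ ls) r ((u∈ , d∈) ∷ ts) = begin
      sum (term r) (map (l ∷_) (subsets ls) ++ subsets ls)
        ≡⟨ sum-++ (term r) (map (l ∷_) (subsets ls)) (subsets ls) ⟩
      sum (term r) (map (l ∷_) (subsets ls)) + sum (term r) (subsets ls)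
        ≡⟨ cong₂ _+_ (trans (sum-map (term r) (l ∷_) (subsets ls))
                     (trans (sum-cong (λ S → term-∷ r l S u∈ d∈) (subsets ls)) (outside (contains r l))))
             (sum-subsets ls r ts) ⟩
      (if contains r l then wt l * Z ls (r ∖ l) else 0ℚ) + Z ls r ∎
      where
      open ≡-Reasoning
      outside : ∀ b → sum (λ S → if b then wt l * term (r ∖ l) S else 0ℚ) (subsets ls) ≡
                (if b then wt l * Z ls (r ∖ l) else 0ℚ)
      outside true  = trans (sum-⊙ (wt l) (term (r ∖ l)) (subsets ls))
        (cong (wt l *_) (sum-subsets ls (r ∖ l) ts))
      outside false = sum-0 (λ _ → refl) (subsets ls)

-- The region in natural-number coordinates.

module Coordinates where

  open import Data.Nat using (_+_; _*_)
  open ExactCovers using (∧-true; ≡ᵇℤ-sound; ≡ᵇℤ-refl)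

  true⇔true : ∀ {x y} → (x ≡ true → y ≡ true) → (y ≡ true → x ≡ true) → x ≡ y
  true⇔true {true}  {true}  f g = refl
  true⇔true {true}  {false} f g = sym (f refl)
  true⇔true {false} {true}  f g = g refl
  true⇔true {false} {false} f g = refl

  T⇒≡ : ∀ {x} → T x → x ≡ true
  T⇒≡ = Equivalence.to T-≡

  ≡⇒T : ∀ {x} → x ≡ true → T x
  ≡⇒T = Equivalence.from T-≡

  ≤ᵇ-sound : ∀ {m n} → (m ≤ᵇ n) ≡ true → m ≤ n
  ≤ᵇ-sound {m} {n} eq = ℕₚ.≤ᵇ⇒≤ m n (≡⇒T eq)

  ≤ᵇ-complete : ∀ {m n} → m ≤ n → (m ≤ᵇ n) ≡ true
  ≤ᵇ-complete p = T⇒≡ (ℕₚ.≤⇒≤ᵇ p)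

  ≤ᵇ-false : ∀ {m n} → (m ≤ᵇ n) ≡ false → n < m
  ≤ᵇ-false {m} {n} eq with n ℕₚ.<? m
  ... | yes p = p
  ... | no ¬p with trans (sym eq) (≤ᵇ-complete (ℕₚ.≮⇒≥ ¬p))
  ...   | ()

  ≡ᵇ-sound : ∀ {m n} → (m ≡ᵇ n) ≡ true → m ≡ n
  ≡ᵇ-sound {m} {n} eq = ℕₚ.≡ᵇ⇒≡ m n (≡⇒T eq)

  ≡ᵇ-refl : ∀ m → (m ≡ᵇ m) ≡ true
  ≡ᵇ-refl m = T⇒≡ (ℕₚ.≡⇒≡ᵇ m m refl)

  -- n − m = (y − x) + k, written without subtraction.
  linear : ∀ k {x y m n} → x ≤ y → n + x ≡ m + y + k → m ≤ n
  linear k {x} {y} {m} {n} x≤y eq = ℕₚ.+-cancelʳ-≤ y m n (begin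
    m + y      ≤⟨ ℕₚ.m≤m+n (m + y) k ⟩
    m + y + k  ≡⟨ sym eq ⟩
    n + x      ≤⟨ ℕₚ.+-monoʳ-≤ n x≤y ⟩
    n + y      ∎)
    where open ℕₚ.≤-Reasoning

  double-cancel-≤ : ∀ {m n} → 2 * m ≤ 2 * n + 1 → m ≤ n
  double-cancel-≤ {m} {n} p with m ℕₚ.≤? n
  ... | yes q = q
  ... | no ¬q = ⊥-elim (ℕₚ.<-irrefl refl (begin-strict
    2 * n + 1      <⟨ ℕₚ.≤-reflexive (ℕ-Ring.solve (n ∷ [])) ⟩
    2 * (suc n)    ≤⟨ ℕₚ.*-monoʳ-≤ 2 (ℕₚ.≰⇒> ¬q) ⟩
    2 * m          ≤⟨ p ⟩
    2 * n + 1      ∎))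
    where open ℕₚ.≤-Reasoning

  open import Data.Integer using (+_)

  -- A comparison depends only on the difference of its sides, so each inequality over ℤ that
  -- describes the region becomes one over ℕ free of subtraction.
  ≤ᵇ-shift : ∀ x y m n → y ℤ.- x ≡ + n ℤ.- + m → (x ℤ.≤ᵇ y) ≡ (m ≤ᵇ n)
  ≤ᵇ-shift x y m n eq = true⇔true
    (λ p → ≤ᵇ-complete {m} {n} (ℤₚ.drop‿+≤+ (ℤₚ.0≤i-j⇒j≤i {+ n} {+ m}
       (subst (+ 0 ℤ.≤_) eq (ℤₚ.i≤j⇒0≤j-i (ℤₚ.≤ᵇ⇒≤ {x} {y} (≡⇒T p)))))))
    (λ p → T⇒≡ (ℤₚ.≤⇒≤ᵇ {x} {y} (ℤₚ.0≤i-j⇒j≤i {y} {x}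
       (subst (+ 0 ℤ.≤_) (sym eq) (ℤₚ.i≤j⇒0≤j-i (ℤ.+≤+ (≤ᵇ-sound {m} {n} p)))))))

  module Geometry (a b c : ℕ) where

    height : ℕ
    height = a + b + 2

    -- The index j counts columns from the right: j = c ∸ i.  The up-triangle at (j , t) and the
    -- down-triangle at (j , t ∸ 1) lie above and below the j-th horizontal edge at height t, and
    -- onLine says whether this edge belongs to the region.
    column : ℕ → ℤ
    column j = + c ℤ.- + j

    onLine : ℕ → ℕ → Bool
    onLine t j = (t ≤ᵇ b + j) ∧ (j ≤ᵇ a + c + 1) ∧ (2 * j ≤ᵇ t + 2 * c + 1)

    -- The side CD is built into j being a natural number. The three bounds of `onLine` are the line
    -- of DE, the side FA and the zigzag. The removed triangle lies in the column c - 1, hence at j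
    -- = 1.
    memℕ : Orientation → ℕ → ℕ → Bool
    memℕ up   j t = (suc t ≤ᵇ height) ∧ onLine t j ∧ not ((j ≡ᵇ 1) ∧ (t ≡ᵇ suc b))
    memℕ down j t = (suc t ≤ᵇ height) ∧ onLine (suc t) j

    onLine-sound : ∀ {t j} → onLine t j ≡ true → t ≤ b + j × j ≤ a + c + 1 × 2 * j ≤ t + 2 * c + 1
    onLine-sound {t} {j} eq with ∧-true {t ≤ᵇ b + j} eq
    ... | p , eq′ with ∧-true {j ≤ᵇ a + c + 1} eq′
    ... | q , r = ≤ᵇ-sound p , ≤ᵇ-sound q , ≤ᵇ-sound r

    onLine-complete : ∀ t j → t ≤ b + j → j ≤ a + c + 1 → 2 * j ≤ t + 2 * c + 1 → onLine t j ≡ true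
    onLine-complete t j p q r = cong₂ _∧_ (≤ᵇ-complete p) (cong₂ _∧_ (≤ᵇ-complete q) (≤ᵇ-complete r))

    column-involutive : ∀ j → + c ℤ.- column j ≡ + j
    column-involutive j = e (+ c) (+ j)
      where
      e : ∀ c j → c ℤ.- (c ℤ.- j) ≡ j
      e = ℤ-Ring.solve-∀

    column-injective : ∀ {j k} → column j ≡ column k → j ≡ k
    column-injective {j} {k} eq = ℤₚ.+-injective
      (trans (sym (column-involutive j)) (trans (cong (λ z → + c ℤ.- z) eq) (column-involutive k)))

    ≡ᵇT-ℕ : ∀ o j t j′ t′ →
      (tri o (column j) (+ t) ≡ᵇT tri o (column j′) (+ t′)) ≡ (j ≡ᵇ j′) ∧ (t ≡ᵇ t′)
    ≡ᵇT-ℕ o j t j′ t′ = trans (orient o) (cong₂ _∧_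
      (true⇔true
        (λ p → subst (λ z → (z ≡ᵇ j′) ≡ true)
                 (sym (column-injective {j} {j′} (≡ᵇℤ-sound (column j) (column j′) p))) (≡ᵇ-refl j′))
        (λ p → subst (λ z → (column z ≡ᵇℤ column j′) ≡ true)
                 (sym (≡ᵇ-sound {j} {j′} p)) (≡ᵇℤ-refl (column j′))))
      (true⇔true
        (λ p → subst (λ z → (z ≡ᵇ t′) ≡ true)
                 (sym (ℤₚ.+-injective (≡ᵇℤ-sound (+ t) (+ t′) p))) (≡ᵇ-refl t′))
        (λ p → subst (λ z → (+ z ≡ᵇℤ + t′) ≡ true)
                 (sym (≡ᵇ-sound {t} {t′} p)) (≡ᵇℤ-refl (+ t′)))))
      where
      orient : ∀ o → (tri o (column j) (+ t) ≡ᵇT tri o (column j′) (+ t′)) ≡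
                     (column j ≡ᵇℤ column j′) ∧ (+ t ≡ᵇℤ + t′)
      orient up   = refl
      orient down = refl

    private
      -- The pair (δ, ε) is the offset of a vertex from the point (`column j`, t).
      hexℕ : ℕ → ℕ → ℕ → ℕ → Bool
      hexℕ j t δ ε = (t + ε ≤ᵇ height) ∧ (j ≤ᵇ c + a + 1 + δ) ∧ (δ ≤ᵇ suc j) ∧
                     (j ≤ᵇ c + δ + t + ε) ∧ (δ + t + ε ≤ᵇ b + 1 + j)

      inHex-ℕ : ∀ j t δ ε {i k} → i ≡ column j ℤ.+ + δ → k ≡ + (t + ε) →
        inHex a b c (pt i k) ≡ hexℕ j t δ ε
      inHex-ℕ j t δ ε refl refl = cong (λ z → (t + ε ≤ᵇ height) ∧ z)
        (cong₂ _∧_ (≤ᵇ-shift (ℤ.- (+ suc a)) i j (c + a + 1 + δ) (e₁ (+ c) (+ j) (+ δ) (+ a)))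
        (cong₂ _∧_ (≤ᵇ-shift i (+ suc c) δ (suc j) (e₂ (+ c) (+ j) (+ δ)))
        (cong₂ _∧_ (≤ᵇ-shift (+ 0) (i ℤ.+ + (t + ε)) j (c + δ + t + ε) (e₃ (+ c) (+ j) (+ δ) (+ t) (+ ε)))
                   (≤ᵇ-shift (i ℤ.+ + (t + ε)) (+ (c + b + 1)) (δ + t + ε) (b + 1 + j) (e₄ (+ c) (+ j) (+ δ) (+ t) (+ ε) (+ b))))))
        where
        i : ℤ
        i = column j ℤ.+ + δ
        e₁ : ∀ c j δ a → (c ℤ.- j ℤ.+ δ) ℤ.- (ℤ.- (+ 1 ℤ.+ a)) ≡ c ℤ.+ a ℤ.+ + 1 ℤ.+ δ ℤ.- j
        e₁ = ℤ-Ring.solve-∀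
        e₂ : ∀ c j δ → (+ 1 ℤ.+ c) ℤ.- (c ℤ.- j ℤ.+ δ) ≡ + 1 ℤ.+ j ℤ.- δ
        e₂ = ℤ-Ring.solve-∀
        e₃ : ∀ c j δ t ε → (c ℤ.- j ℤ.+ δ) ℤ.+ (t ℤ.+ ε) ℤ.- + 0 ≡ c ℤ.+ δ ℤ.+ t ℤ.+ ε ℤ.- j
        e₃ = ℤ-Ring.solve-∀
        e₄ : ∀ c j δ t ε b → (c ℤ.+ b ℤ.+ + 1) ℤ.- ((c ℤ.- j ℤ.+ δ) ℤ.+ (t ℤ.+ ε)) ≡
             b ℤ.+ + 1 ℤ.+ j ℤ.- (δ ℤ.+ t ℤ.+ ε)
        e₄ = ℤ-Ring.solve-∀

      Hex : ℕ → ℕ → ℕ → ℕ → Set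
      Hex j t δ ε = t + ε ≤ height × j ≤ c + a + 1 + δ × δ ≤ suc j × j ≤ c + δ + t + ε × δ + t + ε ≤ b + 1 + j

      hex-sound : ∀ j t δ ε → hexℕ j t δ ε ≡ true → Hex j t δ ε
      hex-sound j t δ ε eq with ∧-true {t + ε ≤ᵇ height} eq
      ... | p , eq₁ with ∧-true {j ≤ᵇ c + a + 1 + δ} eq₁
      ... | q , eq₂ with ∧-true {δ ≤ᵇ suc j} eq₂
      ... | r , eq₃ with ∧-true {j ≤ᵇ c + δ + t + ε} eq₃
      ... | s , u = ≤ᵇ-sound p , ≤ᵇ-sound q , ≤ᵇ-sound r , ≤ᵇ-sound s , ≤ᵇ-sound u

      hex-complete : ∀ j t δ ε → Hex j t δ ε → hexℕ j t δ ε ≡ true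
      hex-complete j t δ ε (p , q , r , s , u) = cong₂ _∧_ (≤ᵇ-complete p) (cong₂ _∧_ (≤ᵇ-complete q)
        (cong₂ _∧_ (≤ᵇ-complete r) (cong₂ _∧_ (≤ᵇ-complete s) (≤ᵇ-complete u))))

      column+0 : ∀ j → column j ≡ column j ℤ.+ + 0
      column+0 j = sym (ℤₚ.+-identityʳ (column j))

      +t : ∀ t → + t ≡ + (t + 0)
      +t t = cong +_ (sym (ℕₚ.+-identityʳ t))

      zigzag : ℕ → ℕ → ℕ → Bool
      zigzag t j o = if t ≤ᵇ 2 * a then 2 * j ≤ᵇ t + 2 * c + o else true

      zigzag-up : ∀ j t → rightOfZ a (tri up (column j) (+ t)) ≡ zigzag t j 1
      zigzag-up j t = cong (λ z → if t ≤ᵇ 2 * a then z else true)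
        (≤ᵇ-shift (+ 0) (+ 2 ℤ.* column j ℤ.+ + t ℤ.+ + 1) (2 * j) (t + 2 * c + 1) (e (+ c) (+ j) (+ t)))
        where
        e : ∀ c j t → (+ 2 ℤ.* (c ℤ.- j) ℤ.+ t ℤ.+ + 1) ℤ.- + 0 ≡
            t ℤ.+ (c ℤ.+ (c ℤ.+ + 0)) ℤ.+ + 1 ℤ.- (j ℤ.+ (j ℤ.+ + 0))
        e = ℤ-Ring.solve-∀

      zigzag-down : ∀ j t → rightOfZ a (tri down (column j) (+ t)) ≡ zigzag t j 2
      zigzag-down j t = cong (λ z → if t ≤ᵇ 2 * a then z else true)
        (≤ᵇ-shift (+ 0) (+ 2 ℤ.* column j ℤ.+ + t ℤ.+ + 2) (2 * j) (t + 2 * c + 2) (e (+ c) (+ j) (+ t)))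
        where
        e : ∀ c j t → (+ 2 ℤ.* (c ℤ.- j) ℤ.+ t ℤ.+ + 2) ℤ.- + 0 ≡
            t ℤ.+ (c ℤ.+ (c ℤ.+ + 0)) ℤ.+ + 2 ℤ.- (j ℤ.+ (j ℤ.+ + 0))
        e = ℤ-Ring.solve-∀

      -- Above height 2a the side FA implies the zigzag inequality, so the single bound in `onLine`
      -- serves at all heights although `rightOfZ` distinguishes two cases.
      above : ∀ t j o → 2 * a < t → j ≤ a + c + 1 → 2 * j ≤ t + 2 * c + suc o
      above t j o p q = linear o (ℕₚ.+-mono-≤ p (ℕₚ.*-monoʳ-≤ 2 q)) (eq t c o a j)
        where
        eq : ∀ t c o a j → t + 2 * c + suc o + (suc (2 * a) + 2 * j) ≡ 2 * j + (t + 2 * (a + c + 1)) + o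
        eq = ℕ-Ring.solve-∀

      zigzag-sound : ∀ t j o → zigzag t j (suc o) ≡ true → j ≤ a + c + 1 → 2 * j ≤ t + 2 * c + suc o
      zigzag-sound t j o eq q with t ≤ᵇ 2 * a in below
      ... | true  = ≤ᵇ-sound {2 * j} eq
      ... | false = above t j o (≤ᵇ-false {t} below) q

      zigzag-complete : ∀ t j o → 2 * j ≤ t + 2 * c + o → zigzag t j o ≡ true
      zigzag-complete t j o p with t ≤ᵇ 2 * a
      ... | true  = ≤ᵇ-complete p
      ... | false = refl

      q-bound : ∀ j δ → j ≤ a + c + 1 → j ≤ c + a + 1 + δ
      q-bound j δ j≤ = linear δ j≤ (ℕ-Ring.solve (c ∷ a ∷ δ ∷ j ∷ []))

      q-bound′ : ∀ j → j ≤ c + a + 1 + 0 → j ≤ a + c + 1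
      q-bound′ j q = linear 0 q (ℕ-Ring.solve (a ∷ c ∷ j ∷ []))

      r-bound : ∀ j t δ ε → 2 * j ≤ t + 2 * c + 1 → j ≤ c + δ + t + ε
      r-bound j t δ ε 2j≤ = double-cancel-≤ {j} (linear (δ + δ + t + ε + ε) 2j≤ (ℕ-Ring.solve (c ∷ δ ∷ t ∷ ε ∷ j ∷ [])))

      r-bound′ : ∀ j t δ ε → 2 * j ≤ suc t + 2 * c + 1 → 1 ≤ δ + ε → j ≤ c + δ + t + ε
      r-bound′ j t δ ε 2j≤ p = double-cancel-≤ {j}
        (linear (t + δ + ε) (ℕₚ.+-mono-≤ 2j≤ p) (ℕ-Ring.solve (c ∷ δ ∷ t ∷ ε ∷ j ∷ [])))

      u-bound : ∀ j t δ ε → t ≤ b + j → δ + ε ≤ 1 → δ + t + ε ≤ b + 1 + j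
      u-bound j t δ ε t≤ p = linear 0 (ℕₚ.+-mono-≤ t≤ p) (ℕ-Ring.solve (δ ∷ t ∷ ε ∷ b ∷ j ∷ []))

      u-bound′ : ∀ j t δ ε → suc t ≤ b + j → δ + ε ≤ 2 → δ + t + ε ≤ b + 1 + j
      u-bound′ j t δ ε t≤ p = linear 0 (ℕₚ.+-mono-≤ t≤ p) (ℕ-Ring.solve (δ ∷ t ∷ ε ∷ b ∷ j ∷ []))

      h-bound₀ : ∀ {h} t → suc t ≤ h → t + 0 ≤ h
      h-bound₀ {h} t p = linear 1 p (ℕ-Ring.solve (t ∷ h ∷ []))

      h-bound₁ : ∀ {h} t → suc t ≤ h → t + 1 ≤ h
      h-bound₁ {h} t p = linear 0 p (ℕ-Ring.solve (t ∷ h ∷ []))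

      up-shape : ∀ j t → all? (inHex a b c) (vertices (tri up (column j) (+ t))) ∧ rightOfZ a (tri up (column j) (+ t))
                         ≡ (suc t ≤ᵇ height) ∧ onLine t j
      up-shape j t = trans
        (cong₂ _∧_
          (cong₂ _∧_ (inHex-ℕ j t 0 0 (column+0 j) (+t t))
          (cong₂ _∧_ (inHex-ℕ j t 1 0 refl (+t t))
          (cong (_∧ true) (inHex-ℕ j t 0 1 (column+0 j) refl))))
          (zigzag-up j t))
        (true⇔true to from)
        where
        to : (hexℕ j t 0 0 ∧ hexℕ j t 1 0 ∧ hexℕ j t 0 1 ∧ true) ∧ zigzag t j 1 ≡ true →
             (suc t ≤ᵇ height) ∧ onLine t j ≡ true
        to eq with ∧-true {hexℕ j t 0 0 ∧ hexℕ j t 1 0 ∧ hexℕ j t 0 1 ∧ true} eq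
        ... | h , z with ∧-true {hexℕ j t 0 0} h
        ... | h₀₀ , h′ with ∧-true {hexℕ j t 1 0} h′
        ... | h₁₀ , h″ with ∧-true {hexℕ j t 0 1} h″
        ... | h₀₁ , _ with hex-sound j t 0 0 h₀₀ | hex-sound j t 1 0 h₁₀ | hex-sound j t 0 1 h₀₁
        ... | _ , q , _ | _ , _ , _ , _ , u | p , _ =
          cong₂ _∧_ (≤ᵇ-complete {suc t} {height} (subst (_≤ height) (ℕₚ.+-comm t 1) p))
            (onLine-complete t j (linear 0 u (ℕ-Ring.solve (b ∷ j ∷ t ∷ []))) (q-bound′ j q) (zigzag-sound t j 0 z (q-bound′ j q)))
        from : (suc t ≤ᵇ height) ∧ onLine t j ≡ true →
               (hexℕ j t 0 0 ∧ hexℕ j t 1 0 ∧ hexℕ j t 0 1 ∧ true) ∧ zigzag t j 1 ≡ true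
        from eq with ∧-true {suc t ≤ᵇ height} eq
        ... | p , eq′ with ≤ᵇ-sound {suc t} p | onLine-sound eq′
        ... | t<h | t≤ , j≤ , 2j≤ = cong₂ _∧_
          (cong₂ _∧_ (hex-complete j t 0 0 (h-bound₀ t t<h , q-bound j 0 j≤ , z≤n , r-bound j t 0 0 2j≤ , u-bound j t 0 0 t≤ z≤n))
          (cong₂ _∧_ (hex-complete j t 1 0 (h-bound₀ t t<h , q-bound j 1 j≤ , s≤s z≤n , r-bound j t 1 0 2j≤ , u-bound j t 1 0 t≤ (s≤s z≤n)))
          (cong₂ _∧_ (hex-complete j t 0 1 (h-bound₁ t t<h , q-bound j 0 j≤ , z≤n , r-bound j t 0 1 2j≤ , u-bound j t 0 1 t≤ (s≤s z≤n))) refl)))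
          (zigzag-complete t j 1 2j≤)

      down-shape : ∀ j t → all? (inHex a b c) (vertices (tri down (column j) (+ t))) ∧ rightOfZ a (tri down (column j) (+ t))
                           ≡ (suc t ≤ᵇ height) ∧ onLine (suc t) j
      down-shape j t = trans
        (cong₂ _∧_
          (cong₂ _∧_ (inHex-ℕ j t 1 0 refl (+t t))
          (cong₂ _∧_ (inHex-ℕ j t 0 1 (column+0 j) refl)
          (cong (_∧ true) (inHex-ℕ j t 1 1 refl refl))))
          (zigzag-down j t))
        (true⇔true to from)
        where
        to : (hexℕ j t 1 0 ∧ hexℕ j t 0 1 ∧ hexℕ j t 1 1 ∧ true) ∧ zigzag t j 2 ≡ true →
             (suc t ≤ᵇ height) ∧ onLine (suc t) j ≡ true
        to eq with ∧-true {hexℕ j t 1 0 ∧ hexℕ j t 0 1 ∧ hexℕ j t 1 1 ∧ true} eq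
        ... | h , z with ∧-true {hexℕ j t 1 0} h
        ... | h₁₀ , h′ with ∧-true {hexℕ j t 0 1} h′
        ... | h₀₁ , h″ with ∧-true {hexℕ j t 1 1} h″
        ... | h₁₁ , _ with hex-sound j t 1 1 h₁₁ | hex-sound j t 0 1 h₀₁
        ... | _ , _ , _ , _ , u | p , q , _ =
          cong₂ _∧_ (≤ᵇ-complete {suc t} {height} (subst (_≤ height) (ℕₚ.+-comm t 1) p))
            (onLine-complete (suc t) j (linear 0 u (ℕ-Ring.solve (b ∷ j ∷ t ∷ []))) (q-bound′ j q)
               (linear 0 (zigzag-sound t j 1 z (q-bound′ j q)) (ℕ-Ring.solve (t ∷ c ∷ j ∷ []))))
        from : (suc t ≤ᵇ height) ∧ onLine (suc t) j ≡ true →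
               (hexℕ j t 1 0 ∧ hexℕ j t 0 1 ∧ hexℕ j t 1 1 ∧ true) ∧ zigzag t j 2 ≡ true
        from eq with ∧-true {suc t ≤ᵇ height} eq
        ... | p , eq′ with ≤ᵇ-sound {suc t} p | onLine-sound eq′
        ... | t<h | t≤ , j≤ , 2j≤ = cong₂ _∧_
          (cong₂ _∧_ (hex-complete j t 1 0 (h-bound₀ t t<h , q-bound j 1 j≤ , s≤s z≤n , r-bound′ j t 1 0 2j≤ (s≤s z≤n) , u-bound′ j t 1 0 t≤ (s≤s z≤n)))
          (cong₂ _∧_ (hex-complete j t 0 1 (h-bound₁ t t<h , q-bound j 0 j≤ , z≤n , r-bound′ j t 0 1 2j≤ (s≤s z≤n) , u-bound′ j t 0 1 t≤ (s≤s z≤n)))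
          (cong₂ _∧_ (hex-complete j t 1 1 (h-bound₁ t t<h , q-bound j 1 j≤ , s≤s z≤n , r-bound′ j t 1 1 2j≤ (s≤s z≤n) , u-bound′ j t 1 1 t≤ (s≤s (s≤s z≤n)))) refl)))
          (zigzag-complete t j 2 (linear 0 2j≤ (ℕ-Ring.solve (t ∷ c ∷ j ∷ []))))

      memℕ-at : ∀ o j t → memS a b c (tri o (column j) (+ t)) ≡ memℕ o j t
      memℕ-at up j t = begin
        A ∧ Rz ∧ not rm                            ≡⟨ sym (∧-assoc A Rz (not rm)) ⟩
        (A ∧ Rz) ∧ not rm                          ≡⟨ cong₂ _∧_ (up-shape j t) (cong not (≡ᵇT-ℕ up j t 1 (suc b))) ⟩
        ((suc t ≤ᵇ height) ∧ onLine t j) ∧ not ((j ≡ᵇ 1) ∧ (t ≡ᵇ suc b))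
                                                   ≡⟨ ∧-assoc (suc t ≤ᵇ height) (onLine t j) _ ⟩
        memℕ up j t                                ∎
        where
        open ≡-Reasoning
        A Rz rm : Bool
        A  = all? (inHex a b c) (vertices (tri up (column j) (+ t)))
        Rz = rightOfZ a (tri up (column j) (+ t))
        rm = tri up (column j) (+ t) ≡ᵇT removedTri b c
      memℕ-at down j t = trans (cong (all? (inHex a b c) (vertices (tri down (column j) (+ t))) ∧_)
        (∧-identityʳ (rightOfZ a (tri down (column j) (+ t))))) (down-shape j t)

      right-of-C : ∀ {i m} k → + c ℤ.- i ≡ -[1+ m ] → inHex a b c (pt (i ℤ.+ ℤ1) k) ≡ false
      right-of-C {i} {m} k eq = trans
        (cong (λ z → A ∧ B ∧ C ∧ z ∧ D) (≤ᵇ-shift (i ℤ.+ ℤ1) (+ suc c) (suc m) 0 (trans (e (+ c) i) (trans eq (sym (ℤₚ.+-identityˡ -[1+ m ]))))))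
        (trans (cong (λ z → A ∧ B ∧ z) (∧-zeroʳ C)) (trans (cong (A ∧_) (∧-zeroʳ B)) (∧-zeroʳ A)))
        where
        A B C D : Bool
        A = + 0 ℤ.≤ᵇ k
        B = k ℤ.≤ᵇ + height
        C = ℤ.- (+ suc a) ℤ.≤ᵇ i ℤ.+ ℤ1
        D = (+ 0 ℤ.≤ᵇ i ℤ.+ ℤ1 ℤ.+ k) ∧ (i ℤ.+ ℤ1 ℤ.+ k ℤ.≤ᵇ + (c + b + 1))
        e : ∀ c i → (+ 1 ℤ.+ c) ℤ.- (i ℤ.+ + 1) ≡ c ℤ.- i
        e = ℤ-Ring.solve-∀

    private
      locate : (Orientation → ℕ → ℕ → Bool) → Orientation → ℕ → ℤ → Bool
      locate f o t (+ j)    = f o j t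
      locate f o t -[1+ _ ] = false

    set : (Orientation → ℕ → ℕ → Bool) → Tri → Bool
    set f (tri o i (+ t))    = locate f o t (+ c ℤ.- i)
    set f (tri o i -[1+ _ ]) = false

    set-at : ∀ f o j t → set f (tri o (column j) (+ t)) ≡ f o j t
    set-at f o j t = cong (locate f o t) (column-involutive j)

    set-right : ∀ f o t {i m} → + c ℤ.- i ≡ -[1+ m ] → set f (tri o i (+ t)) ≡ false
    set-right f o t eq = cong (locate f o t) eq

    -- A view of triangles: an equality between sets of triangles has to be checked on cells with
    -- natural coordinates only, because elsewhere all sets and the region are empty.
    data Located : Tri → Set where
      at      : ∀ o j t → Located (tri o (column j) (+ t))
      outside : ∀ {s} → (∀ f → set f s ≡ false) → memS a b c s ≡ false → Located s

    locate-tri : ∀ s → Located s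
    locate-tri (tri up   i -[1+ n ]) = outside (λ _ → refl) refl
    locate-tri (tri down i -[1+ n ]) = outside (λ _ → refl) refl
    locate-tri (tri o i (+ t)) with + c ℤ.- i in eq
    ... | + j = subst (λ z → Located (tri o z (+ t))) (trans (cong (λ z → + c ℤ.- z) (sym eq)) (e (+ c) i)) (at o j t)
      where
      e : ∀ c i → c ℤ.- (c ℤ.- i) ≡ i
      e = ℤ-Ring.solve-∀
    ... | -[1+ m ] = outside (λ f → set-right f o t {i} eq) (dead o)
      where
      dead : ∀ o → memS a b c (tri o i (+ t)) ≡ false
      dead up   rewrite right-of-C {i} (+ t) eq | ∧-zeroʳ (inHex a b c (pt i (+ t))) = refl
      dead down rewrite right-of-C {i} (+ t) eq = refl

    set-cong : ∀ {f g} → (∀ o j t → f o j t ≡ g o j t) → set f ≗ set g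
    set-cong {f} {g} eq s with locate-tri s
    ... | at o j t    = trans (set-at f o j t) (trans (eq o j t) (sym (set-at g o j t)))
    ... | outside z _ = trans (z f) (sym (z g))

    memS≗set : memS a b c ≗ set memℕ
    memS≗set s with locate-tri s
    ... | at o j t     = trans (memℕ-at o j t) (sym (set-at memℕ o j t))
    ... | outside z eq = trans eq (sym (z memℕ))

-- Expanding the sum over tilings at one triangle.

module Pivots where

  open import Data.Nat using (_+_; _*_)
  open import Data.Integer using (+_)
  open Determinants
  open ExactCovers
  open Coordinates

  shift₁ : ∀ lo m → (lo ℤ.+ + 1) ℤ.+ m ≡ lo ℤ.+ (+ 1 ℤ.+ m)
  shift₁ lo m = ℤₚ.+-assoc lo (+ 1) m

  intRange-∈⁺ : ∀ lo {m} n → m < n → lo ℤ.+ + m ∈ intRange lo n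
  intRange-∈⁺ lo {zero}  (suc n) _         = here (ℤₚ.+-identityʳ lo)
  intRange-∈⁺ lo {suc m} (suc n) (s≤s m<n) =
    there (subst (_∈ intRange (lo ℤ.+ ℤ1) n) (shift₁ lo (+ m)) (intRange-∈⁺ (lo ℤ.+ ℤ1) n m<n))

  intRange-∈⁻ : ∀ lo n {i} → i ∈ intRange lo n → ∃[ m ] i ≡ lo ℤ.+ + m
  intRange-∈⁻ lo (suc n) (here refl) = 0 , sym (ℤₚ.+-identityʳ lo)
  intRange-∈⁻ lo (suc n) (there i∈) with intRange-∈⁻ (lo ℤ.+ ℤ1) n i∈
  ... | m , eq = suc m , trans eq (shift₁ lo (+ m))

  intRange-fresh : ∀ lo n → ¬ lo ∈ intRange (lo ℤ.+ ℤ1) n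
  intRange-fresh lo n lo∈ with intRange-∈⁻ (lo ℤ.+ ℤ1) n lo∈
  ... | m , eq with trans (sym (ℤₚ.+-inverseʳ lo)) (trans (cong (ℤ._- lo) eq) (e lo (+ m)))
    where
    e : ∀ lo m → ((lo ℤ.+ + 1) ℤ.+ m) ℤ.- lo ≡ + 1 ℤ.+ m
    e = ℤ-Ring.solve-∀
  ...   | ()

  sum-0∈ : ∀ {A : Set} (f : A → ℚ) xs → (∀ {x} → x ∈ xs → f x ≡ 0ℚ) → sum f xs ≡ 0ℚ
  sum-0∈ f []       z = refl
  sum-0∈ f (x ∷ xs) z = cong₂ ℚ._+_ (z (here refl)) (sum-0∈ f xs (z ∘ there))

  sum-single : ∀ (f : ℤ → ℚ) i lo n → (∀ k → k ≢ i → f k ≡ 0ℚ) → i ∈ intRange lo n →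
    sum f (intRange lo n) ≡ f i
  sum-single f i lo (suc n) z (here refl) = trans
    (cong (λ z → f lo ℚ.+ z) (sum-0∈ f _ (λ {k} k∈ → z k (λ { refl → intRange-fresh lo n k∈ }))))
    (ℚₚ.+-identityʳ (f lo))
  sum-single f i lo (suc n) z (there i∈) = trans
    (cong₂ ℚ._+_ (z lo (λ { refl → intRange-fresh lo n i∈ })) (sum-single f i (lo ℤ.+ ℤ1) n z i∈))
    (ℚₚ.+-identityˡ (f i))

  ∈-concatMap : ∀ {A B : Set} (f : A → List B) {x y xs} → x ∈ xs → y ∈ f x → y ∈ concatMap f xs
  ∈-concatMap f x∈ y∈ = ∈-concatMap⁺ f (lose x∈ y∈)

  module Region′ (a b c : ℕ) (wt : Lozenge → ℚ) where

    open Geometry a b c public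
    open Cover (triangles (S a b c)) wt public

    Ls : List Lozenge
    Ls = lozenges (S a b c)

    Cells : Set
    Cells = Orientation → ℕ → ℕ → Bool

    tilings : Cells → ℚ
    tilings f = Z Ls (set f)

    _⊆mem : Cells → Set
    f ⊆mem = ∀ o j t → f o j t ≡ true → memℕ o j t ≡ true

    private
      lo : ℤ
      lo = ℤ.- (+ suc a)
      width rows : ℕ
      width = a + c + 3
      rows  = a + b + 3

      cell : ℤ → ℤ → List Lozenge
      cell i k = loz vert i k ∷ loz leftL i k ∷ loz rightL i k ∷ []

      boxLozenges : List Lozenge
      boxLozenges = concatMap (λ i → concatMap (cell i) (intRange (+ 0) rows)) (intRange lo width)

    bounds : ∀ o j t → memℕ o j t ≡ true → suc t ≤ height × j ≤ a + c + 1
    bounds up j t eq with ∧-true {suc t ≤ᵇ height} eq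
    ... | p , eq′ = ≤ᵇ-sound p , proj₁ (proj₂ (onLine-sound {t} {j} (proj₁ (∧-true {onLine t j} eq′))))
    bounds down j t eq with ∧-true {suc t ≤ᵇ height} eq
    ... | p , eq′ = ≤ᵇ-sound p , proj₁ (proj₂ (onLine-sound {suc t} {j} eq′))

    private
      column-∈ : ∀ j → j ≤ a + c + 1 → column j ∈ intRange lo width
      column-∈ j j≤ with ℕₚ.m≤n⇒∃[o]m+o≡n j≤
      ... | m , j+m≡ = subst (_∈ intRange lo width) eq (intRange-∈⁺ lo width m<w)
        where
        m<w : m < width
        m<w = linear (j + 1) (ℕₚ.≤-reflexive j+m≡) (e j m a c)
          where
          e : ∀ j m a c → a + c + 3 + (j + m) ≡ suc m + (a + c + 1) + (j + 1)
          e = ℕ-Ring.solve-∀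
        eq : lo ℤ.+ + m ≡ column j
        eq = trans (e₁ (+ a) (+ j) (+ m)) (trans (cong (λ z → + z ℤ.- + j ℤ.- (+ 1 ℤ.+ + a)) j+m≡) (e₂ (+ a) (+ j) (+ c)))
          where
          e₁ : ∀ a j m → ℤ.- (+ 1 ℤ.+ a) ℤ.+ m ≡ (j ℤ.+ m) ℤ.- j ℤ.- (+ 1 ℤ.+ a)
          e₁ = ℤ-Ring.solve-∀
          e₂ : ∀ a j c → (a ℤ.+ c ℤ.+ + 1) ℤ.- j ℤ.- (+ 1 ℤ.+ a) ≡ c ℤ.- j
          e₂ = ℤ-Ring.solve-∀

      row-∈ : ∀ t → suc t ≤ height → + t ∈ intRange (+ 0) rows
      row-∈ t t< = intRange-∈⁺ (+ 0) rows (ℕₚ.≤-trans t< (ℕₚ.+-monoʳ-≤ (a + b) (s≤s (s≤s z≤n))))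

      in-box : ∀ o j t → memℕ o j t ≡ true → column j ∈ intRange lo width × + t ∈ intRange (+ 0) rows
      in-box o j t m with bounds o j t m
      ... | t< , j≤ = column-∈ j j≤ , row-∈ t t<

    mem-∈ : ∀ s → memS a b c s ≡ true → s ∈ triangles (S a b c)
    mem-∈ s m = ∈-filter⁺ (T? ∘ memS a b c) (box s m) (≡⇒T m)
      where
      pair : ∀ o i k → tri o i k ∈ (tri up i k ∷ tri down i k ∷ [])
      pair up   i k = here refl
      pair down i k = there (here refl)
      box : ∀ s → memS a b c s ≡ true → s ∈ boxTris (S a b c)
      box s m with locate-tri s
      ... | outside _ dead with trans (sym m) dead
      ...   | ()
      box s m | at o j t with in-box o j t (trans (sym (set-at memℕ o j t)) (trans (sym (memS≗set s)) m))
      ... | i∈ , k∈ = ∈-concatMap _ i∈ (∈-concatMap _ k∈ (pair o (column j) (+ t)))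

    sumℚ-map : ∀ {A : Set} (f : A → ℚ) xs → sumℚ (map f xs) ≡ sum f xs
    sumℚ-map f []       = refl
    sumℚ-map f (x ∷ xs) = cong (λ z → f x ℚ.+ z) (sumℚ-map f xs)

    M≡tilings : M (S a b c) wt ≡ tilings memℕ
    M≡tilings = begin
      M (S a b c) wt                           ≡⟨ sumℚ-map _ (subsets Ls) ⟩
      sum (λ ls → if isTiling (S a b c) ls then weightOf wt ls else 0ℚ) (subsets Ls)
                                               ≡⟨ sum-cong (λ ls → if-cong (all?-cong (triangles (S a b c)) (λ s s∈ →
                                                    cong (λ n → length (filterᵇ (λ l → covers l s) ls) ≡ᵇ n)
                                                      (sym (cong (λ z → if z then 1 else 0) (alive s s∈)))))) (subsets Ls) ⟩
      sum (term (memS a b c)) (subsets Ls)     ≡⟨ sum-subsets Ls (memS a b c) (All.tabulate inside) ⟩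
      Z Ls (memS a b c)                        ≡⟨ Z-cong Ls memS≗set ⟩
      tilings memℕ                             ∎
      where
      open ≡-Reasoning
      alive : ∀ s → s ∈ triangles (S a b c) → memS a b c s ≡ true
      alive s s∈ = T⇒≡ (proj₂ (∈-filter⁻ (T? ∘ memS a b c) {xs = boxTris (S a b c)} s∈))
      inside : ∀ {l} → l ∈ Ls → upTri l ∈ triangles (S a b c) × downTri l ∈ triangles (S a b c)
      inside {l} l∈ with ∧-true {memS a b c (upTri l)} (T⇒≡ (proj₂ (∈-filter⁻ (T? ∘ λ l → memS a b c (upTri l) ∧ memS a b c (downTri l)) {xs = boxLozenges} l∈)))
      ... | u , d = mem-∈ _ u , mem-∈ _ d

    remove : ℕ → ℕ → ℕ → ℕ → Cells → Cells
    remove j t j′ t′ f up   i k = f up i k ∧ not ((i ≡ᵇ j) ∧ (k ≡ᵇ t))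
    remove j t j′ t′ f down i k = f down i k ∧ not ((i ≡ᵇ j′) ∧ (k ≡ᵇ t′))

    private
      set-∖ : ∀ f l {j t j′ t′} → upTri l ≡ tri up (column j) (+ t) → downTri l ≡ tri down (column j′) (+ t′) →
        (set f ∖ l) ≗ set (remove j t j′ t′ f)
      set-∖ f l {j} {t} {j′} {t′} u d s with locate-tri s
      ... | outside z _ = trans (cong (_∧ not (covers l s)) (z f)) (sym (z (remove j t j′ t′ f)))
      ... | at up i k = trans (cong₂ _∧_ (set-at f up i k) (cong not cov)) (sym (set-at (remove j t j′ t′ f) up i k))
        where
        cov : covers l (tri up (column i) (+ k)) ≡ (i ≡ᵇ j) ∧ (k ≡ᵇ t)
        cov = trans (cong₂ _∨_ (trans (cong (tri up (column i) (+ k) ≡ᵇT_) u) (≡ᵇT-ℕ up i k j t))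
                               (cong (tri up (column i) (+ k) ≡ᵇT_) d)) (∨-identityʳ _)
      ... | at down i k = trans (cong₂ _∧_ (set-at f down i k) (cong not cov)) (sym (set-at (remove j t j′ t′ f) down i k))
        where
        cov : covers l (tri down (column i) (+ k)) ≡ (i ≡ᵇ j′) ∧ (k ≡ᵇ t′)
        cov = cong₂ _∨_ (cong (tri down (column i) (+ k) ≡ᵇT_) u)
                        (trans (cong (tri down (column i) (+ k) ≡ᵇT_) d) (≡ᵇT-ℕ down i k j′ t′))

      branch-at : ∀ f l s {j t j′ t′} → covers l s ≡ true →
        upTri l ≡ tri up (column j) (+ t) → downTri l ≡ tri down (column j′) (+ t′) →
        branch Ls (set f) s l ≡
        (if f up j t ∧ f down j′ t′ then wt l ℚ.* tilings (remove j t j′ t′ f) else 0ℚ)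
      branch-at f l s {j} {t} {j′} {t′} cv u d = trans (if-cong cv)
        (trans (cong (λ z → if contains (set f) l then wt l ℚ.* z else 0ℚ) (Z-cong Ls (set-∖ f l u d)))
               (if-cong (cong₂ _∧_ (trans (cong (set f) u) (set-at f up j t))
                                   (trans (cong (set f) d) (set-at f down j′ t′)))))

      branch-0 : ∀ r s l → ¬ covers l s ≡ true → branch Ls r s l ≡ 0ℚ
      branch-0 r s l ¬cv with covers l s
      ... | true  = ⊥-elim (¬cv refl)
      ... | false = refl

      branch-dead : ∀ r s l → contains r l ≡ false → branch Ls r s l ≡ 0ℚ
      branch-dead r s l eq with covers l s
      ... | true  = if-cong eq
      ... | false = refl

      boxSum : (ℤ → ℤ → ℚ) → ℚ
      boxSum h = sum (λ i → sum (h i) (intRange (+ 0) rows)) (intRange lo width)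

      -- The one candidate either has a vanishing term or lies in the bounding box. For a lozenge
      -- the second case follows as soon as its up-triangle is still present.
      boxSum-single : ∀ h i k → (∀ i′ k′ → ¬ (i′ ≡ i × k′ ≡ k) → h i′ k′ ≡ 0ℚ) →
        (h i k ≡ 0ℚ) ⊎ (i ∈ intRange lo width × k ∈ intRange (+ 0) rows) → boxSum h ≡ h i k
      boxSum-single h i k z (inj₁ hik≡0) = trans
        (sum-0 (λ i′ → sum-0 (all-0 i′) (intRange (+ 0) rows)) (intRange lo width)) (sym hik≡0)
        where
        all-0 : ∀ i′ k′ → h i′ k′ ≡ 0ℚ
        all-0 i′ k′ with i′ ℤ.≟ i | k′ ℤ.≟ k
        ... | yes refl | yes refl = hik≡0
        ... | no ¬p    | _        = z i′ k′ (¬p ∘ proj₁)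
        ... | _        | no ¬q    = z i′ k′ (¬q ∘ proj₂)
      boxSum-single h i k z (inj₂ (i∈ , k∈)) = trans
        (sum-single _ i lo width (λ i′ i′≢i → sum-0 (λ k′ → z i′ k′ (i′≢i ∘ proj₁)) (intRange (+ 0) rows)) i∈)
        (sum-single (h i) k (+ 0) rows (λ k′ k′≢k → z i k′ (k′≢k ∘ proj₂)) k∈)

      boxSum-⊕ : ∀ g h → boxSum (λ i k → g i k ℚ.+ h i k) ≡ boxSum g ℚ.+ boxSum h
      boxSum-⊕ g h = trans (sum-cong (λ i → sum-⊕ (g i) (h i) (intRange (+ 0) rows)) (intRange lo width))
        (sum-⊕ _ _ (intRange lo width))

      sum-lozenges : ∀ g → (∀ l → contains (memS a b c) l ≡ false → g l ≡ 0ℚ) →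
        sum g Ls ≡ boxSum (λ i k → g (loz vert i k)) ℚ.+
                   (boxSum (λ i k → g (loz leftL i k)) ℚ.+ boxSum (λ i k → g (loz rightL i k)))
      sum-lozenges g z = begin
        sum g Ls
          ≡⟨ sum-filter g (contains (memS a b c)) z boxLozenges ⟩
        sum g boxLozenges
          ≡⟨ sum-concatMap g (λ i → concatMap (cell i) (intRange (+ 0) rows)) (intRange lo width) ⟩
        sum (λ i → sum g (concatMap (cell i) (intRange (+ 0) rows))) (intRange lo width)
          ≡⟨ sum-cong (λ i → trans (sum-concatMap g (cell i) (intRange (+ 0) rows))
               (sum-cong (λ k → cong (λ z → g (loz vert i k) ℚ.+ (g (loz leftL i k) ℚ.+ z)) (ℚₚ.+-identityʳ (g (loz rightL i k))))
                 (intRange (+ 0) rows))) (intRange lo width) ⟩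
        boxSum (λ i k → g (loz vert i k) ℚ.+ (g (loz leftL i k) ℚ.+ g (loz rightL i k)))
          ≡⟨ trans (boxSum-⊕ _ _) (cong (λ z → boxSum (λ i k → g (loz vert i k)) ℚ.+ z) (boxSum-⊕ _ _)) ⟩
        _ ∎
        where open ≡-Reasoning

      contains-mono : ∀ {f} → f ⊆mem → ∀ l → contains (memS a b c) l ≡ false → contains (set f) l ≡ false
      contains-mono {f} f⊆ l eq with contains (set f) l in alive
      ... | false = refl
      ... | true with ∧-true {set f (upTri l)} alive
      ...   | u , d with trans (sym eq) (cong₂ _∧_ (up-mem (upTri l) u) (up-mem (downTri l) d))
        where
        up-mem : ∀ s → set f s ≡ true → memS a b c s ≡ true
        up-mem s p with locate-tri s
        ... | at o j t = trans (memS≗set s) (trans (set-at memℕ o j t) (f⊆ o j t (trans (sym (set-at f o j t)) p)))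
        ... | outside z _ with trans (sym p) (z f)
        ...   | ()
      ...     | ()

      -- The sum is sorted by direction because at most one lozenge of each direction covers a given
      -- triangle; each of the three box sums then collapses to one term.
      expand : ∀ {f} → f ⊆mem → ∀ o j t → f o j t ≡ true → let s = tri o (column j) (+ t); g = branch Ls (set f) s in
        tilings f ≡ boxSum (λ i k → g (loz vert i k)) ℚ.+
                    (boxSum (λ i k → g (loz leftL i k)) ℚ.+ boxSum (λ i k → g (loz rightL i k)))
      expand {f} f⊆ o j t alive = trans
        (pivot Ls s (mem-∈ s (trans (memS≗set s) (trans (set-at memℕ o j t) (f⊆ o j t alive))))
          (trans (set-at f o j t) alive))
        (sum-lozenges _ (λ l eq → branch-dead (set f) s l (contains-mono f⊆ l eq)))
        where
        s : Tri
        s = tri o (column j) (+ t)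

      column-suc : ∀ j → column (suc j) ℤ.+ ℤ1 ≡ column j
      column-suc j = e (+ c) (+ j)
        where
        e : ∀ c j → c ℤ.- (+ 1 ℤ.+ j) ℤ.+ + 1 ≡ c ℤ.- j
        e = ℤ-Ring.solve-∀

      column-pred : ∀ j → column j ℤ.- ℤ1 ≡ column (suc j)
      column-pred j = e (+ c) (+ j)
        where
        e : ∀ c j → c ℤ.- j ℤ.- + 1 ≡ c ℤ.- (+ 1 ℤ.+ j)
        e = ℤ-Ring.solve-∀

      -1+1 : ∀ i → (i ℤ.- ℤ1) ℤ.+ ℤ1 ≡ i
      -1+1 = e
        where
        e : ∀ i → i ℤ.- + 1 ℤ.+ + 1 ≡ i
        e = ℤ-Ring.solve-∀

      when-box : ∀ f {j t} {q} → f ⊆mem → ∀ {j′ t′} →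
        ((if f up j t ∧ f down j′ t′ then q else 0ℚ) ≡ 0ℚ) ⊎ (column j ∈ intRange lo width × + t ∈ intRange (+ 0) rows)
      when-box f {j} {t} f⊆ with f up j t in alive
      ... | true  = inj₂ (in-box up j t (f⊆ up j t alive))
      ... | false = inj₁ refl

      vert-term : ∀ {f} → f ⊆mem → ∀ s j t → (s ≡ tri up (column j) (+ suc t) ⊎ s ≡ tri down (column j) (+ t)) →
        boxSum (λ i k → branch Ls (set f) s (loz vert i k)) ≡
        (if f up j (suc t) ∧ f down j t then wt (loz vert (column j) (+ suc t)) ℚ.* tilings (remove j (suc t) j t f) else 0ℚ)
      vert-term {f} f⊆ s j t s≡ = trans
        (boxSum-single _ (column j) (+ suc t)
          (λ i k ≢ → branch-0 (set f) s (loz vert i k) (λ cv → ≢ (only i k (covers-sound (loz vert i k) s cv) s≡)))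
          (subst (λ z → z ≡ 0ℚ ⊎ _) (sym value) (when-box f f⊆)))
        value
        where
        only : ∀ i k → (s ≡ tri up i k ⊎ s ≡ tri down i (k ℤ.- ℤ1)) →
               (s ≡ tri up (column j) (+ suc t) ⊎ s ≡ tri down (column j) (+ t)) →
               i ≡ column j × k ≡ + suc t
        only i k (inj₁ refl) (inj₁ refl) = refl , refl
        only i k (inj₁ refl) (inj₂ ())
        only i k (inj₂ refl) (inj₁ ())
        only i k (inj₂ p) (inj₂ q) with trans (sym p) q
        ... | eq = cong Tri.col eq , trans (sym (-1+1 k)) (trans (cong (ℤ._+ ℤ1) (cong Tri.row eq)) (cong +_ (ℕₚ.+-comm t 1)))
        cov : (s ≡ tri up (column j) (+ suc t) ⊎ s ≡ tri down (column j) (+ t)) →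
              covers (loz vert (column j) (+ suc t)) s ≡ true
        cov (inj₁ refl) = covers-up (loz vert (column j) (+ suc t))
        cov (inj₂ refl) = covers-down (loz vert (column j) (+ suc t))
        value : branch Ls (set f) s (loz vert (column j) (+ suc t)) ≡ _
        value = branch-at f (loz vert (column j) (+ suc t)) s {j} {suc t} {j} {t} (cov s≡) refl refl

      right-term : ∀ {f} → f ⊆mem → ∀ s j t → (s ≡ tri up (column j) (+ t) ⊎ s ≡ tri down (column j) (+ t)) →
        boxSum (λ i k → branch Ls (set f) s (loz rightL i k)) ≡
        (if f up j t ∧ f down j t then wt (loz rightL (column j) (+ t)) ℚ.* tilings (remove j t j t f) else 0ℚ)
      right-term {f} f⊆ s j t s≡ = trans
        (boxSum-single _ (column j) (+ t)
          (λ i k ≢ → branch-0 (set f) s (loz rightL i k) (λ cv → ≢ (only i k (covers-sound (loz rightL i k) s cv) s≡)))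
          (subst (λ z → z ≡ 0ℚ ⊎ _) (sym value) (when-box f f⊆)))
        value
        where
        only : ∀ i k → (s ≡ tri up i k ⊎ s ≡ tri down i k) →
               (s ≡ tri up (column j) (+ t) ⊎ s ≡ tri down (column j) (+ t)) →
               i ≡ column j × k ≡ + t
        only i k (inj₁ refl) (inj₁ refl) = refl , refl
        only i k (inj₁ refl) (inj₂ ())
        only i k (inj₂ refl) (inj₁ ())
        only i k (inj₂ refl) (inj₂ refl) = refl , refl
        cov : (s ≡ tri up (column j) (+ t) ⊎ s ≡ tri down (column j) (+ t)) →
              covers (loz rightL (column j) (+ t)) s ≡ true
        cov (inj₁ refl) = covers-up (loz rightL (column j) (+ t))
        cov (inj₂ refl) = covers-down (loz rightL (column j) (+ t))
        value : branch Ls (set f) s (loz rightL (column j) (+ t)) ≡ _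
        value = branch-at f (loz rightL (column j) (+ t)) s {j} {t} {j} {t} (cov s≡) refl refl

      left-term : ∀ {f} → f ⊆mem → ∀ s j t → (s ≡ tri up (column j) (+ t) ⊎ s ≡ tri down (column (suc j)) (+ t)) →
        boxSum (λ i k → branch Ls (set f) s (loz leftL i k)) ≡
        (if f up j t ∧ f down (suc j) t then wt (loz leftL (column j) (+ t)) ℚ.* tilings (remove j t (suc j) t f) else 0ℚ)
      left-term {f} f⊆ s j t s≡ = trans
        (boxSum-single _ (column j) (+ t)
          (λ i k ≢ → branch-0 (set f) s (loz leftL i k) (λ cv → ≢ (only i k (covers-sound (loz leftL i k) s cv) s≡)))
          (subst (λ z → z ≡ 0ℚ ⊎ _) (sym value) (when-box f f⊆)))
        value
        where
        only : ∀ i k → (s ≡ tri up i k ⊎ s ≡ tri down (i ℤ.- ℤ1) k) →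
               (s ≡ tri up (column j) (+ t) ⊎ s ≡ tri down (column (suc j)) (+ t)) →
               i ≡ column j × k ≡ + t
        only i k (inj₁ refl) (inj₁ refl) = refl , refl
        only i k (inj₁ refl) (inj₂ ())
        only i k (inj₂ refl) (inj₁ ())
        only i k (inj₂ p) (inj₂ q) with trans (sym p) q
        ... | eq = trans (sym (-1+1 i)) (trans (cong (ℤ._+ ℤ1) (cong Tri.col eq)) (column-suc j)) , cong Tri.row eq
        down≡ : downTri (loz leftL (column j) (+ t)) ≡ tri down (column (suc j)) (+ t)
        down≡ = cong (λ z → tri down z (+ t)) (column-pred j)
        cov : (s ≡ tri up (column j) (+ t) ⊎ s ≡ tri down (column (suc j)) (+ t)) →
              covers (loz leftL (column j) (+ t)) s ≡ true
        cov (inj₁ refl) = covers-up (loz leftL (column j) (+ t))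
        cov (inj₂ refl) = subst (λ z → covers (loz leftL (column j) (+ t)) z ≡ true) down≡
                            (covers-down (loz leftL (column j) (+ t)))
        value : branch Ls (set f) s (loz leftL (column j) (+ t)) ≡ _
        value = branch-at f (loz leftL (column j) (+ t)) s {j} {t} {suc j} {t} (cov s≡) refl down≡

      -- Such a lozenge would use an up-triangle in column c + 1, which lies beyond the side CD.
      left-term-0 : ∀ {f} → f ⊆mem → ∀ t →
        boxSum (λ i k → branch Ls (set f) (tri down (column 0) (+ t)) (loz leftL i k)) ≡ 0ℚ
      left-term-0 {f} f⊆ t = trans
        (boxSum-single _ (column 0 ℤ.+ ℤ1) (+ t)
          (λ i k ≢ → branch-0 (set f) s (loz leftL i k) (λ cv → ≢ (only i k (covers-sound (loz leftL i k) s cv))))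
          (inj₁ dead)) dead
        where
        s : Tri
        s = tri down (column 0) (+ t)
        only : ∀ i k → (s ≡ tri up i k ⊎ s ≡ tri down (i ℤ.- ℤ1) k) → i ≡ column 0 ℤ.+ ℤ1 × k ≡ + t
        only i k (inj₂ p) = trans (sym (-1+1 i)) (cong (ℤ._+ ℤ1) (sym (cong Tri.col p))) , sym (cong Tri.row p)
        e : ∀ c → c ℤ.- (c ℤ.- + 0 ℤ.+ + 1) ≡ -[1+ 0 ]
        e = ℤ-Ring.solve-∀
        dead : branch Ls (set f) s (loz leftL (column 0 ℤ.+ ℤ1) (+ t)) ≡ 0ℚ
        dead = branch-dead (set f) s (loz leftL (column 0 ℤ.+ ℤ1) (+ t)) (cong (_∧ set f (tri down (column 0 ℤ.+ ℤ1 ℤ.- ℤ1) (+ t))) (set-right f up t {column 0 ℤ.+ ℤ1} (e (+ c))))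

    -- Both lateral neighbours are gone, so the vertical lozenge is forced.
    pivot-up : ∀ {f} → f ⊆mem → ∀ j t → f up j (suc t) ≡ true →
      f down j (suc t) ≡ false → f down (suc j) (suc t) ≡ false → f down j t ≡ true →
      tilings f ≡ wt (loz vert (column j) (+ suc t)) ℚ.* tilings (remove j (suc t) j t f)
    pivot-up {f} f⊆ j t u d₀ d₁ d = begin
      tilings f
        ≡⟨ expand f⊆ up j (suc t) u ⟩
      _ ≡⟨ cong₂ ℚ._+_ (vert-term f⊆ _ j t (inj₁ refl))
             (cong₂ ℚ._+_ (left-term f⊆ _ j (suc t) (inj₁ refl)) (right-term f⊆ _ j (suc t) (inj₁ refl))) ⟩
      _ ≡⟨ cong₂ ℚ._+_ (if-cong (cong₂ _∧_ u d))
             (cong₂ ℚ._+_ (if-cong (trans (cong (f up j (suc t) ∧_) d₁) (∧-zeroʳ _)))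
                          (if-cong (trans (cong (f up j (suc t) ∧_) d₀) (∧-zeroʳ _)))) ⟩
      wt (loz vert (column j) (+ suc t)) ℚ.* tilings (remove j (suc t) j t f) ℚ.+ (0ℚ ℚ.+ 0ℚ)
        ≡⟨ ℚₚ.+-identityʳ _ ⟩
      wt (loz vert (column j) (+ suc t)) ℚ.* tilings (remove j (suc t) j t f) ∎
      where open ≡-Reasoning

    leftChoice : Cells → ℕ → ℕ → ℚ
    leftChoice f zero    t = 0ℚ
    leftChoice f (suc j) t = if f up j t then wt (loz leftL (column j) (+ t)) ℚ.* tilings (remove j t (suc j) t f) else 0ℚ

    -- The neighbour above is gone, which leaves the two lateral lozenges. They are the two possible
    -- steps of a path.
    pivot-down : ∀ {f} → f ⊆mem → ∀ j t → f down j t ≡ true → f up j (suc t) ≡ false →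
      tilings f ≡ leftChoice f j t ℚ.+
        (if f up j t then wt (loz rightL (column j) (+ t)) ℚ.* tilings (remove j t j t f) else 0ℚ)
    pivot-down {f} f⊆ j t d u = begin
      tilings f
        ≡⟨ expand f⊆ down j t d ⟩
      _ ≡⟨ cong₂ ℚ._+_ (vert-term f⊆ _ j t (inj₂ refl))
             (cong₂ ℚ._+_ (left j d) (right-term f⊆ _ j t (inj₂ refl))) ⟩
      _ ≡⟨ cong₂ ℚ._+_ (if-cong (cong (_∧ f down j t) u))
             (cong (λ z → leftChoice f j t ℚ.+ z) (if-cong (∧-true-right (f up j t) d))) ⟩
      0ℚ ℚ.+ choices
        ≡⟨ ℚₚ.+-identityˡ choices ⟩
      choices ∎
      where
      open ≡-Reasoning
      choices : ℚ
      choices = leftChoice f j t ℚ.+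
        (if f up j t then wt (loz rightL (column j) (+ t)) ℚ.* tilings (remove j t j t f) else 0ℚ)
      ∧-true-right : ∀ x {y} → y ≡ true → x ∧ y ≡ x
      ∧-true-right true  refl = refl
      ∧-true-right false refl = refl
      left : ∀ j → f down j t ≡ true →
        boxSum (λ i k → branch Ls (set f) (tri down (column j) (+ t)) (loz leftL i k)) ≡ leftChoice f j t
      left zero    d = left-term-0 f⊆ t
      left (suc j) d = trans (left-term f⊆ _ j t (inj₂ refl)) (if-cong (∧-true-right (f up j t) d))

-- Sorted positions, products over a line, and the downward sweep.

module Sweeping where

  open import Data.Nat using (_+_; _*_)
  open import Data.Integer using (+_)
  open All using (All; []; _∷_)
  open import Data.List.Relation.Unary.AllPairs using (AllPairs; []; _∷_)
  open Determinants
  open ExactCovers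
  open Coordinates
  open Pivots

  range : ℕ → ℕ → List ℕ
  range lo zero    = []
  range lo (suc n) = lo ∷ range (suc lo) n

  length-range : ∀ lo n → length (range lo n) ≡ n
  length-range lo zero    = refl
  length-range lo (suc n) = cong suc (length-range (suc lo) n)

  range-lower : ∀ lo n → All (lo ≤_) (range lo n)
  range-lower lo zero    = []
  range-lower lo (suc n) = ℕₚ.≤-refl ∷ All.map (ℕₚ.≤-trans (ℕₚ.n≤1+n lo)) (range-lower (suc lo) n)

  range-upper : ∀ lo n → All (_< lo + n) (range lo n)
  range-upper lo zero    = []
  range-upper lo (suc n) = ℕₚ.m<m+n lo (s≤s z≤n) ∷
    subst (λ m → All (_< m) (range (suc lo) n)) (sym (ℕₚ.+-suc lo n)) (range-upper (suc lo) n)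

  range-sorted : ∀ lo n → AllPairs _<_ (range lo n)
  range-sorted lo zero    = []
  range-sorted lo (suc n) = range-lower (suc lo) n ∷ range-sorted (suc lo) n

  sorted-length : ∀ {lo hi} X → AllPairs _<_ X → All (lo ≤_) X → All (_< hi) X → length X ≤ hi ℕ.∸ lo
  sorted-length []      _          _          _          = z≤n
  sorted-length {lo} {hi} (x ∷ X) (x< ∷ sX) (lo≤x ∷ _) (x<hi ∷ <hi) = begin
    suc (length X)         ≤⟨ s≤s (sorted-length X sX x< <hi) ⟩
    suc (hi ℕ.∸ suc x)     ≡⟨ sym (ℕₚ.+-∸-assoc 1 x<hi) ⟩
    hi ℕ.∸ x               ≤⟨ ℕₚ.∸-monoʳ-≤ hi lo≤x ⟩
    hi ℕ.∸ lo              ∎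
    where open ℕₚ.≤-Reasoning

  -- Pigeonhole. On the bottom line it shows that the c + 1 particles occupy all c + 1 edges of BC.
  sorted-range : ∀ lo n X → AllPairs _<_ X → All (lo ≤_) X → All (_< lo + n) X → length X ≡ n →
    X ≡ range lo n
  sorted-range lo zero    []      _          _            _            _  = refl
  sorted-range lo (suc n) (x ∷ X) (x< ∷ sX) (lo≤x ∷ _) (x<hi ∷ <hi) eq with x ℕₚ.≟ lo
  ... | yes refl = cong (lo ∷_) (sorted-range (suc lo) n X sX x<
         (subst (λ m → All (_< m) X) (ℕₚ.+-suc lo n) <hi) (ℕₚ.suc-injective eq))
  ... | no x≢lo = ⊥-elim (ℕₚ.<-irrefl refl (begin-strict
    n                                ≡⟨ sym (ℕₚ.suc-injective eq) ⟩
    length X                         <⟨ sorted-length (x ∷ X) (x< ∷ sX) (lo<x ∷ All.map (ℕₚ.<-trans lo<x) x<) (x<hi ∷ <hi) ⟩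
    lo + suc n ℕ.∸ suc lo          ≡⟨ cong (ℕ._∸ suc lo) (ℕₚ.+-suc lo n) ⟩
    lo + n ℕ.∸ lo                  ≡⟨ ℕₚ.m+n∸m≡n lo n ⟩
    n                                ∎))
    where
    open ℕₚ.≤-Reasoning
    lo<x : lo < x
    lo<x = ℕₚ.≤∧≢⇒< lo≤x (x≢lo ∘ sym)

  det-unitriangular : ∀ (r : ℕ → Row) lo n → (∀ j → j < lo + n → r j j ≡ 1ℚ) →
    (∀ j k → j < k → r j k ≡ 0ℚ) → det (map r (range lo n)) (range lo n) ≡ 1ℚ
  det-unitriangular r lo zero    diag lower = refl
  det-unitriangular r lo (suc n) diag lower = begin
    r lo lo ℚ.* det rs ks ℚ.- ι (r lo) (det rs ∘ (lo ∷_)) ks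
      ≡⟨ cong₂ ℚ._-_ (cong₂ ℚ._*_ (diag lo (ℕₚ.m<m+n lo (s≤s z≤n)))
           (det-unitriangular r (suc lo) n (λ j j< → diag j (subst (j <_) (sym (ℕₚ.+-suc lo n)) j<)) lower))
           (ι-zero (det rs ∘ (lo ∷_)) ks (All.map (lower lo _) (range-lower (suc lo) n))) ⟩
    1ℚ ∎
    where
    open ≡-Reasoning
    ks = range (suc lo) n
    rs = map r ks

  det-zero-row : ∀ pre r post ks → det (pre ++ (0ℚ ⊙ r) ∷ post) ks ≡ 0ℚ
  det-zero-row pre r post ks = trans (det-⊙ pre 0ℚ r post ks) (ℚₚ.*-zeroˡ (det (pre ++ r ∷ post) ks))

  det-prefix-0 : ∀ pre rs → (∀ ks → det rs ks ≡ 0ℚ) → ∀ ks → det (pre ++ rs) ks ≡ 0ℚ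
  det-prefix-0 []        rs z = z
  det-prefix-0 (p ∷ pre) rs z = ι-0ʳ p (det-prefix-0 pre rs z)

  -- A particle that steps onto an occupied position contributes a determinant with a repeated row.
  -- This is the whole treatment of non-intersection.
  det-member : ∀ (r : ℕ → Row) P acc y post → y ∈ acc → ∀ ks → det ((P ++ map r acc) ++ r y ∷ post) ks ≡ 0ℚ
  det-member r P acc y post y∈ ks with ∈-∃++ y∈
  ... | as , bs , refl = trans (cong (λ rs → det rs ks) eq)
    (det-prefix-0 (P ++ map r as) _ (det-repeat (r y) (map r bs) post) ks)
    where
    eq : (P ++ map r (as ++ y ∷ bs)) ++ r y ∷ post ≡ (P ++ map r as) ++ r y ∷ map r bs ++ r y ∷ post
    eq = begin
      (P ++ map r (as ++ y ∷ bs)) ++ r y ∷ post        ≡⟨ cong (λ z → (P ++ z) ++ r y ∷ post) (map-++ r as (y ∷ bs)) ⟩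
      (P ++ map r as ++ r y ∷ map r bs) ++ r y ∷ post  ≡⟨ cong (_++ r y ∷ post) (sym (++-assoc P (map r as) _)) ⟩
      ((P ++ map r as) ++ r y ∷ map r bs) ++ r y ∷ post ≡⟨ ++-assoc (P ++ map r as) _ _ ⟩
      (P ++ map r as) ++ r y ∷ map r bs ++ r y ∷ post  ∎
      where open ≡-Reasoning

  _∈ᵇ_ : ℕ → List ℕ → Bool
  j ∈ᵇ []      = false
  j ∈ᵇ (x ∷ X) = (j ≡ᵇ x) ∨ (j ∈ᵇ X)

  ∈ᵇ-sound : ∀ j X → (j ∈ᵇ X) ≡ true → j ∈ X
  ∈ᵇ-sound j (x ∷ X) eq with j ≡ᵇ x in j≡x
  ... | true  = here (≡ᵇ-sound j≡x)
  ... | false = there (∈ᵇ-sound j X eq)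

  ∈ᵇ-complete : ∀ {j X} → j ∈ X → (j ∈ᵇ X) ≡ true
  ∈ᵇ-complete {j} (here refl) rewrite ≡ᵇ-refl j = refl
  ∈ᵇ-complete {j} {x ∷ X} (there j∈) rewrite ∈ᵇ-complete j∈ = ∨-trueʳ (j ≡ᵇ x)

  ∈ᵇ-false : ∀ {j X} → ¬ j ∈ X → (j ∈ᵇ X) ≡ false
  ∈ᵇ-false {j} {X} j∉ with j ∈ᵇ X in eq
  ... | false = refl
  ... | true  = ⊥-elim (j∉ (∈ᵇ-sound j X eq))

  ∈ᵇ-++ : ∀ j X Y → (j ∈ᵇ (X ++ Y)) ≡ (j ∈ᵇ X) ∨ (j ∈ᵇ Y)
  ∈ᵇ-++ j []      Y = refl
  ∈ᵇ-++ j (x ∷ X) Y = trans (cong ((j ≡ᵇ x) ∨_) (∈ᵇ-++ j X Y)) (sym (∨-assoc (j ≡ᵇ x) _ _))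

  ≡ᵇ-≢ : ∀ {m n} → m ≢ n → (m ≡ᵇ n) ≡ false
  ≡ᵇ-≢ {m} {n} m≢n with m ≡ᵇ n in eq
  ... | false = refl
  ... | true  = ⊥-elim (m≢n (≡ᵇ-sound eq))

  <⇒∉ : ∀ {x X} → All (x <_) X → ¬ x ∈ X
  <⇒∉ x< x∈ = ℕₚ.<-irrefl refl (All.lookup x< x∈)

  <ᵇ-false : ∀ {m n} → ¬ m < n → (m <ᵇ n) ≡ false
  <ᵇ-false {m} {n} m≮n with m <ᵇ n in eq
  ... | false = refl
  ... | true  = ⊥-elim (m≮n (ℕₚ.<ᵇ⇒< m n (≡⇒T eq)))

  ∈-range : ∀ {lo n j} → lo ≤ j → j < lo + n → j ∈ range lo n
  ∈-range {lo} {zero}  lo≤j j< = ⊥-elim (ℕₚ.<-irrefl refl (ℕₚ.≤-trans j< (subst (_≤ _) (sym (ℕₚ.+-identityʳ lo)) lo≤j)))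
  ∈-range {lo} {suc n} {j} lo≤j j< with j ℕₚ.≟ lo
  ... | yes j≡lo = here j≡lo
  ... | no j≢lo  = there (∈-range (ℕₚ.≤∧≢⇒< lo≤j (j≢lo ∘ sym)) (subst (j <_) (ℕₚ.+-suc lo n) j<))

  prodTo : ℕ → (ℕ → ℚ) → ℚ
  prodTo zero    g = 1ℚ
  prodTo (suc n) g = g n ℚ.* prodTo n g

  prodTo-cong : ∀ n {g h} → (∀ j → j < n → g j ≡ h j) → prodTo n g ≡ prodTo n h
  prodTo-cong zero    eq = refl
  prodTo-cong (suc n) eq = cong₂ ℚ._*_ (eq n ℕₚ.≤-refl) (prodTo-cong n (λ j j< → eq j (ℕₚ.m≤n⇒m≤1+n j<)))

  weigh : (ℕ → ℚ) → (ℕ → Bool) → ℕ → ℚ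
  weigh s u j = if u j then s j else 1ℚ

  prodTo-remove : ∀ n s (u : ℕ → Bool) y → y < n → u y ≡ true →
    prodTo n (weigh s (λ j → u j ∧ not (j ≡ᵇ y))) ℚ.* s y ≡ prodTo n (weigh s u)
  prodTo-remove (suc n) s u y y<n uy with y ℕₚ.≟ n
  ... | yes refl rewrite uy | ≡ᵇ-refl n = trans
    (cong (ℚ._* s n) (trans (ℚₚ.*-identityˡ _) (prodTo-cong n same))) (ℚₚ.*-comm _ (s n))
    where
    same : ∀ j → j < n → weigh s (λ j → u j ∧ not (j ≡ᵇ n)) j ≡ weigh s u j
    same j j<n rewrite ≡ᵇ-≢ (ℕₚ.<⇒≢ j<n) | ∧-identityʳ (u j) = refl
  ... | no y≢n rewrite ≡ᵇ-≢ (y≢n ∘ sym) | ∧-identityʳ (u n) = trans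
    (ℚₚ.*-assoc (weigh s u n) _ (s y))
    (cong (weigh s u n ℚ.*_) (prodTo-remove n s u y (ℕₚ.≤∧≢⇒< (ℕₚ.≤-pred y<n) y≢n) uy))

  -- The vertical lozenges sit at the positions without a particle. Multiplying by the factors at
  -- the particles completes their weight to a product that no longer depends on the tiling.
  prodTo-split : ∀ n s (u : ℕ → Bool) X → AllPairs _<_ X → All (λ x → x < n × u x ≡ true) X →
    prodTo n (weigh s (λ j → u j ∧ not (j ∈ᵇ X))) ℚ.* prod s X ≡ prodTo n (weigh s u)
  prodTo-split n s u [] _ _ = trans (ℚₚ.*-identityʳ _)
    (prodTo-cong n (λ j _ → cong (λ z → if z then s j else 1ℚ) (∧-identityʳ (u j))))
  prodTo-split n s u (x ∷ X) (x< ∷ sX) ((x<n , ux) ∷ uX) = begin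
    prodTo n (weigh s (λ j → u j ∧ not (j ∈ᵇ (x ∷ X)))) ℚ.* (s x ℚ.* prod s X)
      ≡⟨ sym (ℚₚ.*-assoc (prodTo n (weigh s (λ j → u j ∧ not (j ∈ᵇ (x ∷ X))))) (s x) (prod s X)) ⟩
    prodTo n (weigh s (λ j → u j ∧ not (j ∈ᵇ (x ∷ X)))) ℚ.* s x ℚ.* prod s X
      ≡⟨ cong (λ z → z ℚ.* s x ℚ.* prod s X) (prodTo-cong n (λ j _ → cong (λ z → if z then s j else 1ℚ) (regroup (u j) (j ≡ᵇ x) (j ∈ᵇ X)))) ⟩
    prodTo n (weigh s (λ j → (u j ∧ not (j ∈ᵇ X)) ∧ not (j ≡ᵇ x))) ℚ.* s x ℚ.* prod s X
      ≡⟨ cong (ℚ._* prod s X) (prodTo-remove n s (λ j → u j ∧ not (j ∈ᵇ X)) x x<n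
           (cong₂ _∧_ ux (cong not (∈ᵇ-false (<⇒∉ x<))))) ⟩
    prodTo n (weigh s (λ j → u j ∧ not (j ∈ᵇ X))) ℚ.* prod s X
      ≡⟨ prodTo-split n s u X sX uX ⟩
    prodTo n (weigh s u) ∎
    where
    open ≡-Reasoning
    regroup : ∀ p q r → p ∧ not (q ∨ r) ≡ (p ∧ not r) ∧ not q
    regroup false q     r     = refl
    regroup true  true  r     = sym (∧-zeroʳ (not r))
    regroup true  false r     = sym (∧-identityʳ (not r))

  -- Descending from height t + 1 to height t, the particle at j stays at j or moves to j ∸ 1.
  module Paths (onLine : ℕ → ℕ → Bool) (R : ℕ → ℕ → Row) where

    χ : ℕ → ℕ → ℚ
    χ t j = if onLine t j then 1ℚ else 0ℚ

    -- A particle at 0 has nowhere to move. The zero row is written as a multiple of `R t 0`, the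
    -- form in which `det-zero-row` removes it.
    moved : ℕ → ℕ → Row
    moved t zero    = 0ℚ ⊙ R t 0
    moved t (suc j) = χ t j ⊙ R t j

    step : ℕ → ℕ → Row
    step t j = moved t j ⊕ (χ t j ⊙ R t j)

  module Bands (a b c : ℕ) (wt : Lozenge → ℚ) (s : ℕ → ℕ → ℚ) (R : ℕ → ℕ → Row) where

    open Region′ a b c wt
    open Paths onLine R

    -- `R-step` carries a factor `s` because a visited position has no vertical lozenge: its row is
    -- divided by the weight which that lozenge would have had, and every line can then be charged
    -- its full weight. `R-diag` and `R-lower` ask the rows on BC only to be unitriangular, which
    -- leaves room for column operations.
    module Sweep
      (wt-left  : ∀ i k → wt (loz leftL i k) ≡ 1ℚ)
      (wt-right : ∀ i k → wt (loz rightL i k) ≡ 1ℚ)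
      (wt-vert  : ∀ j t → onLine (suc t) j ≡ true → wt (loz vert (column j) (+ suc t)) ≡ s (suc t) j)
      (R-diag   : ∀ j → j ≤ c → R 0 j j ≡ 1ℚ)
      (R-lower  : ∀ j k → j < k → R 0 j k ≡ 0ℚ)
      (R-step   : ∀ t j → onLine (suc t) j ≡ true → step t j ≗ s (suc t) j ⊙ R (suc t) j)
      where

      -- The triangles left after clearing all rows above k: u and d are the up- and down-triangles
      -- left in row k, d′ the down-triangles left in row k ∸ 1.
      band : ℕ → (u d d′ : ℕ → Bool) → Cells
      band k u d d′ up   j t = if t ≡ᵇ k then u j else (if t <ᵇ k then memℕ up j t else false)
      band k u d d′ down j t = if t ≡ᵇ k then d j else
        (if suc t ≡ᵇ k then d′ j else (if t <ᵇ k then memℕ down j t else false))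

      ∅ : ℕ → Bool
      ∅ _ = false

      band-cong : ∀ k {u v d e d′ e′} → u ≗ v → d ≗ e → d′ ≗ e′ → ∀ o j t → band k u d d′ o j t ≡ band k v e e′ o j t
      band-cong k u≗ d≗ d′≗ up j t with t ≡ᵇ k
      ... | true  = u≗ j
      ... | false = refl
      band-cong k u≗ d≗ d′≗ down j t with t ≡ᵇ k | suc t ≡ᵇ k
      ... | true  | _     = d≗ j
      ... | false | true  = d′≗ j
      ... | false | false = refl

      tilings-cong : ∀ {f g} → (∀ o j t → f o j t ≡ g o j t) → tilings f ≡ tilings g
      tilings-cong eq = Z-cong Ls (set-cong eq)

      band-⊆ : ∀ k {u d d′} → (∀ j → u j ≡ true → memℕ up j k ≡ true) → (∀ j → d j ≡ true → memℕ down j k ≡ true) →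
        (∀ j t → suc t ≡ k → d′ j ≡ true → memℕ down j t ≡ true) → band k u d d′ ⊆mem
      band-⊆ k u⊆ d⊆ d′⊆ up j t eq with t ≡ᵇ k in t≡k
      ... | true  = subst (λ z → memℕ up j z ≡ true) (sym (≡ᵇ-sound t≡k)) (u⊆ j eq)
      ... | false with t <ᵇ k
      ...   | true = eq
      band-⊆ k u⊆ d⊆ d′⊆ down j t eq with t ≡ᵇ k in t≡k
      ... | true  = subst (λ z → memℕ down j z ≡ true) (sym (≡ᵇ-sound t≡k)) (d⊆ j eq)
      ... | false with suc t ≡ᵇ k in t≡k′
      ...   | true  = d′⊆ j t (≡ᵇ-sound {suc t} t≡k′) eq
      ...   | false with t <ᵇ k
      ...     | true = eq

      band-up : ∀ k u d d′ j → band k u d d′ up j k ≡ u j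
      band-up k u d d′ j rewrite ≡ᵇ-refl k = refl

      band-down : ∀ k u d d′ j → band k u d d′ down j k ≡ d j
      band-down k u d d′ j rewrite ≡ᵇ-refl k = refl

      suc≢ᵇ : ∀ k → (k ≡ᵇ suc k) ≡ false
      suc≢ᵇ zero    = refl
      suc≢ᵇ (suc k) = suc≢ᵇ k

      suc≢ᵇ′ : ∀ k → (suc k ≡ᵇ k) ≡ false
      suc≢ᵇ′ zero    = refl
      suc≢ᵇ′ (suc k) = suc≢ᵇ′ k

      suc≮ᵇ : ∀ k → (suc k <ᵇ k) ≡ false
      suc≮ᵇ zero    = refl
      suc≮ᵇ (suc k) = suc≮ᵇ k

      band-below : ∀ k u d d′ j → band (suc k) u d d′ down j k ≡ d′ j
      band-below k u d d′ j rewrite suc≢ᵇ k | ≡ᵇ-refl k = refl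

      band-above : ∀ k u d d′ j → band k u d d′ up j (suc k) ≡ false
      band-above k u d d′ j rewrite suc≢ᵇ′ k | suc≮ᵇ k = refl

      drop : (ℕ → Bool) → ℕ → ℕ → Bool
      drop u y j = u j ∧ not (j ≡ᵇ y)

      remove-vert : ∀ k u d′ y o j t →
        remove y (suc k) y k (band (suc k) u ∅ d′) o j t ≡ band (suc k) (drop u y) ∅ (drop d′ y) o j t
      remove-vert k u d′ y up j t with t ≡ᵇ suc k
      ... | true  = cong (λ z → u j ∧ not z) (∧-identityʳ (j ≡ᵇ y))
      ... | false = trans (cong (λ z → (if t <ᵇ suc k then memℕ up j t else false) ∧ not z) (∧-zeroʳ (j ≡ᵇ y))) (∧-identityʳ _)
      remove-vert k u d′ y down j t with t ≡ᵇ suc k in t≡ | t ≡ᵇ k in t≡′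
      ... | true  | _     = refl
      ... | false | true  = cong (λ z → d′ j ∧ not z) (∧-identityʳ (j ≡ᵇ y))
      ... | false | false = trans (cong (λ z → (if t <ᵇ suc k then memℕ down j t else false) ∧ not z) (∧-zeroʳ (j ≡ᵇ y))) (∧-identityʳ _)

      remove-side : ∀ k u d d′ y x o j t →
        remove y k x k (band k u d d′) o j t ≡ band k (drop u y) (drop d x) d′ o j t
      remove-side k u d d′ y x up j t with t ≡ᵇ k
      ... | true  = cong (λ z → u j ∧ not z) (∧-identityʳ (j ≡ᵇ y))
      ... | false = trans (cong (λ z → (if t <ᵇ k then memℕ up j t else false) ∧ not z) (∧-zeroʳ (j ≡ᵇ y))) (∧-identityʳ _)
      remove-side k u d d′ y x down j t with t ≡ᵇ k
      ... | true  = cong (λ z → d j ∧ not z) (∧-identityʳ (j ≡ᵇ x))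
      ... | false = trans (cong (λ z → (if suc t ≡ᵇ k then d′ j else (if t <ᵇ k then memℕ down j t else false)) ∧ not z)
                            (∧-zeroʳ (j ≡ᵇ x))) (∧-identityʳ _)

      drop-true : ∀ {u} y {j} → drop u y j ≡ true → u j ≡ true × j ≢ y
      drop-true {u} y {j} eq with ∧-true {u j} eq
      ... | uj , n = uj , λ { refl → contra (trans (sym n) (cong not (≡ᵇ-refl j))) }
        where
        contra : ¬ true ≡ false
        contra ()

      -- No down-triangle is left in row k + 1, so `pivot-up` forces each remaining up-triangle of
      -- that row, the largest position first; n bounds the positions still to be treated.
      clear-verticals : ∀ k n u d′ → (∀ j → u j ≡ true → j < n) →
        (∀ j → u j ≡ true → memℕ up j (suc k) ≡ true) → (∀ j → u j ≡ true → d′ j ≡ true) →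
        (∀ j → d′ j ≡ true → memℕ down j k ≡ true) →
        tilings (band (suc k) u ∅ d′) ≡
        prodTo n (weigh (s (suc k)) u) ℚ.* tilings (band (suc k) ∅ ∅ (λ j → d′ j ∧ not (u j)))
      clear-verticals k zero u d′ u<0 u⊆ u⊆d d⊆ = trans
        (tilings-cong (band-cong (suc k) none (λ _ → refl)
          (λ j → sym (trans (cong (λ z → d′ j ∧ not z) (none j)) (∧-identityʳ (d′ j))))))
        (sym (ℚₚ.*-identityˡ _))
        where
        none : ∀ j → u j ≡ false
        none j with u j in uj
        ... | false = refl
        ... | true with u<0 j uj
        ...   | ()
      clear-verticals k (suc n) u d′ u<n u⊆ u⊆d d⊆ with u n in un
      ... | false = trans (clear-verticals k n u d′ u<n′ u⊆ u⊆d d⊆)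
        (cong (ℚ._* tilings (band (suc k) ∅ ∅ (λ j → d′ j ∧ not (u j)))) (sym (ℚₚ.*-identityˡ (prodTo n (weigh (s (suc k)) u)))))
        where
        u<n′ : ∀ j → u j ≡ true → j < n
        u<n′ j uj = ℕₚ.≤∧≢⇒< (ℕₚ.≤-pred (u<n j uj)) λ { refl → contra (trans (sym uj) un) }
          where
          contra : ¬ true ≡ false
          contra ()
      ... | true = begin
        tilings (band (suc k) u ∅ d′)
          ≡⟨ pivot-up {band (suc k) u ∅ d′} (band-⊆ (suc k) {u} {∅} {d′} u⊆ (λ _ ()) (λ j t eq → subst (λ z → d′ j ≡ true → memℕ down j z ≡ true) (sym (ℕₚ.suc-injective eq)) (d⊆ j)))
               n k (trans (band-up (suc k) u ∅ d′ n) un) (band-down (suc k) u ∅ d′ n) (band-down (suc k) u ∅ d′ (suc n))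
               (trans (band-below k u ∅ d′ n) (u⊆d n un)) ⟩
        wt (loz vert (column n) (+ suc k)) ℚ.* tilings (remove n (suc k) n k (band (suc k) u ∅ d′))
          ≡⟨ cong₂ ℚ._*_ (wt-vert n k (proj₁ (∧-true {onLine (suc k) n} (proj₂ (∧-true {suc (suc k) ≤ᵇ height} (u⊆ n un)))))) (tilings-cong (remove-vert k u d′ n)) ⟩
        s (suc k) n ℚ.* tilings (band (suc k) (drop u n) ∅ (drop d′ n))
          ≡⟨ cong (s (suc k) n ℚ.*_) (clear-verticals k n (drop u n) (drop d′ n)
               (λ j eq → let (uj , j≢n) = drop-true {u} n eq in ℕₚ.≤∧≢⇒< (ℕₚ.≤-pred (u<n j uj)) j≢n)
               (λ j eq → u⊆ j (proj₁ (drop-true {u} n eq)))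
               (λ j eq → let (uj , j≢n) = drop-true {u} n eq in cong₂ _∧_ (u⊆d j uj) (cong not (≡ᵇ-≢ j≢n)))
               (λ j eq → d⊆ j (proj₁ (drop-true {d′} n eq)))) ⟩
        s (suc k) n ℚ.* (prodTo n (weigh (s (suc k)) (drop u n)) ℚ.* tilings (band (suc k) ∅ ∅ (λ j → drop d′ n j ∧ not (drop u n j))))
          ≡⟨ cong₂ (λ p q → s (suc k) n ℚ.* (p ℚ.* q))
               (prodTo-cong n (λ j j<n → cong (λ z → if z then s (suc k) j else 1ℚ)
                 (trans (cong (λ z → u j ∧ not z) (≡ᵇ-≢ (ℕₚ.<⇒≢ j<n))) (∧-identityʳ (u j)))))
               (tilings-cong (band-cong (suc k) (λ _ → refl) (λ _ → refl) left)) ⟩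
        s (suc k) n ℚ.* (prodTo n (weigh (s (suc k)) u) ℚ.* tilings (band (suc k) ∅ ∅ (λ j → d′ j ∧ not (u j))))
          ≡⟨ sym (ℚₚ.*-assoc (s (suc k) n) _ _) ⟩
        s (suc k) n ℚ.* prodTo n (weigh (s (suc k)) u) ℚ.* tilings (band (suc k) ∅ ∅ (λ j → d′ j ∧ not (u j))) ∎
        where
        open ≡-Reasoning
        left : ∀ j → drop d′ n j ∧ not (drop u n j) ≡ d′ j ∧ not (u j)
        left j with j ≡ᵇ n in j≡n
        ... | false = cong₂ (λ p q → p ∧ not q) (∧-identityʳ (d′ j)) (∧-identityʳ (u j))
        ... | true  = trans (cong (_∧ not (u j ∧ false)) (∧-zeroʳ (d′ j)))
          (sym (trans (cong (λ z → d′ j ∧ not z) (trans (cong u (≡ᵇ-sound {j} j≡n)) un)) (∧-zeroʳ (d′ j))))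

      cols : List ℕ
      cols = range 0 (suc c)

      -- The removed up-triangle behaves like one already used by a lozenge from above, so at height
      -- b + 1 a further particle appears at position 1.
      dents : ℕ → List ℕ
      dents k = if k ≡ᵇ suc b then 1 ∷ [] else []

      dents-∈ᵇ : ∀ k j → (j ∈ᵇ dents k) ≡ (j ≡ᵇ 1) ∧ (k ≡ᵇ suc b)
      dents-∈ᵇ k j with k ≡ᵇ suc b
      ... | true  = trans (∨-identityʳ (j ≡ᵇ 1)) (sym (∧-identityʳ (j ≡ᵇ 1)))
      ... | false = sym (∧-zeroʳ (j ≡ᵇ 1))

      free : ℕ → List ℕ → ℕ → Bool
      free k acc j = onLine k j ∧ not (j ∈ᵇ acc)

      below : ℕ → ℕ → Bool
      below zero    j = false
      below (suc k) j = onLine (suc k) j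

      up-free : ∀ k j → suc k ≤ height → memℕ up j k ≡ free k (dents k) j
      up-free k j k< = trans (cong (_∧ (onLine k j ∧ not ((j ≡ᵇ 1) ∧ (k ≡ᵇ suc b)))) (≤ᵇ-complete {suc k} k<))
        (cong (λ z → onLine k j ∧ not z) (sym (dents-∈ᵇ k j)))

      down-onLine : ∀ k j → suc k ≤ height → memℕ down j k ≡ onLine (suc k) j
      down-onLine k j k< = cong (_∧ onLine (suc k) j) (≤ᵇ-complete {suc k} k<)

      record Particles (k : ℕ) (X : List ℕ) : Set where
        field
          sorted : AllPairs _<_ X
          inside : All (λ x → onLine k x ≡ true) X

      DentsIn : ℕ → List ℕ → Set
      DentsIn k acc = ∀ j → (j ∈ᵇ acc) ≡ false → (j ∈ᵇ dents k) ≡ false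

      free-mem : ∀ k acc → suc k ≤ height → DentsIn k acc → ∀ j → free k acc j ≡ true → memℕ up j k ≡ true
      free-mem k acc k< dents⊆ j eq = let (on , off) = ∧-true {onLine k j} eq in
        trans (up-free k j k<) (cong₂ _∧_ on (cong not (dents⊆ j (not-true off))))
        where
        not-true : ∀ {x} → not x ≡ true → x ≡ false
        not-true {false} _ = refl

      cases : ∀ {A : Set} x → (x ≡ true → A) → (x ≡ false → A) → A
      cases true  f g = f refl
      cases false f g = g refl

      -- `done` is the continuation: it evaluates the state in which all particles from height k + 1
      -- have moved. `P` holds the rows of paths that end at a dent further down.
      module RowSweep (k : ℕ) (h : ℚ) (P : List Row) (k< : suc k ≤ height)
        (done : ∀ acc → Particles k acc → DentsIn k acc → length acc + length P ≡ suc c →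
          tilings (band k (free k acc) ∅ (below k)) ≡ h ℚ.* det (P ++ map (R k) acc) cols) where

        below-mem : ∀ j t → suc t ≡ k → below k j ≡ true → memℕ down j t ≡ true
        below-mem j t refl on = trans (down-onLine t j (ℕₚ.<⇒≤ k<)) on

        state : List ℕ → List ℕ → Cells
        state acc X = band k (free k acc) (_∈ᵇ X) (below k)

        state-⊆ : ∀ acc X → DentsIn k acc → All (λ x → onLine (suc k) x ≡ true) X → state acc X ⊆mem
        state-⊆ acc X dents⊆ X⊆ = band-⊆ k {free k acc} {_∈ᵇ X} {below k} (free-mem k acc k< dents⊆)
          (λ j j∈ → trans (down-onLine k j k<) (All.lookup X⊆ (∈ᵇ-sound j X j∈))) below-mem

        -- The particles are taken in increasing order. Each moves by at most one, so its target is
        -- at least every position in `acc`, and appending it keeps `acc` sorted unless the two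
        -- coincide. The two summands of `step k x` match the two lozenges offered by `pivot-down`.
        sweep : ∀ acc X → Particles k acc → DentsIn k acc → Particles (suc k) X → All (λ x → All (_< x) acc) X →
          length acc + length X + length P ≡ suc c →
          tilings (state acc X) ≡ h ℚ.* det ((P ++ map (R k) acc) ++ map (step k) X) cols
        sweep acc [] pacc dents⊆ _ _ len = trans
          (done acc pacc dents⊆ (trans (cong (ℕ._+ length P) (sym (ℕₚ.+-identityʳ (length acc)))) len))
          (cong (λ rs → h ℚ.* det rs cols) (sym (++-identityʳ (P ++ map (R k) acc))))
        sweep acc (x ∷ X) pacc dents⊆ record { sorted = x< ∷ sX ; inside = xon ∷ Xon } (acc<x ∷ acc<X) len = begin
          tilings f
            ≡⟨ pivot-down {f} (state-⊆ acc (x ∷ X) dents⊆ (xon ∷ Xon)) x k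
                 (trans (band-down k (free k acc) (_∈ᵇ (x ∷ X)) (below k) x) (∈ᵇ-complete {x} {x ∷ X} (here refl)))
                 (band-above k (free k acc) (_∈ᵇ (x ∷ X)) (below k) x) ⟩
          leftChoice f x k ℚ.+ (if f up x k then wt (loz rightL (column x) (+ k)) ℚ.* tilings (remove x k x k f) else 0ℚ)
            ≡⟨ cong₂ ℚ._+_ (left x refl) (choice x (wt-right (column x) (+ k)) (All.map ℕₚ.<⇒≤ acc<x) ℕₚ.≤-refl) ⟩
          h ℚ.* det (pre ++ moved k x ∷ post) cols ℚ.+ h ℚ.* det (pre ++ (χ k x ⊙ R k x) ∷ post) cols
            ≡⟨ sym (ℚₚ.*-distribˡ-+ h (det (pre ++ moved k x ∷ post) cols) (det (pre ++ (χ k x ⊙ R k x) ∷ post) cols)) ⟩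
          h ℚ.* (det (pre ++ moved k x ∷ post) cols ℚ.+ det (pre ++ (χ k x ⊙ R k x) ∷ post) cols)
            ≡⟨ cong (h ℚ.*_) (sym (det-⊕ pre (moved k x) (χ k x ⊙ R k x) post cols)) ⟩
          h ℚ.* det (pre ++ step k x ∷ post) cols ∎
          where
          open ≡-Reasoning
          open Particles pacc
          f : Cells
          f = state acc (x ∷ X)
          pre post : List Row
          pre  = P ++ map (R k) acc
          post = map (step k) X

          value : ℕ → ℚ
          value y = h ℚ.* det (pre ++ (χ k y ⊙ R k y) ∷ post) cols

          value≡ : ∀ y {q d} → χ k y ≡ q → det (pre ++ R k y ∷ post) cols ≡ d → value y ≡ h ℚ.* (q ℚ.* d)
          value≡ y {q} refl refl = cong (h ℚ.*_) (det-⊙ pre (χ k y) (R k y) post cols)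

          f-up : ∀ y → f up y k ≡ free k acc y
          f-up = band-up k (free k acc) (_∈ᵇ (x ∷ X)) (below k)

          next : ∀ y {q} → q ≡ 1ℚ → All (_≤ y) acc → y ≤ x → onLine k y ≡ true → (y ∈ᵇ acc) ≡ false →
            q ℚ.* tilings (remove y k x k f) ≡ h ℚ.* det (pre ++ R k y ∷ post) cols
          next y refl acc≤y y≤x on off = begin
            1ℚ ℚ.* tilings (remove y k x k f)
              ≡⟨ ℚₚ.*-identityˡ _ ⟩
            tilings (remove y k x k f)
              ≡⟨ tilings-cong (λ o j t → trans (remove-side k (free k acc) (_∈ᵇ (x ∷ X)) (below k) y x o j t)
                   (band-cong k {e = _∈ᵇ X} more-used fewer (λ _ → refl) o j t)) ⟩
            tilings (state (acc ++ y ∷ []) X)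
              ≡⟨ sweep (acc ++ y ∷ []) X
                   record { sorted = AllPairsₚ.++⁺ sorted ([] ∷ []) (All.tabulate (λ z∈ → acc<y z∈ ∷ []))
                          ; inside = Allₚ.++⁺ inside (on ∷ []) }
                   (λ j j∉ → dents⊆ j (proj₁ (∨-false (trans (sym (∈ᵇ-++ j acc (y ∷ []))) j∉))))
                   record { sorted = sX ; inside = Xon }
                   (All.zipWith (λ (p , x<x′) → Allₚ.++⁺ p (ℕₚ.≤-<-trans y≤x x<x′ ∷ [])) (acc<X , x<))
                   (trans (cong (ℕ._+ length P) (trans (cong (ℕ._+ length X) (length-++ acc))
                      (trans (ℕₚ.+-assoc (length acc) 1 (length X)) refl))) len) ⟩
            h ℚ.* det ((P ++ map (R k) (acc ++ y ∷ [])) ++ post) cols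
              ≡⟨ cong (λ rs → h ℚ.* det rs cols) (trans (cong (λ z → (P ++ z) ++ post) (map-++ (R k) acc (y ∷ [])))
                   (trans (cong (_++ post) (sym (++-assoc P (map (R k) acc) (R k y ∷ []))))
                          (++-assoc pre (R k y ∷ []) post))) ⟩
            h ℚ.* det (pre ++ R k y ∷ post) cols ∎
            where
            ∨-false : ∀ {p q} → p ∨ q ≡ false → p ≡ false × q ≡ false
            ∨-false {false} eq = refl , eq
            acc<y : ∀ {z} → z ∈ acc → z < y
            acc<y z∈ = ℕₚ.≤∧≢⇒< (All.lookup acc≤y z∈) λ { refl → absurd (trans (sym off) (∈ᵇ-complete z∈)) }
              where
              absurd : ¬ false ≡ true
              absurd ()
            more-used : ∀ j → drop (free k acc) y j ≡ free k (acc ++ y ∷ []) j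
            more-used j = trans (regroup (onLine k j) (j ∈ᵇ acc) (j ≡ᵇ y))
              (cong (λ z → onLine k j ∧ not z) (sym (trans (∈ᵇ-++ j acc (y ∷ [])) (cong ((j ∈ᵇ acc) ∨_) (∨-identityʳ (j ≡ᵇ y))))))
              where
              regroup : ∀ p q r → (p ∧ not q) ∧ not r ≡ p ∧ not (q ∨ r)
              regroup false q     r = refl
              regroup true  true  r = refl
              regroup true  false r = refl
            fewer : ∀ j → drop (_∈ᵇ (x ∷ X)) x j ≡ (j ∈ᵇ X)
            fewer j with j ≡ᵇ x in j≡x
            ... | false = ∧-identityʳ (j ∈ᵇ X)
            ... | true  = sym (trans (cong (_∈ᵇ X) (≡ᵇ-sound {j} j≡x)) (∈ᵇ-false (<⇒∉ x<)))

          choice : ∀ y {q} → q ≡ 1ℚ → All (_≤ y) acc → y ≤ x →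
            (if f up y k then q ℚ.* tilings (remove y k x k f) else 0ℚ) ≡ value y
          choice y q≡1 acc≤y y≤x = cases (onLine k y)
            (λ on → cases (y ∈ᵇ acc)
              -- On a collision both sides vanish: the up-triangle is taken, and the determinant has
              -- two equal rows.
              (λ used → trans (if-cong (trans (f-up y) (trans (cong (λ z → onLine k y ∧ not z) used) (∧-zeroʳ _))))
                (sym (trans (value≡ y refl (det-member (R k) P acc y post (∈ᵇ-sound y acc used) cols))
                  (trans (cong (h ℚ.*_) (ℚₚ.*-zeroʳ (χ k y))) (ℚₚ.*-zeroʳ h)))))
              (λ off → trans (if-cong (trans (f-up y) (cong₂ (λ p z → p ∧ not z) on off)))
                (trans (next y q≡1 acc≤y y≤x on off)
                  (sym (trans (value≡ y (if-cong on) refl) (cong (h ℚ.*_) (ℚₚ.*-identityˡ _)))))))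
            (λ off → trans (if-cong (trans (f-up y) (cong (_∧ not (y ∈ᵇ acc)) off)))
              (sym (trans (value≡ y (if-cong off) refl)
                (trans (cong (h ℚ.*_) (ℚₚ.*-zeroˡ (det (pre ++ R k y ∷ post) cols))) (ℚₚ.*-zeroʳ h)))))

          left : ∀ y → y ≡ x → leftChoice f y k ≡ h ℚ.* det (pre ++ moved k y ∷ post) cols
          left zero    y≡x = sym (trans (cong (h ℚ.*_) (det-zero-row pre (R k 0) post cols)) (ℚₚ.*-zeroʳ h))
          left (suc y) refl = choice y (wt-left (column y) (+ k)) (All.map ℕₚ.≤-pred acc<x) (ℕₚ.n≤1+n y)

      tilings-empty : ∀ {f} → (∀ o j t → f o j t ≡ false) → tilings f ≡ 1ℚ
      tilings-empty {f} eq = Z-empty Ls dead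
        where
        dead : ∀ s → set f s ≡ false
        dead s with locate-tri s
        ... | at o j t    = trans (set-at f o j t) (eq o j t)
        ... | outside z _ = z f

      -- The weight the line would have if every one of its positions carried a vertical lozenge.
      lineWeight : ℕ → ℚ
      lineWeight t = prodTo (a + c + 2) (weigh (s t) (onLine t))

      totalWeight : ℕ → ℚ
      totalWeight zero    = 1ℚ
      totalWeight (suc k) = lineWeight (suc k) ℚ.* totalWeight k

      -- Rows of the dents at heights up to k. They wait in front of the moving rows until the sweep
      -- reaches their height, where `fixed-split` hands them over to `acc`.
      fixed : ℕ → List Row
      fixed zero    = []
      fixed (suc k) = fixed k ++ map (R (suc k)) (dents (suc k))

      onLine-< : ∀ t {j} → onLine t j ≡ true → j < a + c + 2
      onLine-< t {j} on = ℕₚ.≤-trans (s≤s (proj₁ (proj₂ (onLine-sound {t} {j} on)))) (ℕₚ.≤-reflexive (sym (ℕₚ.+-suc (a + c) 1)))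

      -- All edges of BC are occupied, so nothing is left to tile, and the determinant is
      -- unitriangular.
      clear-bottom : ∀ acc → Particles 0 acc → length acc + 0 ≡ suc c →
        tilings (band 0 (free 0 acc) ∅ (below 0)) ≡ 1ℚ ℚ.* det ([] ++ map (R 0) acc) cols
      clear-bottom acc pacc len = trans (tilings-empty nothing)
        (sym (trans (ℚₚ.*-identityˡ _) (trans (cong (λ X → det (map (R 0) X) cols) acc≡)
          (det-unitriangular (R 0) 0 (suc c) (λ j j< → R-diag j (ℕₚ.≤-pred j<)) R-lower))))
        where
        open Particles pacc
        bound : ∀ {j} → onLine 0 j ≡ true → j < suc c
        bound {j} on = s≤s (double-cancel-≤ {j} {c} (proj₂ (proj₂ (onLine-sound {0} {j} on))))
        acc≡ : acc ≡ range 0 (suc c)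
        acc≡ = sorted-range 0 (suc c) acc sorted (All.universal (λ _ → z≤n) acc) (All.map bound inside)
          (trans (sym (ℕₚ.+-identityʳ _)) len)
        none : ∀ j → free 0 acc j ≡ false
        none j = cases (onLine 0 j)
          (λ on → trans (cong (λ z → onLine 0 j ∧ not z)
            (∈ᵇ-complete (subst (j ∈_) (sym acc≡) (∈-range z≤n (bound on))))) (∧-zeroʳ _))
          (λ off → cong (_∧ not (j ∈ᵇ acc)) off)
        nothing : ∀ o j t → band 0 (free 0 acc) ∅ (below 0) o j t ≡ false
        nothing up   j zero    = none j
        nothing up   j (suc t) = refl
        nothing down j zero    = refl
        nothing down j (suc t) = refl

      -- What is left after clearing a line is the initial state of the sweep one row further down.
      lower-band : ∀ k {d} X → suc (suc k) ≤ height → d ≗ (_∈ᵇ X) → ∀ o j t →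
        band (suc k) ∅ ∅ d o j t ≡ band k (λ j → memℕ up j k) (_∈ᵇ X) (below k) o j t
      lower-band k X k< d≗ o j t with ℕₚ.<-cmp t k
      lower-band k X k< d≗ up j t | tri< t<k t≢k _
        rewrite ≡ᵇ-≢ t≢k | ≡ᵇ-≢ (ℕₚ.<⇒≢ (ℕₚ.m<n⇒m<1+n t<k)) | T⇒≡ (ℕₚ.<⇒<ᵇ t<k) | T⇒≡ (ℕₚ.<⇒<ᵇ (ℕₚ.m<n⇒m<1+n t<k)) = refl
      lower-band k X k< d≗ up j t | tri≈ _ refl _
        rewrite suc≢ᵇ k | ≡ᵇ-refl k | T⇒≡ (ℕₚ.<⇒<ᵇ (ℕₚ.n<1+n k)) = refl
      lower-band k X k< d≗ up j t | tri> t≮k t≢k k<t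
        rewrite ≡ᵇ-≢ t≢k | <ᵇ-false t≮k | <ᵇ-false (ℕₚ.≤⇒≯ k<t) with t ≡ᵇ suc k
      ... | true  = refl
      ... | false = refl
      lower-band k X k< d≗ down j t | tri< t<k t≢k _
        rewrite ≡ᵇ-≢ t≢k | ≡ᵇ-≢ (ℕₚ.<⇒≢ (ℕₚ.m<n⇒m<1+n t<k)) | T⇒≡ (ℕₚ.<⇒<ᵇ t<k) | T⇒≡ (ℕₚ.<⇒<ᵇ (ℕₚ.m<n⇒m<1+n t<k))
        with suc t ≡ᵇ k in st≡k
      ... | false = refl
      ... | true  = trans (down-onLine t j (ℕₚ.≤-trans t<k (ℕₚ.≤-trans (ℕₚ.n≤1+n k) (ℕₚ.<⇒≤ k<))))
                          (cong (λ z → below z j) (≡ᵇ-sound {suc t} {k} st≡k))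
      lower-band k X k< d≗ down j t | tri≈ _ refl _
        rewrite suc≢ᵇ k | ≡ᵇ-refl k = d≗ j
      lower-band k X k< d≗ down j t | tri> t≮k t≢k k<t
        rewrite ≡ᵇ-≢ t≢k | <ᵇ-false t≮k | <ᵇ-false (ℕₚ.≤⇒≯ k<t) | ≡ᵇ-≢ (ℕₚ.>⇒≢ (ℕₚ.m<n⇒m<1+n k<t)) with t ≡ᵇ suc k
      ... | true  = refl
      ... | false = refl

      dents-sorted : ∀ k → AllPairs _<_ (dents k)
      dents-sorted k with k ≡ᵇ suc b
      ... | true  = [] ∷ []
      ... | false = []

      dents-inside : ∀ k → All (λ x → onLine k x ≡ true) (dents k)
      dents-inside k with k ≡ᵇ suc b in eq
      ... | false = []
      ... | true  = subst (λ z → onLine z 1 ≡ true) (sym (≡ᵇ-sound {k} eq))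
        (onLine-complete (suc b) 1 (ℕₚ.≤-reflexive (ℕₚ.+-comm 1 b)) (ℕₚ.m≤n+m 1 (a + c))
          (s≤s (ℕₚ.m≤n+m 1 (b + 2 * c)))) ∷ []

      -- At height b + 2 the side DE forces every position to be at least 2. Hence the dent at 1
      -- comes first in the order and no sign arises.
      dents-below : ∀ k {X} → All (λ x → onLine (suc k) x ≡ true) X → All (λ x → All (_< x) (dents k)) X
      dents-below k Xon with k ≡ᵇ suc b in eq
      ... | false = All.map (λ _ → []) Xon
      ... | true  = All.map (λ {x} on → ℕₚ.+-cancelˡ-≤ b 2 x (ℕₚ.≤-trans (ℕₚ.≤-reflexive
          (trans (ℕₚ.+-comm b 2) (cong suc (sym (≡ᵇ-sound {k} eq))))) (proj₁ (onLine-sound {suc k} {x} on))) ∷ []) Xon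

      fixed-end : ℕ → List Row
      fixed-end zero    = []
      fixed-end (suc k) = fixed k

      fixed-split : ∀ k → fixed k ≡ fixed-end k ++ map (R k) (dents k)
      fixed-split zero    = refl
      fixed-split (suc k) = refl

      -- A mutual induction on the height: `sweep-down` moves the particles from height k + 1 to
      -- height k, and `clear-line` places the vertical lozenges at height k and calls `sweep-down`
      -- one row lower. The length condition keeps the determinant square.
      sweep-down : ∀ k X → suc k ≤ height → Particles (suc k) X → length X + length (fixed k) ≡ suc c →
        tilings (band k (λ j → memℕ up j k) (_∈ᵇ X) (below k)) ≡
        totalWeight k ℚ.* det (fixed k ++ map (step k) X) cols
      clear-line : ∀ k acc → suc k ≤ height → Particles k acc → DentsIn k acc →
        length acc + length (fixed-end k) ≡ suc c →
        tilings (band k (free k acc) ∅ (below k)) ≡ totalWeight k ℚ.* det (fixed-end k ++ map (R k) acc) cols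

      sweep-down k X k< pX len = begin
        tilings (band k (λ j → memℕ up j k) (_∈ᵇ X) (below k))
          ≡⟨ tilings-cong (band-cong k (λ j → up-free k j k<) (λ _ → refl) (λ _ → refl)) ⟩
        tilings (band k (free k (dents k)) (_∈ᵇ X) (below k))
          ≡⟨ RowSweep.sweep k (totalWeight k) (fixed-end k) k< (λ acc → clear-line k acc k<) (dents k) X record { sorted = dents-sorted k ; inside = dents-inside k } (λ _ eq → eq)
               pX (dents-below k (Particles.inside pX)) len′ ⟩
        totalWeight k ℚ.* det ((fixed-end k ++ map (R k) (dents k)) ++ map (step k) X) cols
          ≡⟨ cong (λ rs → totalWeight k ℚ.* det (rs ++ map (step k) X) cols) (sym (fixed-split k)) ⟩
        totalWeight k ℚ.* det (fixed k ++ map (step k) X) cols ∎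
        where
        open ≡-Reasoning
        len′ : length (dents k) + length X + length (fixed-end k) ≡ suc c
        len′ = trans (e (length (dents k)) (length X) (length (fixed-end k)))
          (trans (cong (λ n → length X + n) (sym (trans (cong length (fixed-split k))
            (trans (length-++ (fixed-end k)) (cong (length (fixed-end k) ℕ.+_) (length-map (R k) (dents k))))))) len)
          where
          e : ∀ p q r → p + q + r ≡ q + (r + p)
          e = ℕ-Ring.solve-∀

      clear-line zero    acc k< pacc dents⊆ len = clear-bottom acc pacc len
      clear-line (suc k) acc k< pacc dents⊆ len = begin
        tilings (band (suc k) (free (suc k) acc) ∅ (onLine (suc k)))
          ≡⟨ clear-verticals k (a + c + 2) (free (suc k) acc) (onLine (suc k))
               (λ j eq → onLine-< (suc k) (proj₁ (∧-true eq)))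
               (free-mem (suc k) acc k< dents⊆)
               (λ j eq → proj₁ (∧-true eq))
               (λ j on → trans (down-onLine k j (ℕₚ.<⇒≤ k<)) on) ⟩
        holes ℚ.* tilings (band (suc k) ∅ ∅ (λ j → onLine (suc k) j ∧ not (free (suc k) acc j)))
          ≡⟨ cong (holes ℚ.*_) (trans (tilings-cong (lower-band k acc k< rest))
               (sweep-down k acc (ℕₚ.<⇒≤ k<) pacc len)) ⟩
        holes ℚ.* (totalWeight k ℚ.* det (fixed k ++ map (step k) acc) cols)
          ≡⟨ cong (λ z → holes ℚ.* (totalWeight k ℚ.* z))
               (det-scale (s (suc k)) (R (suc k)) (step k) (fixed k) acc (All.map (R-step k _) inside) cols) ⟩
        holes ℚ.* (totalWeight k ℚ.* (prod (s (suc k)) acc ℚ.* d))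
          ≡⟨ solve 4 (λ h t p d → h :* (t :* (p :* d)) := (h :* p) :* t :* d) refl
               holes (totalWeight k) (prod (s (suc k)) acc) d ⟩
        (holes ℚ.* prod (s (suc k)) acc) ℚ.* totalWeight k ℚ.* d
          ≡⟨ cong (λ z → z ℚ.* totalWeight k ℚ.* d)
               (prodTo-split (a + c + 2) (s (suc k)) (onLine (suc k)) acc sorted
                 (All.map (λ on → onLine-< (suc k) on , on) inside)) ⟩
        lineWeight (suc k) ℚ.* totalWeight k ℚ.* d ∎
        where
        open ≡-Reasoning
        open Particles pacc
        holes d : ℚ
        holes = prodTo (a + c + 2) (weigh (s (suc k)) (free (suc k) acc))
        d = det (fixed k ++ map (R (suc k)) acc) cols
        rest : ∀ j → onLine (suc k) j ∧ not (free (suc k) acc j) ≡ (j ∈ᵇ acc)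
        rest j = cases (j ∈ᵇ acc)
          (λ used → trans (cong₂ (λ p q → p ∧ not (p ∧ not q)) (All.lookup inside (∈ᵇ-sound j acc used)) used) (sym used))
          (λ off → trans (cong (λ q → onLine (suc k) j ∧ not (onLine (suc k) j ∧ not q)) off)
            (trans (contradictory (onLine (suc k) j)) (sym off)))
          where
          contradictory : ∀ p → p ∧ not (p ∧ true) ≡ false
          contradictory true  = refl
          contradictory false = refl

      top : ℕ
      top = suc b + a

      fixed-low : ∀ k → k ≤ b → fixed k ≡ []
      fixed-low zero    _ = refl
      fixed-low (suc k) k<b rewrite fixed-low k (ℕₚ.<⇒≤ k<b) | ≡ᵇ-≢ (ℕₚ.<⇒≢ k<b) = refl

      fixed-high : ∀ m → fixed (suc b + m) ≡ R (suc b) 1 ∷ []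
      fixed-high zero    rewrite ℕₚ.+-identityʳ b | fixed-low b ℕₚ.≤-refl | ≡ᵇ-refl b = refl
      fixed-high (suc m) rewrite ℕₚ.+-suc b m | fixed-high m | ≡ᵇ-≢ (ℕₚ.>⇒≢ (s≤s (ℕₚ.m≤m+n b m))) = refl

      top-height : suc top ≡ height
      top-height = e a b
        where
        e : ∀ a b → suc (suc b + a) ≡ a + b + 2
        e = ℕ-Ring.solve-∀

      -- DE and FA cut out the c edges of EF. The bound a ≤ b + 1 is what keeps all of them on the
      -- right side of the wall.
      top-row : a ≤ suc b → ∀ j → onLine (suc top) j ≡ (j ∈ᵇ range (a + 2) c)
      top-row a≤ j = true⇔true
        (λ on → let (p , q , _) = onLine-sound {suc top} {j} on in
          ∈ᵇ-complete (∈-range {a + 2} {c} (linear 0 p (e₁ a b j)) (linear 0 q (e₂ a c j))))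
        (λ j∈ → let j∈′ = ∈ᵇ-sound j (range (a + 2) c) j∈
                    lo≤ = All.lookup (range-lower (a + 2) c) j∈′
                    <hi = All.lookup (range-upper (a + 2) c) j∈′ in
          onLine-complete (suc top) j (linear 0 lo≤ (e₃ a b j)) (linear 0 <hi (e₄ a c j))
            (linear 0 (ℕₚ.+-mono-≤ (ℕₚ.*-monoʳ-≤ 2 <hi) a≤) (e₅ a b c j)))
        where
        e₁ : ∀ a b j → j + suc (suc b + a) ≡ a + 2 + (b + j) + 0
        e₁ = ℕ-Ring.solve-∀
        e₂ : ∀ a c j → a + 2 + c + j ≡ suc j + (a + c + 1) + 0
        e₂ = ℕ-Ring.solve-∀
        e₃ : ∀ a b j → b + j + (a + 2) ≡ suc (suc b + a) + j + 0
        e₃ = ℕ-Ring.solve-∀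
        e₄ : ∀ a c j → a + c + 1 + suc j ≡ j + (a + 2 + c) + 0
        e₄ = ℕ-Ring.solve-∀
        e₅ : ∀ a b c j → suc (suc b + a) + 2 * c + 1 + (2 * suc j + a) ≡
             2 * j + (2 * (a + 2 + c) + suc b) + 0
        e₅ = ℕ-Ring.solve-∀

      whole-region : a ≤ suc b → ∀ o j t →
        memℕ o j t ≡ band top (λ j → memℕ up j top) (_∈ᵇ range (a + 2) c) (below top) o j t
      whole-region a≤ o j t with ℕₚ.<-cmp t top
      whole-region a≤ up j t | tri< t<k t≢k _ rewrite ≡ᵇ-≢ t≢k | T⇒≡ (ℕₚ.<⇒<ᵇ t<k) = refl
      whole-region a≤ up j t | tri≈ _ refl _ rewrite ≡ᵇ-refl (b + a) = refl
      whole-region a≤ up j t | tri> t≮k t≢k k<t rewrite ≡ᵇ-≢ t≢k | <ᵇ-false t≮k =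
        cong (_∧ (onLine t j ∧ not ((j ≡ᵇ 1) ∧ (t ≡ᵇ suc b)))) (<ᵇ-false (ℕₚ.≤⇒≯ (subst (_≤ t) top-height k<t)))
      whole-region a≤ down j t | tri< t<k t≢k _ rewrite ≡ᵇ-≢ t≢k | T⇒≡ (ℕₚ.<⇒<ᵇ t<k) with t ≡ᵇ b + a in eq
      ... | false = refl
      ... | true  = trans (down-onLine t j (ℕₚ.≤-trans t<k (ℕₚ.≤-trans (ℕₚ.n≤1+n top) (ℕₚ.≤-reflexive top-height))))
                          (cong (λ z → onLine (suc z) j) (≡ᵇ-sound {t} eq))
      whole-region a≤ down j t | tri≈ _ refl _ rewrite ≡ᵇ-refl (b + a) =
        trans (down-onLine top j (ℕₚ.≤-reflexive top-height)) (top-row a≤ j)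
      whole-region a≤ down j t | tri> t≮k t≢k k<t rewrite ≡ᵇ-≢ t≢k | <ᵇ-false t≮k | ≡ᵇ-≢ (ℕₚ.>⇒≢ (ℕₚ.<⇒≤ k<t)) =
        cong (_∧ onLine (suc t) j) (<ᵇ-false (ℕₚ.≤⇒≯ (subst (_≤ t) top-height k<t)))

      -- The last rows are `step top` and not `R (suc top)`: no vertical lozenge crosses EF, so on
      -- that line there is no weight to divide by.
      M≡det : a ≤ suc b →
        M (S a b c) wt ≡ totalWeight top ℚ.* det (R (suc b) 1 ∷ map (step top) (range (a + 2) c)) cols
      M≡det a≤ = begin
        M (S a b c) wt
          ≡⟨ M≡tilings ⟩
        tilings memℕ
          ≡⟨ tilings-cong (whole-region a≤) ⟩
        tilings (band top (λ j → memℕ up j top) (_∈ᵇ range (a + 2) c) (below top))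
          ≡⟨ sweep-down top (range (a + 2) c) (ℕₚ.≤-reflexive top-height)
               record { sorted = range-sorted (a + 2) c
                      ; inside = All.tabulate (λ {j} j∈ → trans (top-row a≤ j) (∈ᵇ-complete j∈)) }
               (trans (cong₂ ℕ._+_ (length-range (a + 2) c) (cong length (fixed-high a))) (ℕₚ.+-comm c 1)) ⟩
        totalWeight top ℚ.* det (fixed top ++ map (step top) (range (a + 2) c)) cols
          ≡⟨ cong (λ rs → totalWeight top ℚ.* det (rs ++ map (step top) (range (a + 2) c)) cols) (fixed-high a) ⟩
        totalWeight top ℚ.* det (R (suc b) 1 ∷ map (step top) (range (a + 2) c)) cols ∎
        where open ≡-Reasoning

-- Path counts with a wall, and the determinants for the region.

module PathCounts where

  open import Data.Nat using (_+_; _*_)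
  open import Data.Integer using (+_)
  open All using (All; []; _∷_)
  open Determinants
  open ExactCovers
  open Coordinates
  open Pivots
  open Sweeping

  prodTo-one : ∀ n {g} → (∀ j → j < n → g j ≡ 1ℚ) → prodTo n g ≡ 1ℚ
  prodTo-one zero    eq = refl
  prodTo-one (suc n) eq = cong₂ ℚ._*_ (eq n ℕₚ.≤-refl) (prodTo-one n (λ j j< → eq j (ℕₚ.m≤n⇒m≤1+n j<)))

  prodTo-single : ∀ n {g} w → w < n → (∀ j → j ≢ w → g j ≡ 1ℚ) → prodTo n g ≡ g w
  prodTo-single (suc n) {g} w w<n eq with n ℕₚ.≟ w
  ... | yes refl = trans (cong (g n ℚ.*_) (prodTo-one n (λ j j<n → eq j (ℕₚ.<⇒≢ j<n)))) (ℚₚ.*-identityʳ (g n))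
  ... | no n≢w   = trans (cong₂ ℚ._*_ (eq n n≢w) (prodTo-single n w (ℕₚ.≤∧≢⇒< (ℕₚ.≤-pred w<n) (n≢w ∘ sym)) eq))
                         (ℚₚ.*-identityˡ (g w))

  prod-one : ∀ {f : ℕ → ℚ} {X} → All (λ x → f x ≡ 1ℚ) X → prod f X ≡ 1ℚ
  prod-one []         = refl
  prod-one (eq ∷ eqs) = cong₂ ℚ._*_ eq (prod-one eqs)

  -- Row reduction from the end: the last row equals `r j` since its `q` vanishes, and in every
  -- earlier row the multiple of `r (suc j)` duplicates the row that follows.
  det-slide : ∀ (st r : ℕ → Row) (q : ℕ → ℚ) pre lo n →
    (∀ j → lo ≤ j → j < lo + n → st (suc j) ≗ r j ⊕ (q j ⊙ r (suc j))) →
    (∀ j → suc j ≡ lo + n → q j ≡ 0ℚ) →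
    ∀ ks → det (pre ++ map st (range (suc lo) n)) ks ≡ det (pre ++ map r (range lo n)) ks
  det-slide st r q pre lo zero          st≗ last ks = refl
  det-slide st r q pre lo (suc n) st≗ last ks = begin
    det (pre ++ st (suc lo) ∷ map st (range (2 + lo) n)) ks
      ≡⟨ cong (λ rs → det rs ks) (sym (++-assoc pre (st (suc lo) ∷ []) _)) ⟩
    det ((pre ++ st (suc lo) ∷ []) ++ map st (range (2 + lo) n)) ks
      ≡⟨ det-slide st r q (pre ++ st (suc lo) ∷ []) (suc lo) n
           (λ j lo< j< → st≗ j (ℕₚ.<⇒≤ lo<) (subst (j <_) (sym (ℕₚ.+-suc lo n)) j<))
           (λ j eq → last j (trans eq (sym (ℕₚ.+-suc lo n)))) ks ⟩
    det ((pre ++ st (suc lo) ∷ []) ++ map r (range (suc lo) n)) ks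
      ≡⟨ cong (λ rs → det rs ks) (++-assoc pre (st (suc lo) ∷ []) _) ⟩
    det (pre ++ st (suc lo) ∷ map r (range (suc lo) n)) ks
      ≡⟨ det-row-cong pre _ (st≗ lo ℕₚ.≤-refl (ℕₚ.m<m+n lo (s≤s z≤n))) ks ⟩
    det (pre ++ (r lo ⊕ (q lo ⊙ r (suc lo))) ∷ map r (range (suc lo) n)) ks
      ≡⟨ det-⊕ pre (r lo) (q lo ⊙ r (suc lo)) _ ks ⟩
    det (pre ++ r lo ∷ map r (range (suc lo) n)) ks ℚ.+ det (pre ++ (q lo ⊙ r (suc lo)) ∷ map r (range (suc lo) n)) ks
      ≡⟨ cong (λ z → det (pre ++ r lo ∷ map r (range (suc lo) n)) ks ℚ.+ z)
           (trans (det-⊙ pre (q lo) (r (suc lo)) (map r (range (suc lo) n)) ks) (vanish n last)) ⟩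
    det (pre ++ r lo ∷ map r (range (suc lo) n)) ks ℚ.+ 0ℚ
      ≡⟨ ℚₚ.+-identityʳ _ ⟩
    det (pre ++ r lo ∷ map r (range (suc lo) n)) ks ∎
    where
    open ≡-Reasoning
    vanish : ∀ n → (∀ j → suc j ≡ lo + suc n → q j ≡ 0ℚ) →
      q lo ℚ.* det (pre ++ r (suc lo) ∷ map r (range (suc lo) n)) ks ≡ 0ℚ
    vanish zero    last = trans (cong (ℚ._* det (pre ++ r (suc lo) ∷ []) ks) (last lo (ℕₚ.+-comm 1 lo)))
      (ℚₚ.*-zeroˡ (det (pre ++ r (suc lo) ∷ []) ks))
    vanish (suc n) last = trans (cong (q lo ℚ.*_) (det-adjacent pre (r (suc lo)) _ ks)) (ℚₚ.*-zeroʳ (q lo))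

  -- Path counts from the bottom edges, after column operations: with L = t + 2c + 1, the entry in
  -- column k is β (L ∸ 2k) (j ∸ k), and 0 when j < k or c < k.
  module Rows (β : ℕ → ℕ → ℚ) where

    row : ℕ → ℕ → ℕ → Row
    row c       t j       zero    = β (t + 2 * c + 1) j
    row zero    t j       (suc k) = 0ℚ
    row (suc c) t zero    (suc k) = 0ℚ
    row (suc c) t (suc j) (suc k) = row c t j k

    module _ (β-zero : ∀ L → β L 0 ≡ 1ℚ) where

      -- Continued below BC, the wall meets position k at height -(2(c-k)+1), and column k describes
      -- paths from that point. Passing from these points to the edges of BC is unitriangular, so
      -- the determinant is the same as with the edges as starting points.
      row-diag : ∀ c j → j ≤ c → row c 0 j j ≡ 1ℚ
      row-diag c       zero    _         = β-zero (2 * c + 1)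
      row-diag (suc c) (suc j) (s≤s j≤c) = row-diag c j j≤c

      row-lower : ∀ c t j k → j < k → row c t j k ≡ 0ℚ
      row-lower zero    t j       (suc k) _         = refl
      row-lower (suc c) t zero    (suc k) _         = refl
      row-lower (suc c) t (suc j) (suc k) (s≤s j<k) = row-lower c t j k j<k

      row-0 : ∀ c t t′ → row c t 0 ≗ row c t′ 0
      row-0 c       t t′ zero    = trans (β-zero (t + 2 * c + 1)) (sym (β-zero (t′ + 2 * c + 1)))
      row-0 zero    t t′ (suc k) = refl
      row-0 (suc c) t t′ (suc k) = refl

      module _ (pascal : ∀ L j → β (suc L) (suc j) ≡ β L j ℚ.+ β L (suc j)) where

        row-pascal : ∀ c t j → row c (suc t) (suc j) ≗ row c t j ⊕ row c t (suc j)
        row-pascal c       t j       zero    = pascal (t + 2 * c + 1) j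
        row-pascal zero    t j       (suc k) = refl
        row-pascal (suc c) t zero    (suc k) = trans (row-0 c (suc t) t k) (sym (ℚₚ.+-identityˡ _))
        row-pascal (suc c) t (suc j) (suc k) = row-pascal c t j k

        module _ (θ : ℚ) (wall : ∀ j → β (2 * j + 1) (suc j) ≡ θ ℚ.* β (2 * j + 1) j) where

          -- At this height j is the last position in front of the wall and j + 1 its mirror image.
          -- Binomial coefficients are symmetric there, ballot numbers vanish behind the wall. Every
          -- column meets the wall in the same way, since L - 2k and j - k keep the distance L - 2j.
          row-wall : ∀ c t j → 2 * j ≡ t + 2 * c → row c t (suc j) ≗ θ ⊙ row c t j
          row-wall c       t j       eq zero    = subst (λ L → β L (suc j) ≡ θ ℚ.* β L j) (cong (ℕ._+ 1) eq) (wall j)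
          row-wall zero    t j       eq (suc k) = sym (ℚₚ.*-zeroʳ θ)
          row-wall (suc c) t zero    eq (suc k) with trans eq (e t c)
            where
            e : ∀ t c → t + 2 * suc c ≡ suc (suc (t + 2 * c))
            e = ℕ-Ring.solve-∀
          ... | ()
          row-wall (suc c) t (suc j) eq (suc k) = row-wall c t j
            (ℕₚ.+-cancelˡ-≡ 2 _ _ (trans (sym (e₁ j)) (trans eq (e₂ t c)))) k
            where
            e₁ : ∀ j → 2 * suc j ≡ 2 + 2 * j
            e₁ = ℕ-Ring.solve-∀
            e₂ : ∀ t c → t + 2 * suc c ≡ 2 + (t + 2 * c)
            e₂ = ℕ-Ring.solve-∀

  atWall : ℕ → ℕ → ℕ → Bool
  atWall c t j = 2 * j ≡ᵇ t + 2 * c + 1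

  -- By Pascal's rule the row at a wall position is 1 + θ times the only row from which the wall can
  -- be reached; η, the weight of a vertical lozenge there, undoes this factor.
  module Count (β : ℕ → ℕ → ℚ) (θ η : ℚ) (η-inv : η ℚ.* (1ℚ ℚ.+ θ) ≡ 1ℚ)
    (β-zero : ∀ L → β L 0 ≡ 1ℚ)
    (pascal : ∀ L j → β (suc L) (suc j) ≡ β L j ℚ.+ β L (suc j))
    (wall : ∀ j → β (2 * j + 1) (suc j) ≡ θ ℚ.* β (2 * j + 1) j) where

    open Rows β public

    s : ℕ → ℕ → ℕ → ℚ
    s c t j = if atWall c t j then η else 1ℚ

    module Count′ (a b c : ℕ) (wt : Lozenge → ℚ)
      (wt-left  : ∀ i k → wt (loz leftL i k) ≡ 1ℚ)
      (wt-right : ∀ i k → wt (loz rightL i k) ≡ 1ℚ)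
      (wt-vert  : ∀ j t → Geometry.onLine a b c (suc t) j ≡ true →
                  wt (loz vert (Geometry.column a b c j) (+ suc t)) ≡ s c (suc t) j) where

      open Geometry a b c
      open Paths onLine (row c)

      χ-true : ∀ t j → onLine t j ≡ true → χ t j ≡ 1ℚ
      χ-true t j on = if-cong on

      lower-right : ∀ t j → onLine (suc t) (suc j) ≡ true → onLine t j ≡ true
      lower-right t j on = let (p , q , r) = onLine-sound {suc t} {suc j} on in
        onLine-complete t j (linear 0 p (e₁ t b j)) (ℕₚ.<⇒≤ q) (linear 1 r (e₂ t c j))
        where
        e₁ : ∀ t b j → b + j + suc t ≡ t + (b + suc j) + 0
        e₁ = ℕ-Ring.solve-∀
        e₂ : ∀ t c j → t + 2 * c + 1 + 2 * suc j ≡ 2 * j + (suc t + 2 * c + 1) + 1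
        e₂ = ℕ-Ring.solve-∀

      row-step : ∀ t j → onLine (suc t) j ≡ true → step t j ≗ s c (suc t) j ⊙ row c (suc t) j
      row-step t zero on k = begin
        0ℚ ℚ.* row c t 0 k ℚ.+ χ t 0 ℚ.* row c t 0 k
          ≡⟨ cong (λ z → 0ℚ ℚ.* row c t 0 k ℚ.+ z ℚ.* row c t 0 k) (χ-true t 0
               (onLine-complete t 0 (ℕₚ.<⇒≤ (proj₁ (onLine-sound {suc t} {0} on))) z≤n z≤n)) ⟩
        0ℚ ℚ.* row c t 0 k ℚ.+ 1ℚ ℚ.* row c t 0 k
          ≡⟨ solve 1 (λ x → con 0ℚ :* x :+ con 1ℚ :* x := con 1ℚ :* x) refl (row c t 0 k) ⟩
        1ℚ ℚ.* row c t 0 k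
          ≡⟨ cong₂ ℚ._*_ (sym (if-cong {x = η} {y = 1ℚ} no-wall)) (row-0 β-zero c t (suc t) k) ⟩
        s c (suc t) 0 ℚ.* row c (suc t) 0 k ∎
        where
        open ≡-Reasoning
        no-wall : atWall c (suc t) 0 ≡ false
        no-wall = refl
      row-step t (suc j) on k with atWall c (suc t) (suc j) in w
      ... | true = begin
        χ t j ℚ.* row c t j k ℚ.+ χ t (suc j) ℚ.* row c t (suc j) k
          ≡⟨ cong₂ (λ x y → x ℚ.* row c t j k ℚ.+ y ℚ.* row c t (suc j) k) (χ-true t j (lower-right t j on)) (if-cong beyond) ⟩
        1ℚ ℚ.* row c t j k ℚ.+ 0ℚ ℚ.* row c t (suc j) k
          ≡⟨ solve 2 (λ x y → con 1ℚ :* x :+ con 0ℚ :* y := con 1ℚ :* x) refl (row c t j k) (row c t (suc j) k) ⟩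
        1ℚ ℚ.* row c t j k
          -- The position behind the wall contributes no path. Its formal row, θ times the row in
          -- front, is put in so that Pascal's rule applies.
          ≡⟨ cong (ℚ._* row c t j k) (sym η-inv) ⟩
        η ℚ.* (1ℚ ℚ.+ θ) ℚ.* row c t j k
          ≡⟨ solve 3 (λ e θ x → e :* (con 1ℚ :+ θ) :* x := e :* (x :+ θ :* x)) refl η θ (row c t j k) ⟩
        η ℚ.* (row c t j k ℚ.+ θ ℚ.* row c t j k)
          ≡⟨ cong (λ z → η ℚ.* (row c t j k ℚ.+ z)) (sym (row-wall β-zero pascal θ wall c t j eq k)) ⟩
        η ℚ.* (row c t j k ℚ.+ row c t (suc j) k)
          ≡⟨ cong (η ℚ.*_) (sym (row-pascal β-zero pascal c t j k)) ⟩
        η ℚ.* row c (suc t) (suc j) k ∎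
        where
        open ≡-Reasoning
        full : 2 * suc j ≡ suc t + 2 * c + 1
        full = ≡ᵇ-sound w
        eq : 2 * j ≡ t + 2 * c
        eq = ℕₚ.+-cancelˡ-≡ 2 _ _ (trans (sym (e₁ j)) (trans full (e₂ t c)))
          where
          e₁ : ∀ j → 2 * suc j ≡ 2 + 2 * j
          e₁ = ℕ-Ring.solve-∀
          e₂ : ∀ t c → suc t + 2 * c + 1 ≡ 2 + (t + 2 * c)
          e₂ = ℕ-Ring.solve-∀
        beyond : onLine t (suc j) ≡ false
        beyond with onLine t (suc j) in on′
        ... | false = refl
        ... | true  = ⊥-elim (ℕₚ.<-irrefl refl (ℕₚ.≤-trans (ℕₚ.≤-reflexive (sym full))
                        (proj₂ (proj₂ (onLine-sound {t} {suc j} on′)))))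
      ... | false = begin
        χ t j ℚ.* row c t j k ℚ.+ χ t (suc j) ℚ.* row c t (suc j) k
          ≡⟨ cong₂ (λ x y → x ℚ.* row c t j k ℚ.+ y ℚ.* row c t (suc j) k) (χ-true t j (lower-right t j on)) (χ-true t (suc j) stays) ⟩
        1ℚ ℚ.* row c t j k ℚ.+ 1ℚ ℚ.* row c t (suc j) k
          ≡⟨ solve 2 (λ x y → con 1ℚ :* x :+ con 1ℚ :* y := con 1ℚ :* (x :+ y)) refl (row c t j k) (row c t (suc j) k) ⟩
        1ℚ ℚ.* (row c t j k ℚ.+ row c t (suc j) k)
          ≡⟨ cong (1ℚ ℚ.*_) (sym (row-pascal β-zero pascal c t j k)) ⟩
        1ℚ ℚ.* row c (suc t) (suc j) k ∎
        where
        open ≡-Reasoning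
        stays : onLine t (suc j) ≡ true
        stays = let (p , q , r) = onLine-sound {suc t} {suc j} on in
          onLine-complete t (suc j) (ℕₚ.<⇒≤ p) q (ℕₚ.≤-pred (ℕₚ.≤∧≢⇒< r λ eq → absurd (trans (sym w) (trans (cong (_≡ᵇ suc t + 2 * c + 1) eq) (≡ᵇ-refl (suc t + 2 * c + 1))))))
          where
          absurd : ¬ false ≡ true
          absurd ()

      open Bands a b c wt (s c) (row c)
      open Sweep wt-left wt-right wt-vert (row-diag β-zero c) (row-lower β-zero c 0) row-step public
        using (lineWeight; totalWeight; top; top-row; M≡det; onLine-<; cols)

      even-line : ∀ m → lineWeight (2 * m) ≡ 1ℚ
      even-line m = prodTo-one (a + c + 2) (λ j _ → factor j)
        where
        parity : ∀ m n → ¬ 2 * m ≡ 2 * n + 1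
        parity m n eq = ℕₚ.<-irrefl refl (ℕₚ.≤-trans (ℕₚ.≤-reflexive (trans (ℕₚ.+-comm 1 (2 * n)) (sym eq)))
          (ℕₚ.*-monoʳ-≤ 2 (double-cancel-≤ {m} {n} (ℕₚ.≤-reflexive eq))))
        factor : ∀ j → weigh (s c (2 * m)) (onLine (2 * m)) j ≡ 1ℚ
        factor j rewrite ≡ᵇ-≢ (λ eq → parity j (m + c) (trans eq (cong (ℕ._+ 1) (sym (ℕₚ.*-distribˡ-+ 2 m c)))))
          with onLine (2 * m) j
        ... | true  = refl
        ... | false = refl

      wall-at : ∀ m j → atWall c (2 * m + 1) j ≡ true → j ≡ m + c + 1
      wall-at m j eq = ℕₚ.*-cancelˡ-≡ j (m + c + 1) 2 (trans (≡ᵇ-sound {2 * j} eq) (e m c))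
        where
        e : ∀ m c → 2 * m + 1 + 2 * c + 1 ≡ 2 * (m + c + 1)
        e = ℕ-Ring.solve-∀

      -- The equation 2j = t + 2c + 1 has a solution only for odd t, namely j = m + c + 1; m ≤ a
      -- keeps it within FA, and m ≤ b is enough for DE.
      odd-line : ∀ m → m ≤ a → m ≤ b → lineWeight (2 * m + 1) ≡ η
      odd-line m m≤a m≤b = trans (prodTo-single (a + c + 2) w (onLine-< t on) others) here′
        where
        t w : ℕ
        t = 2 * m + 1
        w = m + c + 1
        on : onLine t w ≡ true
        on = onLine-complete t w (linear c m≤b (e₁ m b c)) (linear 0 m≤a (e₂ m a c)) (ℕₚ.≤-reflexive (e₃ m c))
          where
          e₁ : ∀ m b c → b + (m + c + 1) + m ≡ 2 * m + 1 + b + c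
          e₁ = ℕ-Ring.solve-∀
          e₂ : ∀ m a c → a + c + 1 + m ≡ m + c + 1 + a + 0
          e₂ = ℕ-Ring.solve-∀
          e₃ : ∀ m c → 2 * (m + c + 1) ≡ 2 * m + 1 + 2 * c + 1
          e₃ = ℕ-Ring.solve-∀
        here′ : weigh (s c t) (onLine t) w ≡ η
        here′ = trans (if-cong on) (if-cong (trans (cong (_≡ᵇ t + 2 * c + 1) (e₃ m c)) (≡ᵇ-refl (t + 2 * c + 1))))
          where
          e₃ : ∀ m c → 2 * (m + c + 1) ≡ 2 * m + 1 + 2 * c + 1
          e₃ = ℕ-Ring.solve-∀
        others : ∀ j → j ≢ w → weigh (s c t) (onLine t) j ≡ 1ℚ
        others j j≢w with onLine t j | atWall c t j in eq
        ... | false | _     = refl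
        ... | true  | false = refl
        ... | true  | true  = ⊥-elim (j≢w (wall-at m j eq))

      high-line : ∀ t → 2 * a + 1 < t → lineWeight t ≡ 1ℚ
      high-line t a<t = prodTo-one (a + c + 2) (λ j _ → factor j)
        where
        factor : ∀ j → weigh (s c t) (onLine t) j ≡ 1ℚ
        factor j with onLine t j in on | atWall c t j in eq
        ... | false | _     = refl
        ... | true  | false = refl
        ... | true  | true  = ⊥-elim (ℕₚ.<-irrefl refl (ℕₚ.≤-trans (ℕₚ.≤-reflexive refl)
          (linear 0 {m = suc t} {n = t} (ℕₚ.+-mono-≤ (ℕₚ.*-monoʳ-≤ 2 (proj₁ (proj₂ (onLine-sound {t} {j} on)))) a<t)
            (trans (cong (λ z → t + (z + suc (2 * a + 1))) (≡ᵇ-sound {2 * j} eq)) (e a c t)))))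
          where
          e : ∀ a c t → t + (t + 2 * c + 1 + suc (2 * a + 1)) ≡ suc t + (2 * (a + c + 1) + t) + 0
          e = ℕ-Ring.solve-∀

      total-low : ∀ m → m ≤ a → m ≤ suc b → totalWeight (2 * m) ≡ η ^ℚ m
      total-low zero    _   _ = refl
      total-low (suc m) m<a m<b = begin
        totalWeight (2 * suc m)
          ≡⟨ cong totalWeight (ℕₚ.*-suc 2 m) ⟩
        lineWeight (suc (suc (2 * m))) ℚ.* (lineWeight (suc (2 * m)) ℚ.* totalWeight (2 * m))
          ≡⟨ cong₂ (λ x y → x ℚ.* (y ℚ.* totalWeight (2 * m)))
               (trans (cong lineWeight (sym (ℕₚ.*-suc 2 m))) (even-line (suc m)))
               (trans (cong lineWeight (ℕₚ.+-comm 1 (2 * m))) (odd-line m (ℕₚ.<⇒≤ m<a) (ℕₚ.≤-pred m<b))) ⟩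
        1ℚ ℚ.* (η ℚ.* totalWeight (2 * m))
          ≡⟨ trans (ℚₚ.*-identityˡ _) (ℚₚ.*-comm η _) ⟩
        totalWeight (2 * m) ℚ.* η
          ≡⟨ cong (ℚ._* η) (total-low m (ℕₚ.<⇒≤ m<a) (ℕₚ.<⇒≤ m<b)) ⟩
        η ^ℚ suc m ∎
        where open ≡-Reasoning

      -- Above height 2a + 1 the wall has left the region, so there are a + 1 factors, one for each
      -- of the lozenges on the west side.
      total-high : a ≤ b → ∀ d → totalWeight (d + suc (2 * a)) ≡ η ^ℚ suc a
      total-high a≤b zero    = trans
        (cong₂ ℚ._*_ (trans (cong lineWeight (ℕₚ.+-comm 1 (2 * a))) (odd-line a ℕₚ.≤-refl a≤b))
                     (total-low a ℕₚ.≤-refl (ℕₚ.m≤n⇒m≤1+n a≤b)))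
        (ℚₚ.*-comm η (η ^ℚ a))
      total-high a≤b (suc d) = trans
        (cong₂ ℚ._*_ (high-line (suc (d + suc (2 * a))) (s≤s (linear d ℕₚ.≤-refl (e d a)))) (total-high a≤b d))
        (ℚₚ.*-identityˡ _)
        where
        e : ∀ d a → d + suc (2 * a) + 0 ≡ 2 * a + 1 + 0 + d
        e = ℕ-Ring.solve-∀

      -- For a ≤ b every edge of EF is strictly off the wall, so `step top` is the row at height
      -- `suc top` without a factor.
      M-generic : a ≤ b → M (S a b c) wt ≡
        (η ^ℚ suc a) ℚ.* det (row c (suc b) 1 ∷ map (row c (suc top)) (range (a + 2) c)) (range 0 (suc c))
      M-generic a≤b = begin
        M (S a b c) wt
          ≡⟨ M≡det (ℕₚ.m≤n⇒m≤1+n a≤b) ⟩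
        totalWeight top ℚ.* det (row c (suc b) 1 ∷ map (step top) E) (range 0 (suc c))
          ≡⟨ cong₂ ℚ._*_ weight (trans (det-scale (s c (suc top)) (row c (suc top)) (step top) (row c (suc b) 1 ∷ []) E
               (All.tabulate (λ {j} j∈ → row-step top j (trans (top-row (ℕₚ.m≤n⇒m≤1+n a≤b) j) (∈ᵇ-complete j∈)))) (range 0 (suc c)))
               (trans (cong (ℚ._* d) (prod-one (All.map off-wall (range-upper (a + 2) c)))) (ℚₚ.*-identityˡ d))) ⟩
        (η ^ℚ suc a) ℚ.* d ∎
        where
        open ≡-Reasoning
        E : List ℕ
        E = range (a + 2) c
        d : ℚ
        d = det (row c (suc b) 1 ∷ map (row c (suc top)) E) (range 0 (suc c))
        weight : totalWeight top ≡ η ^ℚ suc a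
        weight with ℕₚ.m≤n⇒∃[o]m+o≡n a≤b
        ... | d , refl = trans (cong totalWeight (e a d)) (total-high a≤b d)
          where
          e : ∀ a d → suc (a + d) + a ≡ d + suc (2 * a)
          e = ℕ-Ring.solve-∀
        off-wall : ∀ {j} → j < a + 2 + c → s c (suc top) j ≡ 1ℚ
        off-wall {j} j< = if-cong (≡ᵇ-≢ {2 * j} {suc top + 2 * c + 1} λ eq → ℕₚ.<-irrefl eq
          (linear 0 (ℕₚ.+-mono-≤ (ℕₚ.*-monoʳ-≤ 2 j<) a≤b) (e a b c j)))
          where
          e : ∀ a b c j → suc (suc b + a) + 2 * c + 1 + (2 * suc j + a) ≡
              suc (2 * j) + (2 * (a + 2 + c) + b) + 0
          e = ℕ-Ring.solve-∀

      -- Now the last edge of EF touches the wall and its path arrives by a forced step; `det-slide`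
      -- passes this on to the other paths, so all of them end one row lower. The topmost of the
      -- west lozenges has its upper half outside the region, whence the exponent a.
      M-edge : a ≡ suc b → M (S a b c) wt ≡
        (η ^ℚ a) ℚ.* det (row c (suc b) 1 ∷ map (row c top) (range (suc a) c)) (range 0 (suc c))
      M-edge a≡ = begin
        M (S a b c) wt
          ≡⟨ M≡det (ℕₚ.≤-reflexive a≡) ⟩
        totalWeight top ℚ.* det (row c (suc b) 1 ∷ map (step top) (range (a + 2) c)) (range 0 (suc c))
          ≡⟨ cong₂ (λ w lo → w ℚ.* det (row c (suc b) 1 ∷ map (step top) (range lo c)) (range 0 (suc c)))
               (trans (cong totalWeight top≡) (total-low a ℕₚ.≤-refl (ℕₚ.≤-reflexive a≡))) (ℕₚ.+-comm a 2) ⟩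
        (η ^ℚ a) ℚ.* det (row c (suc b) 1 ∷ map (step top) (range (suc (suc a)) c)) (range 0 (suc c))
          ≡⟨ cong ((η ^ℚ a) ℚ.*_) (det-slide (step top) (row c top) (λ j → χ top (suc j)) (row c (suc b) 1 ∷ []) (suc a) c
               (λ j lo≤ j< k → cong (ℚ._+ χ top (suc j) ℚ.* row c top (suc j) k)
                 (trans (cong (ℚ._* row c top j k) (χ-true top j (on j lo≤ j<))) (ℚₚ.*-identityˡ (row c top j k))))
               (λ j eq → if-cong (off j eq)) (range 0 (suc c))) ⟩
        (η ^ℚ a) ℚ.* det (row c (suc b) 1 ∷ map (row c top) (range (suc a) c)) (range 0 (suc c)) ∎
        where
        open ≡-Reasoning
        top≡ : top ≡ 2 * a
        top≡ = trans (cong (ℕ._+ a) (sym a≡)) (cong (a ℕ.+_) (sym (ℕₚ.+-identityʳ a)))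
        on : ∀ j → suc a ≤ j → j < suc a + c → onLine top j ≡ true
        on j lo≤ j< = onLine-complete top j (linear 0 lo≤ (e₁ a b j)) (linear 1 j< (e₂ a c j))
          (subst (λ z → 2 * j ≤ z + 2 * c + 1) (sym top≡) (linear 1 (ℕₚ.*-monoʳ-≤ 2 j<) (e₃ a c j)))
          where
          e₁ : ∀ a b j → b + j + suc a ≡ suc b + a + j + 0
          e₁ = ℕ-Ring.solve-∀
          e₂ : ∀ a c j → a + c + 1 + suc j ≡ j + (suc a + c) + 1
          e₂ = ℕ-Ring.solve-∀
          e₃ : ∀ a c j → 2 * a + 2 * c + 1 + 2 * suc j ≡ 2 * j + 2 * (suc a + c) + 1
          e₃ = ℕ-Ring.solve-∀
        off : ∀ j → suc j ≡ suc a + c → onLine top (suc j) ≡ false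
        off j refl with onLine top (suc (a + c)) in on′
        ... | false = refl
        ... | true  = ⊥-elim (ℕₚ.<-irrefl refl (ℕₚ.≤-trans (ℕₚ.≤-reflexive (e a c))
          (subst (λ z → 2 * suc (a + c) ≤ z + 2 * c + 1) top≡
            (proj₂ (proj₂ (onLine-sound {top} {suc (a + c)} on′))))))
          where
          e : ∀ a c → suc (2 * a + 2 * c + 1) ≡ 2 * suc (a + c)
          e = ℕ-Ring.solve-∀

  any?-sound : ∀ {A : Set} (p : A → Bool) xs → any? p xs ≡ true → ∃[ x ] x ∈ xs × p x ≡ true
  any?-sound p (x ∷ xs) eq with p x in px
  ... | true  = x , here refl , px
  ... | false = let (y , y∈ , py) = any?-sound p xs eq in y , there y∈ , py

  any?-complete : ∀ {A : Set} (p : A → Bool) xs {x} → x ∈ xs → p x ≡ true → any? p xs ≡ true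
  any?-complete p (x ∷ xs) (here refl) px rewrite px = refl
  any?-complete p (y ∷ xs) (there x∈)  px rewrite any?-complete p xs x∈ px = ∨-trueʳ (p y)

  module West (a b c : ℕ) where
    open Geometry a b c

    -- The lozenge with index m + 1 has j = c + m + 1 and height 2m + 1, which is the wall position
    -- at that odd height.
    west-wall : ∀ j t → onLine (suc t) j ≡ true →
      isWestVertical a (loz vert (column j) (+ suc t)) ≡ atWall c (suc t) j
    west-wall j t on = true⇔true to from
      where
      is : ℕ → Bool
      is k = (column j ≡ᵇℤ ℤ.- (+ k)) ∧ (+ suc t ≡ᵇℤ + (2 * k ∸ 1))

      to : any? is (map suc (upTo (suc a))) ≡ true → atWall c (suc t) j ≡ true
      to eq with any?-sound is (map suc (upTo (suc a))) eq
      ... | k , k∈ , isk with ∈-map⁻ suc k∈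
      ...   | m , _ , refl with ∧-true {column j ≡ᵇℤ ℤ.- (+ suc m)} isk
      ...     | p , q = subst (λ z → (2 * j ≡ᵇ z) ≡ true) (trans (cong (2 ℕ.*_) j≡) (trans (e c m) (cong (λ z → z + 2 * c + 1) (sym t≡))))
                          (≡ᵇ-refl (2 * j))
        where
        j≡ : j ≡ c + suc m
        j≡ = ℤₚ.+-injective (trans (sym (column-involutive j)) (trans (cong (λ z → + c ℤ.- z) (≡ᵇℤ-sound (column j) _ p))
               (cong (λ z → + c ℤ.+ z) (ℤₚ.neg-involutive (+ suc m)))))
        t≡ : suc t ≡ 2 * m + 1
        t≡ = trans (ℤₚ.+-injective (≡ᵇℤ-sound (+ suc t) (+ (2 * suc m ∸ 1)) q)) (e′ m)
          where
          e′ : ∀ m → m + suc (m + 0) ≡ 2 * m + 1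
          e′ = ℕ-Ring.solve-∀
        e : ∀ c m → 2 * (c + suc m) ≡ 2 * m + 1 + 2 * c + 1
        e = ℕ-Ring.solve-∀

      from : atWall c (suc t) j ≡ true → any? is (map suc (upTo (suc a))) ≡ true
      from w with ℕₚ.m≤n⇒∃[o]m+o≡n {suc c} {j} (ℕₚ.*-cancelˡ-≤ 2 (linear t (ℕₚ.≤-reflexive (sym wall)) (e t c j)))
        where
        wall : 2 * j ≡ suc t + 2 * c + 1
        wall = ≡ᵇ-sound w
        e : ∀ t c j → 2 * j + (suc t + 2 * c + 1) ≡ 2 * suc c + 2 * j + t
        e = ℕ-Ring.solve-∀
      ... | m , refl = any?-complete is (map suc (upTo (suc a))) (∈-map⁺ suc (∈-upTo⁺ m<))
        (cong₂ _∧_ (subst (λ z → (z ≡ᵇℤ ℤ.- (+ suc m)) ≡ true) (col≡ (+ c) (+ m)) (≡ᵇℤ-refl (ℤ.- (+ suc m))))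
                   (subst (λ z → (+ z ≡ᵇℤ + (2 * suc m ∸ 1)) ≡ true) t≡ (≡ᵇℤ-refl (+ (2 * suc m ∸ 1)))))
        where
        m< : m < suc a
        m< = linear 0 (proj₁ (proj₂ (onLine-sound {suc t} {suc c + m} on))) (e a c m)
          where
          e : ∀ a c m → suc a + (suc c + m) ≡ suc m + (a + c + 1) + 0
          e = ℕ-Ring.solve-∀
        col≡ : ∀ c m → ℤ.- (+ 1 ℤ.+ m) ≡ c ℤ.- (+ 1 ℤ.+ c ℤ.+ m)
        col≡ = ℤ-Ring.solve-∀
        t≡ : 2 * suc m ∸ 1 ≡ suc t
        t≡ = ℕₚ.+-cancelˡ-≡ (2 * c + 1) _ _ (trans (e₁ c m) (trans (≡ᵇ-sound {2 * (suc c + m)} w) (e₂ c t)))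
          where
          e₁ : ∀ c m → 2 * c + 1 + (m + suc (m + 0)) ≡ 2 * (suc c + m)
          e₁ = ℕ-Ring.solve-∀
          e₂ : ∀ c t → suc t + 2 * c + 1 ≡ 2 * c + 1 + suc t
          e₂ = ℕ-Ring.solve-∀

-- Binomial identities and the factorisation of the minors.

module Evaluation where

  open import Data.Rational using (-_; _+_; _*_; _-_)
  open import Data.Rational.Properties
  open All using (All; []; _∷_)
  open import Data.List.Relation.Unary.AllPairs using (AllPairs; []; _∷_)
  open Determinants
  open Polynomials
  open Sweeping using (range; length-range; range-upper; range-sorted)
  open PathCounts using (module Rows)

  -- Defined by repeated addition of 1, so that successors unfold to terms the ring solver can
  -- treat.
  ⟦_⟧ : ℕ → ℚ
  ⟦ zero ⟧  = 0ℚ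
  ⟦ suc n ⟧ = 1ℚ + ⟦ n ⟧

  ⟦+⟧ : ∀ m n → ⟦ m ℕ.+ n ⟧ ≡ ⟦ m ⟧ + ⟦ n ⟧
  ⟦+⟧ zero    n = sym (+-identityˡ ⟦ n ⟧)
  ⟦+⟧ (suc m) n = trans (cong (1ℚ +_) (⟦+⟧ m n)) (sym (+-assoc 1ℚ ⟦ m ⟧ ⟦ n ⟧))

  ⟦⟧≥0 : ∀ n → 0ℚ ℚ.≤ ⟦ n ⟧
  ⟦⟧≥0 zero    = ≤-refl
  ⟦⟧≥0 (suc n) = +-mono-≤ {0ℚ} {1ℚ} {0ℚ} {⟦ n ⟧} (ℚ.*≤* (ℤ.+≤+ z≤n)) (⟦⟧≥0 n)

  ⟦suc⟧≢0 : ∀ n → ⟦ suc n ⟧ ≢ 0ℚ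
  ⟦suc⟧≢0 n eq = <⇒≢ (+-mono-<-≤ {0ℚ} {1ℚ} (ℚ.*<* (ℤ.+<+ (s≤s z≤n))) (⟦⟧≥0 n)) (sym eq)

  recip : ℕ → ℚ
  recip n = (1/ ⟦ suc n ⟧) {{≢-nonZero (⟦suc⟧≢0 n)}}

  recip-inverse : ∀ n → recip n * ⟦ suc n ⟧ ≡ 1ℚ
  recip-inverse n = *-inverseˡ ⟦ suc n ⟧ {{≢-nonZero (⟦suc⟧≢0 n)}}

  bin : ℕ → ℕ → ℚ
  bin n       zero    = 1ℚ
  bin zero    (suc k) = 0ℚ
  bin (suc n) (suc k) = bin n k + bin n (suc k)

  bin-absorb : ∀ n k → ⟦ suc k ⟧ * bin (suc n) (suc k) ≡ ⟦ suc n ⟧ * bin n k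
  bin-absorb zero    zero    = refl
  bin-absorb zero    (suc k) = *-zeroʳ ⟦ suc (suc k) ⟧
  bin-absorb (suc n) zero    = trans
    (solve 2 (λ x b → con 1ℚ :* (con 1ℚ :+ b) := con 1ℚ :+ con 1ℚ :* b) refl 0ℚ (bin (suc n) 1))
    (trans (cong (1ℚ +_) (bin-absorb n zero))
    (solve 1 (λ n → con 1ℚ :+ n :* con 1ℚ := (con 1ℚ :+ n) :* con 1ℚ) refl ⟦ suc n ⟧))
  bin-absorb (suc n) (suc k) = begin
    (1ℚ + ⟦ suc k ⟧) * (X + Y)
      ≡⟨ solve 3 (λ k x y → (con 1ℚ :+ k) :* (x :+ y) := k :* x :+ x :+ (con 1ℚ :+ k) :* y) refl ⟦ suc k ⟧ X Y ⟩
    ⟦ suc k ⟧ * X + X + ⟦ suc (suc k) ⟧ * Y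
      ≡⟨ cong₂ (λ u v → u + X + v) (bin-absorb n k) (bin-absorb n (suc k)) ⟩
    ⟦ suc n ⟧ * bin n k + X + ⟦ suc n ⟧ * bin n (suc k)
      ≡⟨ solve 3 (λ n p q → n :* p :+ (p :+ q) :+ n :* q := (con 1ℚ :+ n) :* (p :+ q)) refl
           ⟦ suc n ⟧ (bin n k) (bin n (suc k)) ⟩
    (1ℚ + ⟦ suc n ⟧) * X ∎
    where
    open ≡-Reasoning
    X Y : ℚ
    X = bin (suc n) (suc k)
    Y = bin (suc n) (suc (suc k))

  bin-absorb′ : ∀ n k → (⟦ suc n ⟧ - ⟦ k ⟧) * bin (suc n) k ≡ ⟦ suc n ⟧ * bin n k
  bin-absorb′ n zero    = solve 1 (λ n → (n :- con 0ℚ) :* con 1ℚ := n :* con 1ℚ) refl ⟦ suc n ⟧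
  bin-absorb′ n (suc k) = begin
    (⟦ suc n ⟧ - ⟦ suc k ⟧) * X
      ≡⟨ solve 3 (λ n k x → (n :- k) :* x := n :* x :- k :* x) refl ⟦ suc n ⟧ ⟦ suc k ⟧ X ⟩
    ⟦ suc n ⟧ * X - ⟦ suc k ⟧ * X
      ≡⟨ cong (λ z → ⟦ suc n ⟧ * X - z) (bin-absorb n k) ⟩
    ⟦ suc n ⟧ * (bin n k + bin n (suc k)) - ⟦ suc n ⟧ * bin n k
      ≡⟨ solve 3 (λ n p q → n :* (p :+ q) :- n :* p := n :* q) refl ⟦ suc n ⟧ (bin n k) (bin n (suc k)) ⟩
    ⟦ suc n ⟧ * bin n (suc k) ∎
    where
    open ≡-Reasoning
    X : ℚ
    X = bin (suc n) (suc k)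

  bin-≢0 : ∀ n k → k ≤ n → bin n k ≢ 0ℚ
  bin-≢0 n       zero    _         = λ ()
  bin-≢0 (suc n) (suc k) (s≤s k≤n) eq = *-≢0 (⟦suc⟧≢0 n) (bin-≢0 n k k≤n)
    (trans (sym (bin-absorb n k)) (trans (cong (⟦ suc k ⟧ *_) eq) (*-zeroʳ ⟦ suc k ⟧)))

  bin-middle : ∀ j → bin (2 ℕ.* j ℕ.+ 1) (suc j) ≡ bin (2 ℕ.* j ℕ.+ 1) j
  bin-middle j = subst (λ n → bin n (suc j) ≡ bin n j) (ℕₚ.+-comm 1 (2 ℕ.* j))
    (*-cancelˡ-≢0 (⟦suc⟧≢0 j) (trans (bin-absorb (2 ℕ.* j) j) (trans (sym (bin-absorb′ (2 ℕ.* j) j))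
      (cong (_* bin (suc (2 ℕ.* j)) j) (trans (cong (λ z → 1ℚ + z - ⟦ j ⟧) (trans (⟦+⟧ j (j ℕ.+ 0)) (cong (⟦ j ⟧ +_) (cong ⟦_⟧ (ℕₚ.+-identityʳ j)))))
        (solve 1 (λ j → con 1ℚ :+ (j :+ j) :- j := con 1ℚ :+ j) refl ⟦ j ⟧))))))

  -- Compares neighbouring columns of a row. The factor on the right is j (m - j) taken at m = n + 2
  -- and j + 1, which is why this expression is the variable of the polynomials below.
  bin-shift : ∀ n j → ⟦ suc (suc n) ⟧ * ⟦ suc n ⟧ * bin n j ≡
    ⟦ suc j ⟧ * (⟦ suc (suc n) ⟧ - ⟦ suc j ⟧) * bin (suc (suc n)) (suc j)
  bin-shift n j = begin
    N₂ * ⟦ suc n ⟧ * bin n j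
      ≡⟨ *-assoc N₂ ⟦ suc n ⟧ (bin n j) ⟩
    N₂ * (⟦ suc n ⟧ * bin n j)
      ≡⟨ cong (N₂ *_) (sym (bin-absorb′ n j)) ⟩
    N₂ * ((⟦ suc n ⟧ - ⟦ j ⟧) * bin (suc n) j)
      ≡⟨ solve 4 (λ m n j b → m :* ((n :- j) :* b) := (n :- j) :* (m :* b)) refl N₂ ⟦ suc n ⟧ ⟦ j ⟧ (bin (suc n) j) ⟩
    (⟦ suc n ⟧ - ⟦ j ⟧) * (N₂ * bin (suc n) j)
      ≡⟨ cong ((⟦ suc n ⟧ - ⟦ j ⟧) *_) (sym (bin-absorb (suc n) j)) ⟩
    (⟦ suc n ⟧ - ⟦ j ⟧) * ((1ℚ + ⟦ j ⟧) * bin (suc (suc n)) (suc j))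
      ≡⟨ solve 3 (λ n j b → (n :- j) :* ((con 1ℚ :+ j) :* b) := (con 1ℚ :+ j) :* ((con 1ℚ :+ n) :- (con 1ℚ :+ j)) :* b)
           refl ⟦ suc n ⟧ ⟦ j ⟧ (bin (suc (suc n)) (suc j)) ⟩
    ⟦ suc j ⟧ * (N₂ - ⟦ suc j ⟧) * bin (suc (suc n)) (suc j) ∎
    where
    open ≡-Reasoning
    N₂ : ℚ
    N₂ = ⟦ suc (suc n) ⟧

  ballot : ℕ → ℕ → ℚ
  ballot L zero    = 1ℚ
  ballot L (suc j) = bin L (suc j) - bin L j

  ballot-pascal : ∀ L j → ballot (suc L) (suc j) ≡ ballot L j + ballot L (suc j)
  ballot-pascal L zero    = solve 1 (λ b → con 1ℚ :+ b :- con 1ℚ := con 1ℚ :+ (b :- con 1ℚ)) refl (bin L 1)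
  ballot-pascal L (suc j) = solve 3 (λ p q r → (q :+ r) :- (p :+ q) := (q :- p) :+ (r :- q)) refl
    (bin L j) (bin L (suc j)) (bin L (suc (suc j)))

  -- The numerator in the ballot formula (L+1-2j)/(L+1) times the binomial coefficient of L + 1 and
  -- j. The factor m - 2j does not change when m grows by 2 and j by 1, so `tilt` inherits the shift
  -- identity of `bin`.
  tilt : ℕ → ℕ → ℚ
  tilt m j = (⟦ m ⟧ - (⟦ j ⟧ + ⟦ j ⟧)) * bin m j

  ballot-tilt : ∀ L j → ⟦ suc L ⟧ * ballot L j ≡ tilt (suc L) j
  ballot-tilt L zero    = solve 1 (λ m → m :* con 1ℚ := (m :- (con 0ℚ :+ con 0ℚ)) :* con 1ℚ) refl ⟦ suc L ⟧
  ballot-tilt L (suc j) = begin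
    ⟦ suc L ⟧ * (bin L (suc j) - bin L j)
      ≡⟨ solve 3 (λ m p q → m :* (p :- q) := m :* p :- m :* q) refl ⟦ suc L ⟧ (bin L (suc j)) (bin L j) ⟩
    ⟦ suc L ⟧ * bin L (suc j) - ⟦ suc L ⟧ * bin L j
      ≡⟨ cong₂ _-_ (sym (bin-absorb′ L (suc j))) (sym (bin-absorb L j)) ⟩
    (⟦ suc L ⟧ - ⟦ suc j ⟧) * X - ⟦ suc j ⟧ * X
      ≡⟨ solve 3 (λ m j x → (m :- j) :* x :- j :* x := (m :- (j :+ j)) :* x) refl ⟦ suc L ⟧ ⟦ suc j ⟧ X ⟩
    (⟦ suc L ⟧ - (⟦ suc j ⟧ + ⟦ suc j ⟧)) * X ∎
    where
    open ≡-Reasoning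
    X : ℚ
    X = bin (suc L) (suc j)

  tilt-shift : ∀ n j → ⟦ suc (suc n) ⟧ * ⟦ suc n ⟧ * tilt n j ≡
    ⟦ suc j ⟧ * (⟦ suc (suc n) ⟧ - ⟦ suc j ⟧) * tilt (suc (suc n)) (suc j)
  tilt-shift n j = begin
    p * (s * bin n j)
      ≡⟨ solve 3 (λ p s b → p :* (s :* b) := s :* (p :* b)) refl p s (bin n j) ⟩
    s * (p * bin n j)
      ≡⟨ cong (s *_) (bin-shift n j) ⟩
    s * (q * X)
      ≡⟨ solve 4 (λ n j q x → (n :- (j :+ j)) :* (q :* x) :=
           q :* (((con 1ℚ :+ (con 1ℚ :+ n)) :- ((con 1ℚ :+ j) :+ (con 1ℚ :+ j))) :* x)) refl ⟦ n ⟧ ⟦ j ⟧ q X ⟩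
    q * tilt (suc (suc n)) (suc j) ∎
    where
    open ≡-Reasoning
    p q s X : ℚ
    p = ⟦ suc (suc n) ⟧ * ⟦ suc n ⟧
    q = ⟦ suc j ⟧ * (⟦ suc (suc n) ⟧ - ⟦ suc j ⟧)
    s = ⟦ n ⟧ - (⟦ j ⟧ + ⟦ j ⟧)
    X = bin (suc (suc n)) (suc j)

  poly-translate : ∀ d α {p} → Poly d p → Poly d (λ y → p (y - α))
  poly-translate zero    α (c , eq)          = c , λ y → eq (y - α)
  poly-translate (suc d) α (c , q , pq , eq) = poly-cong (suc d) (λ y → sym (eq (y - α)))
    (poly-⊕ (suc d) (poly-const (suc d) c) (poly-linear d α (poly-translate d α pq)))

  -- The factors run over consecutive integers, so moving the argument by one changes only the two
  -- end factors. All quotients of minors come from this.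
  prod-telescope : ∀ lo n x →
    prod (λ e → 1ℚ + x - ⟦ e ⟧) (range lo n) * (1ℚ + x - ⟦ lo ℕ.+ n ⟧) ≡
    (1ℚ + x - ⟦ lo ⟧) * prod (λ e → x - ⟦ e ⟧) (range lo n)
  prod-telescope lo zero    x = trans (cong (λ m → 1ℚ * (1ℚ + x - ⟦ m ⟧)) (ℕₚ.+-identityʳ lo))
    (*-comm 1ℚ (1ℚ + x - ⟦ lo ⟧))
  prod-telescope lo (suc n) x = begin
    (1ℚ + x - ⟦ lo ⟧) * F * (1ℚ + x - ⟦ lo ℕ.+ suc n ⟧)
      ≡⟨ cong (λ m → (1ℚ + x - ⟦ lo ⟧) * F * (1ℚ + x - ⟦ m ⟧)) (ℕₚ.+-suc lo n) ⟩
    (1ℚ + x - ⟦ lo ⟧) * F * (1ℚ + x - ⟦ suc lo ℕ.+ n ⟧)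
      ≡⟨ *-assoc (1ℚ + x - ⟦ lo ⟧) F (1ℚ + x - ⟦ suc lo ℕ.+ n ⟧) ⟩
    (1ℚ + x - ⟦ lo ⟧) * (F * (1ℚ + x - ⟦ suc lo ℕ.+ n ⟧))
      ≡⟨ cong ((1ℚ + x - ⟦ lo ⟧) *_) (prod-telescope (suc lo) n x) ⟩
    (1ℚ + x - ⟦ lo ⟧) * ((1ℚ + x - (1ℚ + ⟦ lo ⟧)) * G)
      ≡⟨ cong (λ z → (1ℚ + x - ⟦ lo ⟧) * (z * G))
           (solve 2 (λ x l → con 1ℚ :+ x :- (con 1ℚ :+ l) := x :- l) refl x ⟦ lo ⟧) ⟩
    (1ℚ + x - ⟦ lo ⟧) * ((x - ⟦ lo ⟧) * G) ∎
    where
    open ≡-Reasoning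
    F G : ℚ
    F = prod (λ e → 1ℚ + x - ⟦ e ⟧) (range (suc lo) n)
    G = prod (λ e → x - ⟦ e ⟧) (range (suc lo) n)

  -- The entries of the row at j are w m j times polynomials in j (m ∸ j), where m = L + o.
  module Evaluate (β w : ℕ → ℕ → ℚ) (o : ℕ) (κ : ℕ → ℚ)
    (base  : ∀ L j → β L j ≡ w (o ℕ.+ L) j * κ L)
    (shift : ∀ n j → ⟦ suc (suc n) ⟧ * ⟦ suc n ⟧ * w n j ≡
             ⟦ suc j ⟧ * (⟦ suc (suc n) ⟧ - ⟦ suc j ⟧) * w (suc (suc n)) (suc j)) where

    open Rows β

    mass : ℕ → ℕ → ℕ
    mass c t = o ℕ.+ (t ℕ.+ 2 ℕ.* c ℕ.+ 1)

    mass-suc : ∀ c t → mass (suc c) t ≡ suc (suc (mass c t))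
    mass-suc c t = e o t c
      where
      e : ∀ o t c → o ℕ.+ (t ℕ.+ 2 ℕ.* suc c ℕ.+ 1) ≡ suc (suc (o ℕ.+ (t ℕ.+ 2 ℕ.* c ℕ.+ 1)))
      e = ℕ-Ring.solve-∀

    node : ℕ → ℕ → ℚ
    node m j = ⟦ j ⟧ * (⟦ m ⟧ - ⟦ j ⟧)

    -- One column further means one use of `shift`: the node for m + 2 and j + 1 exceeds that for m
    -- and j by m + 1, hence the translation. The factor y vanishes at j = 0, in accordance with the
    -- zero entries of that row.
    φ : ℕ → ℕ → ℕ → ℚ → ℚ
    φ c       t zero    y = κ (t ℕ.+ 2 ℕ.* c ℕ.+ 1)
    φ zero    t (suc k) y = 0ℚ
    φ (suc c) t (suc k) y =
      recip (suc (mass c t)) * recip (mass c t) * (0ℚ + y * φ c t k (y - ⟦ suc (mass c t) ⟧))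

    φ-poly : ∀ c t k → Poly c (φ c t k)
    φ-poly c       t zero    = poly-const c (κ (t ℕ.+ 2 ℕ.* c ℕ.+ 1))
    φ-poly zero    t (suc k) = 0ℚ , λ _ → refl
    φ-poly (suc c) t (suc k) = poly-⊙ (suc c) (recip (suc (mass c t)) * recip (mass c t))
      (0ℚ , (λ y → φ c t k (y - ⟦ suc (mass c t) ⟧)) , poly-translate c ⟦ suc (mass c t) ⟧ (φ-poly c t k) , λ _ → refl)

    row-φ : ∀ c t j k → row c t j k ≡ w (mass c t) j * φ c t k (node (mass c t) j)
    row-φ c       t j       zero    = base (t ℕ.+ 2 ℕ.* c ℕ.+ 1) j
    row-φ zero    t j       (suc k) = sym (*-zeroʳ (w (mass 0 t) j))
    row-φ (suc c) t zero    (suc k) = sym (trans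
      (cong (λ z → w m 0 * (ρ * (0ℚ + z * φ c t k (z - ⟦ suc n ⟧)))) (*-zeroˡ (⟦ m ⟧ - 0ℚ)))
      (solve 3 (λ w r f → w :* (r :* (con 0ℚ :+ con 0ℚ :* f)) := con 0ℚ) refl (w m 0) ρ (φ c t k (0ℚ - ⟦ suc n ⟧))))
      where
      n m : ℕ
      n = mass c t
      m = mass (suc c) t
      ρ : ℚ
      ρ = recip (suc n) * recip n
    row-φ (suc c) t (suc j) (suc k) = begin
      row c t j k
        ≡⟨ row-φ c t j k ⟩
      w n j * f
        ≡⟨ solve 2 (λ x y → x :* y := con 1ℚ :* con 1ℚ :* x :* y) refl (w n j) f ⟩
      1ℚ * 1ℚ * w n j * f
        ≡⟨ cong₂ (λ x y → x * y * w n j * f) (sym (recip-inverse (suc n))) (sym (recip-inverse n)) ⟩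
      (r₂ * ⟦ suc (suc n) ⟧) * (r₁ * ⟦ suc n ⟧) * w n j * f
        ≡⟨ solve 6 (λ r₂ n₂ r₁ n₁ w f → (r₂ :* n₂) :* (r₁ :* n₁) :* w :* f := r₂ :* r₁ :* (n₂ :* n₁ :* w) :* f) refl
             r₂ ⟦ suc (suc n) ⟧ r₁ ⟦ suc n ⟧ (w n j) f ⟩
      r₂ * r₁ * (⟦ suc (suc n) ⟧ * ⟦ suc n ⟧ * w n j) * f
        ≡⟨ cong (λ z → r₂ * r₁ * z * f) (shift n j) ⟩
      r₂ * r₁ * (Y * w (suc (suc n)) (suc j)) * f
        ≡⟨ solve 5 (λ r₂ r₁ y w f → r₂ :* r₁ :* (y :* w) :* f := w :* (r₂ :* r₁ :* (con 0ℚ :+ y :* f))) refl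
             r₂ r₁ Y (w (suc (suc n)) (suc j)) f ⟩
      w (suc (suc n)) (suc j) * (r₂ * r₁ * (0ℚ + Y * f))
        ≡⟨ cong (λ y → w (suc (suc n)) (suc j) * (r₂ * r₁ * (0ℚ + Y * φ c t k y))) (sym recentre) ⟩
      w (suc (suc n)) (suc j) * (r₂ * r₁ * (0ℚ + Y * φ c t k (Y - ⟦ suc n ⟧)))
        ≡⟨ cong (λ m → w m (suc j) * φ (suc c) t (suc k) (node m (suc j))) (sym (mass-suc c t)) ⟩
      w (mass (suc c) t) (suc j) * φ (suc c) t (suc k) (node (mass (suc c) t) (suc j)) ∎
      where
      open ≡-Reasoning
      n : ℕ
      n = mass c t
      r₂ r₁ f Y : ℚ
      r₂ = recip (suc n)
      r₁ = recip n
      f  = φ c t k (node n j)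
      Y  = node (suc (suc n)) (suc j)
      recentre : Y - ⟦ suc n ⟧ ≡ node n j
      recentre = solve 2 (λ n j → (con 1ℚ :+ j) :* ((con 1ℚ :+ (con 1ℚ :+ n)) :- (con 1ℚ :+ j)) :- (con 1ℚ :+ n)
        := j :* (n :- j)) refl ⟦ n ⟧ ⟦ j ⟧

    -- This is p(j): the row of the removed triangle is put at the common height t, where it can be
    -- compared with the other rows.
    minor : ℕ → ℕ → ℕ → ℕ → ℚ
    minor lo c t j = det (row c t j ∷ map (row c t) (range lo c)) (range 0 (suc c))

    gaps : ℕ → ℕ → ℚ → ℚ
    gaps lo c x = prod (λ e → x - ⟦ e ⟧) (range lo c)

    private
      nodes-split : ∀ m j X → prod (λ r → node m j - r) (map (node m) X) ≡
        prod (λ e → ⟦ j ⟧ - ⟦ e ⟧) X * prod (λ e → ⟦ m ⟧ - ⟦ j ⟧ - ⟦ e ⟧) X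
      nodes-split m j []      = refl
      nodes-split m j (e ∷ X) = trans (cong ((node m j - node m e) *_) (nodes-split m j X))
        (solve 5 (λ m j e p q → (j :* (m :- j) :- e :* (m :- e)) :* (p :* q) := ((j :- e) :* p) :* ((m :- j :- e) :* q))
          refl ⟦ m ⟧ ⟦ j ⟧ ⟦ e ⟧ (prod (λ e → ⟦ j ⟧ - ⟦ e ⟧) X) (prod (λ e → ⟦ m ⟧ - ⟦ j ⟧ - ⟦ e ⟧) X))

      -- The difference of the two nodes is (e′ - e)(m - e - e′).
      node-≢ : ∀ m {e e′} → e < e′ → e ℕ.+ e′ < m → node m e ≢ node m e′
      node-≢ m {e} {e′} e<e′ e+e′<m eq
        with ℕₚ.m≤n⇒∃[o]m+o≡n e<e′ | ℕₚ.m≤n⇒∃[o]m+o≡n e+e′<m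
      ... | u , refl | v , refl = *-≢0 (⟦suc⟧≢0 u) (⟦suc⟧≢0 v) (begin
        ⟦ suc u ⟧ * ⟦ suc v ⟧
          ≡⟨ solve 3 (λ e u v → (con 1ℚ :+ u) :* (con 1ℚ :+ v) :=
               (con 1ℚ :+ (e :+ u)) :* ((con 1ℚ :+ (e :+ (con 1ℚ :+ (e :+ u)) :+ v)) :- (con 1ℚ :+ (e :+ u)))
               :- e :* ((con 1ℚ :+ (e :+ (con 1ℚ :+ (e :+ u)) :+ v)) :- e)) refl ⟦ e ⟧ ⟦ u ⟧ ⟦ v ⟧ ⟩
        E′ * (Mm - E′) - ⟦ e ⟧ * (Mm - ⟦ e ⟧)
          ≡⟨ cong₂ (λ x y → x * (y - x) - ⟦ e ⟧ * (y - ⟦ e ⟧)) (sym e′≡) (sym m≡) ⟩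
        node m e′ - node m e
          ≡⟨ cong (λ z → node m e′ - z) eq ⟩
        node m e′ - node m e′
          ≡⟨ +-inverseʳ (node m e′) ⟩
        0ℚ ∎)
        where
        open ≡-Reasoning
        E′ Mm : ℚ
        E′ = 1ℚ + (⟦ e ⟧ + ⟦ u ⟧)
        Mm = 1ℚ + (⟦ e ⟧ + E′ + ⟦ v ⟧)
        e′≡ : ⟦ suc e ℕ.+ u ⟧ ≡ E′
        e′≡ = cong (1ℚ +_) (⟦+⟧ e u)
        m≡ : ⟦ suc (e ℕ.+ (suc e ℕ.+ u)) ℕ.+ v ⟧ ≡ Mm
        m≡ = cong (1ℚ +_) (trans (⟦+⟧ (e ℕ.+ (suc e ℕ.+ u)) v) (cong (_+ ⟦ v ⟧) (trans (⟦+⟧ e (suc e ℕ.+ u)) (cong (⟦ e ⟧ +_) e′≡))))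

    -- Placing j on one of the other end points repeats a row, which gives c roots for a polynomial
    -- of degree c. The bound makes their nodes distinct, and non-vanishing w lets the roots pass
    -- from the minor to the polynomial. `K` depends on the other rows but not on j.
    minor-product : ∀ lo c t → All (λ e → w (mass c t) e ≢ 0ℚ) (range lo c) →
      lo ℕ.+ lo ℕ.+ 2 ℕ.* c ≤ suc (mass c t) →
      ∃[ K ] (∀ j → minor lo c t j ≡
        w (mass c t) j * (K * (gaps lo c ⟦ j ⟧ * gaps lo c (⟦ mass c t ⟧ - ⟦ j ⟧))))
    minor-product lo c t w≢0 bound = K , λ j → trans (minor-P j)
      (cong (w m j *_) (trans (eq (node m j)) (cong (K *_) (nodes-split m j E))))
      where
      m : ℕ
      m = mass c t
      E : List ℕ
      E = range lo c
      P : ℚ → ℚ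
      P y = ι (λ k → φ c t k y) (det (map (row c t) E)) (range 0 (suc c))
      minor-P : ∀ j → minor lo c t j ≡ w m j * P (node m j)
      minor-P j = trans (ι-cong {g = det (map (row c t) E)} (row-φ c t j) (λ _ → refl) (range 0 (suc c)))
        (ι-⊙ˡ (w m j) (λ k → φ c t k (node m j)) (det (map (row c t) E)) (range 0 (suc c)))
      P-poly : Poly (length (map (node m) E)) P
      P-poly = subst (λ d → Poly d P) (sym (trans (length-map (node m) E) (length-range lo c)))
        (poly-ι c (φ c t) (det (map (row c t) E)) (range 0 (suc c)) (All.universal (φ-poly c t) (range 0 (suc c))))
      root : ∀ {e} → e ∈ E → w m e ≢ 0ℚ → P (node m e) ≡ 0ℚ
      root {e} e∈ we≢0 = *-cancelˡ-≢0 we≢0 (trans (sym (minor-P e)) (trans repeated (sym (*-zeroʳ (w m e)))))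
        where
        repeated : minor lo c t e ≡ 0ℚ
        repeated with ∈-∃++ e∈
        ... | as , bs , E≡ = trans
          (cong (λ X → det (row c t e ∷ X) (range 0 (suc c))) (trans (cong (map (row c t)) E≡) (map-++ (row c t) as (e ∷ bs))))
          (det-repeat (row c t e) (map (row c t) as) (map (row c t) bs) (range 0 (suc c)))
      roots : All (λ r → P r ≡ 0ℚ) (map (node m) E)
      roots = Allₚ.map⁺ (All.tabulate (λ e∈ → root e∈ (All.lookup w≢0 e∈)))
      small : ∀ e e′ → e < e′ → e′ < lo ℕ.+ c → e ℕ.+ e′ < m
      small e e′ e<e′ e′< = ℕₚ.≤-pred (ℕₚ.≤-trans (ℕₚ.≤-trans (ℕₚ.≤-reflexive (e₁ e e′))
        (ℕₚ.≤-trans (ℕₚ.+-mono-≤ (ℕₚ.<-trans e<e′ e′<) e′<) (ℕₚ.≤-reflexive (e₂ lo c)))) bound)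
        where
        e₁ : ∀ e e′ → suc (suc (e ℕ.+ e′)) ≡ suc e ℕ.+ suc e′
        e₁ = ℕ-Ring.solve-∀
        e₂ : ∀ lo c → lo ℕ.+ c ℕ.+ (lo ℕ.+ c) ≡ lo ℕ.+ lo ℕ.+ 2 ℕ.* c
        e₂ = ℕ-Ring.solve-∀
      distinct : ∀ X → AllPairs _<_ X → All (_< lo ℕ.+ c) X → AllPairs (λ e e′ → node m e ≢ node m e′) X
      distinct []      []        []         = []
      distinct (x ∷ X) (x< ∷ sX) (_ ∷ X<hi) =
        All.zipWith (λ {e′} (x<e′ , e′<) → node-≢ m x<e′ (small x e′ x<e′ e′<)) (x< , X<hi) ∷ distinct X sX X<hi
      factored : ∃[ K ] (∀ y → P y ≡ K * prod (λ r → y - r) (map (node m) E))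
      factored = poly-roots (map (node m) E) P-poly roots
        (AllPairsₚ.map⁺ (distinct E (range-sorted lo c) (range-upper lo c)))
      K : ℚ
      K = proj₁ factored
      eq : ∀ y → P y ≡ K * prod (λ r → y - r) (map (node m) E)
      eq = proj₂ factored

-- Quotients of minors.

module Comparison where

  open import Data.Rational using (-_; _+_; _*_; _-_)
  open import Data.Rational.Properties
  open import Data.Integer using (+_)
  open All using (All; []; _∷_)
  open Determinants
  open Polynomials
  open ExactCovers using (if-cong)
  open Coordinates using (linear)
  open Sweeping using (range; range-lower; range-upper)
  open PathCounts
  open Evaluation

  toℚᵘ-⟦⟧ : ∀ n → toℚᵘ ⟦ n ⟧ ℚᵘ.≃ ℚᵘ.mkℚᵘ (+ n) 0
  toℚᵘ-⟦⟧ zero    = ℚᵘ.*≡* refl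
  toℚᵘ-⟦⟧ (suc n) = ℚᵘₚ.≃-trans (toℚᵘ-homo-+ 1ℚ ⟦ n ⟧)
    (ℚᵘₚ.≃-trans (ℚᵘₚ.+-congʳ (toℚᵘ 1ℚ) (toℚᵘ-⟦⟧ n)) (ℚᵘ.*≡* (e (+ n))))
    where
    e : ∀ n → (+ 1 ℤ.* + 1 ℤ.+ n ℤ.* + 1) ℤ.* + 1 ≡ (+ 1 ℤ.+ n) ℤ.* + 1
    e = ℤ-Ring.solve-∀

  /-cancel : ∀ n m → (+ n / suc m) ℚ.* ⟦ suc m ⟧ ≡ ⟦ n ⟧
  /-cancel n m = toℚᵘ-injective (ℚᵘₚ.≃-trans (toℚᵘ-homo-* (+ n / suc m) ⟦ suc m ⟧)
    (ℚᵘₚ.≃-trans (ℚᵘₚ.*-cong (toℚᵘ-fromℚᵘ (ℚᵘ.mkℚᵘ (+ n) m)) (toℚᵘ-⟦⟧ (suc m)))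
    (ℚᵘₚ.≃-trans (ℚᵘ.*≡* e) (ℚᵘₚ.≃-sym (toℚᵘ-⟦⟧ n)))))
    where
    e : + n ℤ.* + suc m ℤ.* + 1 ≡ + n ℤ.* + (suc m ℕ.* 1)
    e = trans (ℤₚ.*-identityʳ _) (cong (λ k → + n ℤ.* + k) (sym (ℕₚ.*-identityʳ (suc m))))

  ⟦∸⟧ : ∀ {m n} → n ≤ m → ⟦ m ∸ n ⟧ ≡ ⟦ m ⟧ - ⟦ n ⟧
  ⟦∸⟧ {m} {n} n≤m = begin
    ⟦ m ∸ n ⟧                      ≡⟨ solve 2 (λ x y → x := (x :+ y) :- y) refl ⟦ m ∸ n ⟧ ⟦ n ⟧ ⟩
    (⟦ m ∸ n ⟧ + ⟦ n ⟧) - ⟦ n ⟧    ≡⟨ cong (λ z → z - ⟦ n ⟧) (sym (⟦+⟧ (m ∸ n) n)) ⟩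
    ⟦ m ∸ n ℕ.+ n ⟧ - ⟦ n ⟧        ≡⟨ cong (λ k → ⟦ k ⟧ - ⟦ n ⟧) (ℕₚ.m∸n+n≡m n≤m) ⟩
    ⟦ m ⟧ - ⟦ n ⟧                  ∎
    where open ≡-Reasoning

  fall : ℚ → ℕ → ℚ
  fall x n = prodℚ n (λ i → x - ⟦ i ⟧)

  fall-telescope : ∀ x n → fall (1ℚ + x) n * (x - ⟦ n ⟧) ≡ x * fall x n
  fall-telescope x zero    = solve 1 (λ x → con 1ℚ :* (x :- con 0ℚ) := x :* con 1ℚ) refl x
  fall-telescope x (suc n) = begin
    fall (1ℚ + x) n * (1ℚ + x - (1ℚ + ⟦ n ⟧)) * (x - ⟦ suc n ⟧)
      ≡⟨ cong (λ z → fall (1ℚ + x) n * z * (x - ⟦ suc n ⟧))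
           (solve 2 (λ x n → con 1ℚ :+ x :- (con 1ℚ :+ n) := x :- n) refl x ⟦ n ⟧) ⟩
    fall (1ℚ + x) n * (x - ⟦ n ⟧) * (x - ⟦ suc n ⟧)
      ≡⟨ cong (_* (x - ⟦ suc n ⟧)) (fall-telescope x n) ⟩
    x * fall x n * (x - ⟦ suc n ⟧)
      ≡⟨ *-assoc x (fall x n) (x - ⟦ suc n ⟧) ⟩
    x * (fall x n * (x - ⟦ suc n ⟧)) ∎
    where open ≡-Reasoning

  module Minors (β w : ℕ → ℕ → ℚ) (o : ℕ) (κ : ℕ → ℚ)
    (β-zero : ∀ L → β L 0 ≡ 1ℚ)
    (pascal : ∀ L j → β (suc L) (suc j) ≡ β L j + β L (suc j))
    (base  : ∀ L j → β L j ≡ w (o ℕ.+ L) j * κ L)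
    (shift : ∀ n j → ⟦ suc (suc n) ⟧ * ⟦ suc n ⟧ * w n j ≡
             ⟦ suc j ⟧ * (⟦ suc (suc n) ⟧ - ⟦ suc j ⟧) * w (suc (suc n)) (suc j)) where

    open Rows β public
    open Evaluate β w o κ base shift public

    -- The row at position 0 is the same at all heights, so each application of Pascal's rule adds
    -- one more copy of it. With t = b + 1 and m = a + 1 this lifts the removed triangle to the top
    -- line.
    row-1 : ∀ c t m → row c (m ℕ.+ t) 1 ≗ row c t 1 ⊕ (⟦ m ⟧ ⊙ row c t 0)
    row-1 c t zero    k = solve 2 (λ x y → x := x :+ con 0ℚ :* y) refl (row c t 1 k) (row c t 0 k)
    row-1 c t (suc m) k = begin
      row c (suc (m ℕ.+ t)) 1 k
        ≡⟨ row-pascal β-zero pascal c (m ℕ.+ t) 0 k ⟩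
      row c (m ℕ.+ t) 0 k + row c (m ℕ.+ t) 1 k
        ≡⟨ cong₂ _+_ (row-0 β-zero c (m ℕ.+ t) t k) (row-1 c t m k) ⟩
      row c t 0 k + (row c t 1 k + ⟦ m ⟧ * row c t 0 k)
        ≡⟨ solve 3 (λ x y m → y :+ (x :+ m :* y) := x :+ (con 1ℚ :+ m) :* y) refl (row c t 1 k) (row c t 0 k) ⟦ m ⟧ ⟩
      row c t 1 k + ⟦ suc m ⟧ * row c t 0 k ∎
      where open ≡-Reasoning

    minor-dent : ∀ lo c t m →
      minor lo c (m ℕ.+ t) 1 ≡ det (row c t 1 ∷ map (row c (m ℕ.+ t)) (range lo c)) (range 0 (suc c))
                               + ⟦ m ⟧ * minor lo c (m ℕ.+ t) 0
    minor-dent lo c t m = begin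
      ι (row c (m ℕ.+ t) 1) G cs
        ≡⟨ ι-cong {g = G} (row-1 c t m) (λ _ → refl) cs ⟩
      ι (row c t 1 ⊕ (⟦ m ⟧ ⊙ row c t 0)) G cs
        ≡⟨ ι-⊕ˡ (row c t 1) (⟦ m ⟧ ⊙ row c t 0) G cs ⟩
      ι (row c t 1) G cs + ι (⟦ m ⟧ ⊙ row c t 0) G cs
        ≡⟨ cong (λ z → ι (row c t 1) G cs + z) (trans (ι-⊙ˡ ⟦ m ⟧ (row c t 0) G cs)
             (cong (⟦ m ⟧ *_) (ι-cong {g = G} (row-0 β-zero c t (m ℕ.+ t)) (λ _ → refl) cs))) ⟩
      ι (row c t 1) G cs + ⟦ m ⟧ * ι (row c (m ℕ.+ t) 0) G cs ∎
      where
      open ≡-Reasoning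
      G : Form
      G = det (map (row c (m ℕ.+ t)) (range lo c))
      cs : List ℕ
      cs = range 0 (suc c)

    -- The row at position 0 is (1, 0, ..., 0). Without it and column 0 all positions and c drop by
    -- one; the positions left are a + 1, ..., a + c + 1, the first of which is read as the new j.
    minor-suc : ∀ a c t → minor (2 ℕ.+ a) (suc c) t 0 ≡ minor (2 ℕ.+ a) c t (suc a)
    minor-suc a c t = begin
      row (suc c) t 0 0 * G (range 1 (suc c)) - ι (row (suc c) t 0) (G ∘ (0 ∷_)) (range 1 (suc c))
        ≡⟨ cong₂ _-_ (trans (cong (_* G (range 1 (suc c))) (β-zero _)) (*-identityˡ (G (range 1 (suc c)))))
             (ι-zero (G ∘ (0 ∷_)) (range 1 (suc c)) (All.map (row-lower β-zero (suc c) t 0 _) (range-lower 1 (suc c)))) ⟩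
      G (range 1 (suc c)) - 0ℚ
        ≡⟨ solve 1 (λ x → x :- con 0ℚ := x) refl (G (range 1 (suc c))) ⟩
      G (range 1 (suc c))
        ≡⟨ cong G (range-suc 0 (suc c)) ⟩
      G (map suc (range 0 (suc c)))
        ≡⟨ det-map-suc (map (row (suc c) t) (range (2 ℕ.+ a) (suc c))) (range 0 (suc c)) ⟩
      det (map (_∘ suc) (map (row (suc c) t) (range (2 ℕ.+ a) (suc c)))) (range 0 (suc c))
        ≡⟨ cong (λ rs → det rs (range 0 (suc c))) (trans (cong (map (_∘ suc) ∘ map (row (suc c) t)) (range-suc (suc a) (suc c)))
             (trans (sym (map-∘ (map suc (range (suc a) (suc c))))) (sym (map-∘ (range (suc a) (suc c)))))) ⟩
      det (map (row c t) (range (suc a) (suc c))) (range 0 (suc c)) ∎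
      where
      open ≡-Reasoning
      G : Form
      G = det (map (row (suc c) t) (range (2 ℕ.+ a) (suc c)))
      range-suc : ∀ lo n → range (suc lo) n ≡ map suc (range lo n)
      range-suc lo zero    = refl
      range-suc lo (suc n) = cong (suc lo ∷_) (range-suc (suc lo) n)

    gaps-0 : ∀ a c → gaps (2 ℕ.+ a) c ⟦ 1 ⟧ * (1ℚ + (⟦ a ⟧ + ⟦ c ⟧)) ≡ (1ℚ + ⟦ a ⟧) * gaps (2 ℕ.+ a) c ⟦ 0 ⟧
    gaps-0 a c = begin
      g₁ * (1ℚ + (⟦ a ⟧ + ⟦ c ⟧))
        ≡⟨ solve 3 (λ g a c → g :* (con 1ℚ :+ (a :+ c)) :=
             con (- 1ℚ) :* (g :* (con 1ℚ :+ con 0ℚ :- (con 1ℚ :+ (con 1ℚ :+ (a :+ c)))))) refl g₁ ⟦ a ⟧ ⟦ c ⟧ ⟩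
      - 1ℚ * (g₁ * (1ℚ + 0ℚ - (1ℚ + (1ℚ + (⟦ a ⟧ + ⟦ c ⟧)))))
        ≡⟨ cong (λ z → - 1ℚ * (g₁ * (1ℚ + 0ℚ - (1ℚ + (1ℚ + z))))) (sym (⟦+⟧ a c)) ⟩
      - 1ℚ * (g₁ * (1ℚ + 0ℚ - ⟦ 2 ℕ.+ a ℕ.+ c ⟧))
        ≡⟨ cong (λ z → - 1ℚ * z) (prod-telescope (2 ℕ.+ a) c 0ℚ) ⟩
      - 1ℚ * ((1ℚ + 0ℚ - (1ℚ + (1ℚ + ⟦ a ⟧))) * g₀)
        ≡⟨ solve 2 (λ g a → con (- 1ℚ) :* ((con 1ℚ :+ con 0ℚ :- (con 1ℚ :+ (con 1ℚ :+ a))) :* g) :=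
             (con 1ℚ :+ a) :* g) refl g₀ ⟦ a ⟧ ⟩
      (1ℚ + ⟦ a ⟧) * g₀ ∎
      where
      open ≡-Reasoning
      g₀ g₁ : ℚ
      g₀ = gaps (2 ℕ.+ a) c 0ℚ
      g₁ = gaps (2 ℕ.+ a) c (1ℚ + 0ℚ)

    gaps-shift : ∀ a c x x′ → x′ ≡ 1ℚ + x →
      gaps (2 ℕ.+ a) c x′ * (x - (1ℚ + (⟦ a ⟧ + ⟦ c ⟧))) ≡ (x - (1ℚ + ⟦ a ⟧)) * gaps (2 ℕ.+ a) c x
    gaps-shift a c x x′ refl = begin
      G′ * (x - (1ℚ + (⟦ a ⟧ + ⟦ c ⟧)))
        ≡⟨ cong (G′ *_) (trans (solve 2 (λ x y → x :- (con 1ℚ :+ y) := con 1ℚ :+ x :- (con 1ℚ :+ (con 1ℚ :+ y))) refl x (⟦ a ⟧ + ⟦ c ⟧))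
             (cong (λ z → 1ℚ + x - (1ℚ + (1ℚ + z))) (sym (⟦+⟧ a c)))) ⟩
      G′ * (1ℚ + x - ⟦ 2 ℕ.+ a ℕ.+ c ⟧)
        ≡⟨ prod-telescope (2 ℕ.+ a) c x ⟩
      (1ℚ + x - (1ℚ + (1ℚ + ⟦ a ⟧))) * G
        ≡⟨ cong (_* G) (solve 2 (λ x a → con 1ℚ :+ x :- (con 1ℚ :+ (con 1ℚ :+ a)) := x :- (con 1ℚ :+ a)) refl x ⟦ a ⟧) ⟩
      (x - (1ℚ + ⟦ a ⟧)) * G ∎
      where
      open ≡-Reasoning
      G G′ : ℚ
      G  = gaps (2 ℕ.+ a) c x
      G′ = gaps (2 ℕ.+ a) c (1ℚ + x)

    Product : ℕ → ℕ → ℕ → Set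
    Product a c t = ∃[ K ] (∀ j → minor (2 ℕ.+ a) c t j ≡
      w (mass c t) j * (K * (gaps (2 ℕ.+ a) c ⟦ j ⟧ * gaps (2 ℕ.+ a) c (⟦ mass c t ⟧ - ⟦ j ⟧))))

    -- `K` is common to j = 0 and j = 1, and both products of gaps telescope, one upwards from 0 and
    -- one downwards from m. The result is cross-multiplied to avoid inverses.
    minor-ratio : ∀ a c t → Product a c t → let m = mass c t; A = ⟦ a ⟧; C = ⟦ c ⟧ in
      minor (2 ℕ.+ a) c t 1 * ((1ℚ + (A + C)) * (⟦ m ⟧ - 1ℚ - (1ℚ + A))) * w m 0 ≡
      minor (2 ℕ.+ a) c t 0 * ((1ℚ + A) * (⟦ m ⟧ - 1ℚ - (1ℚ + (A + C)))) * w m 1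
    minor-ratio a c t (K , eq) = begin
      minor (2 ℕ.+ a) c t 1 * ((1ℚ + (A + C)) * q) * w m 0
        ≡⟨ cong (λ z → z * ((1ℚ + (A + C)) * q) * w m 0) (eq 1) ⟩
      w m 1 * (K * (g₁ * h₁)) * ((1ℚ + (A + C)) * q) * w m 0
        ≡⟨ solve 7 (λ w₁ K g h s q w₀ → w₁ :* (K :* (g :* h)) :* (s :* q) :* w₀ :=
             w₁ :* w₀ :* K :* (g :* s) :* (q :* h)) refl (w m 1) K g₁ h₁ (1ℚ + (A + C)) q (w m 0) ⟩
      w m 1 * w m 0 * K * (g₁ * (1ℚ + (A + C))) * (q * h₁)
        ≡⟨ cong₂ (λ x y → w m 1 * w m 0 * K * x * y) (gaps-0 a c) (sym (trans
             (gaps-shift a c (⟦ m ⟧ - 1ℚ) (⟦ m ⟧ - 0ℚ) (solve 1 (λ m → m :- con 0ℚ := con 1ℚ :+ (m :- con 1ℚ)) refl ⟦ m ⟧)) refl)) ⟩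
      w m 1 * w m 0 * K * ((1ℚ + A) * g₀) * (h₀ * p)
        ≡⟨ solve 7 (λ w₁ K g h s p w₀ → w₁ :* w₀ :* K :* (s :* g) :* (h :* p) :=
             w₀ :* (K :* (g :* h)) :* (s :* p) :* w₁) refl (w m 1) K g₀ h₀ (1ℚ + A) p (w m 0) ⟩
      w m 0 * (K * (g₀ * h₀)) * ((1ℚ + A) * p) * w m 1
        ≡⟨ cong (λ z → z * ((1ℚ + A) * p) * w m 1) (sym (eq 0)) ⟩
      minor (2 ℕ.+ a) c t 0 * ((1ℚ + A) * p) * w m 1 ∎
      where
      open ≡-Reasoning
      m : ℕ
      m = mass c t
      A C p q g₀ g₁ h₀ h₁ : ℚ
      A = ⟦ a ⟧
      C = ⟦ c ⟧
      p = ⟦ m ⟧ - 1ℚ - (1ℚ + (A + C))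
      q = ⟦ m ⟧ - 1ℚ - (1ℚ + A)
      g₀ = gaps (2 ℕ.+ a) c ⟦ 0 ⟧
      g₁ = gaps (2 ℕ.+ a) c ⟦ 1 ⟧
      h₀ = gaps (2 ℕ.+ a) c (⟦ m ⟧ - ⟦ 0 ⟧)
      h₁ = gaps (2 ℕ.+ a) c (⟦ m ⟧ - ⟦ 1 ⟧)

  module Bin = Minors bin bin 0 (λ _ → 1ℚ) (λ _ → refl) (λ _ _ → refl)
    (λ L j → sym (*-identityʳ (bin L j))) bin-shift

  module Ballot = Minors ballot tilt 1 recip (λ _ → refl) ballot-pascal
    (λ L j → sym (trans (cong (_* recip L) (sym (ballot-tilt L j)))
      (trans (solve 3 (λ m b r → m :* b :* r := b :* (r :* m)) refl ⟦ suc L ⟧ (ballot L j) (recip L))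
      (trans (cong (ballot L j *_) (recip-inverse L)) (*-identityʳ (ballot L j)))))) tilt-shift

  sub-≢0 : ∀ {m n} → n < m → ⟦ m ⟧ - ⟦ n ⟧ ≢ 0ℚ
  sub-≢0 {m} {n} n<m eq = ⟦suc⟧≢0 (m ∸ suc n)
    (trans (cong ⟦_⟧ (sym (ℕₚ.+-∸-assoc 1 n<m))) (trans (⟦∸⟧ (ℕₚ.<⇒≤ n<m)) eq))

  prod-≢0 : ∀ {f : ℕ → ℚ} {X} → All (λ x → f x ≢ 0ℚ) X → prod f X ≢ 0ℚ
  prod-≢0 []         = λ ()
  prod-≢0 (nz ∷ nzs) = *-≢0 nz (prod-≢0 nzs)

  bin-1 : ∀ n → bin n 1 ≡ ⟦ n ⟧
  bin-1 zero    = refl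
  bin-1 (suc n) = cong (λ z → 1ℚ + z) (bin-1 n)

  ≢0-factorʳ : ∀ {x y} → x * y ≢ 0ℚ → y ≢ 0ℚ
  ≢0-factorʳ {x} xy≢0 refl = xy≢0 (*-zeroʳ x)

  ≢0-factorˡ : ∀ {x y} → x * y ≢ 0ℚ → x ≢ 0ℚ
  ≢0-factorˡ {y = y} xy≢0 refl = xy≢0 (*-zeroˡ y)

  -- Eliminates p₁ from p₁ = X + α p₀ by means of the known quotient of p₁ and p₀.
  excess : ∀ {X p₀ p₁} α s u v w → p₁ ≡ X + α * p₀ → p₁ * (s * u) ≡ p₀ * (α * v) * w →
    X * (s * u) ≡ p₀ * (α * (v * w - s * u))
  excess {X} {p₀} {p₁} α s u v w p₁≡ ratio = begin
    X * (s * u)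
      ≡⟨ solve 5 (λ X α p s u → X :* (s :* u) := (X :+ α :* p) :* (s :* u) :- α :* p :* (s :* u)) refl X α p₀ s u ⟩
    (X + α * p₀) * (s * u) - α * p₀ * (s * u)
      ≡⟨ cong (λ z → z * (s * u) - α * p₀ * (s * u)) (sym p₁≡) ⟩
    p₁ * (s * u) - α * p₀ * (s * u)
      ≡⟨ cong (λ z → z - α * p₀ * (s * u)) ratio ⟩
    p₀ * (α * v) * w - α * p₀ * (s * u)
      ≡⟨ solve 6 (λ α p s u v w → p :* (α :* v) :* w :- α :* p :* (s :* u) := p :* (α :* (v :* w :- s :* u))) refl α p₀ s u v w ⟩
    p₀ * (α * (v * w - s * u)) ∎
    where open ≡-Reasoning

  -- The value p(0) for c and for c + 1 involves the same unknown constant, `K` for ballot numbers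
  -- and `K′` for binomials. In the cross product of the four values all constants and the gaps at 0
  -- and a + 1 balance.
  cross-ratio : ∀ {K K′ g₀ gₐ gL gM gL′ gM′ BL BM μ u v z q₁ q₂} q₃ →
    gM * u ≡ v * gL → gM′ * q₁ ≡ q₂ * gL′ → z * BM ≡ μ * BL →
    (BL * (K′ * (gₐ * gL′))) * (μ * (K * (g₀ * gM))) * (q₃ * q₂ * u) ≡
    (q₃ * BM * (K * (gₐ * gM′))) * (1ℚ * (K′ * (g₀ * gL))) * (z * v * q₁)
  cross-ratio {K} {K′} {g₀} {gₐ} {gL} {gM} {gL′} {gM′} {BL} {BM} {μ} {u} {v} {z} {q₁} {q₂} q₃ h₁ h₂ h₃ = begin
    (BL * (K′ * (gₐ * gL′))) * (μ * (K * (g₀ * gM))) * (q₃ * q₂ * u)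
      ≡⟨ solve 11 (λ BL K′ gₐ gL′ μ K g₀ gM q₃ q₂ u →
           (BL :* (K′ :* (gₐ :* gL′))) :* (μ :* (K :* (g₀ :* gM))) :* (q₃ :* q₂ :* u) :=
           K′ :* K :* gₐ :* g₀ :* q₃ :* (μ :* BL) :* (q₂ :* gL′) :* (gM :* u)) refl
           BL K′ gₐ gL′ μ K g₀ gM q₃ q₂ u ⟩
    K′ * K * gₐ * g₀ * q₃ * (μ * BL) * (q₂ * gL′) * (gM * u)
      ≡⟨ cong (K′ * K * gₐ * g₀ * q₃ * (μ * BL) * (q₂ * gL′) *_) h₁ ⟩
    K′ * K * gₐ * g₀ * q₃ * (μ * BL) * (q₂ * gL′) * (v * gL)
      ≡⟨ cong₂ (λ x y → K′ * K * gₐ * g₀ * q₃ * x * y * (v * gL)) (sym h₃) (sym h₂) ⟩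
    K′ * K * gₐ * g₀ * q₃ * (z * BM) * (gM′ * q₁) * (v * gL)
      ≡⟨ solve 11 (λ BM K′ gₐ gM′ z K g₀ gL q₃ q₁ v →
           K′ :* K :* gₐ :* g₀ :* q₃ :* (z :* BM) :* (gM′ :* q₁) :* (v :* gL) :=
           (q₃ :* BM :* (K :* (gₐ :* gM′))) :* (con 1ℚ :* (K′ :* (g₀ :* gL))) :* (z :* v :* q₁)) refl
           BM K′ gₐ gM′ z K g₀ gL q₃ q₁ v ⟩
    (q₃ * BM * (K * (gₐ * gM′))) * (1ℚ * (K′ * (g₀ * gL))) * (z * v * q₁) ∎
    where open ≡-Reasoning

  ratio-step : ∀ {τ τ′ τ₁ τ₁′ D D₁ N N₁ u v z q₁ q₂ q₃} →
    τ ≢ 0ℚ → q₁ ≢ 0ℚ → q₂ ≢ 0ℚ → q₃ ≢ 0ℚ →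
    τ₁′ * τ * (q₃ * q₂ * u) ≡ τ₁ * τ′ * (z * v * q₁) →
    τ′ * D ≡ τ * N → D₁ * q₁ ≡ u * D → N₁ * (q₃ * q₂) ≡ z * v * N → τ₁′ * D₁ ≡ τ₁ * N₁
  ratio-step {τ} {τ′} {τ₁} {τ₁′} {D} {D₁} {N} {N₁} {u} {v} {z} {q₁} {q₂} {q₃} τ≢0 q₁≢0 q₂≢0 q₃≢0 cross ih den num =
    *-cancelˡ-≢0 {τ * (q₁ * (q₃ * q₂))} (*-≢0 τ≢0 (*-≢0 q₁≢0 (*-≢0 q₃≢0 q₂≢0))) (begin
    τ * (q₁ * (q₃ * q₂)) * (τ₁′ * D₁)
      ≡⟨ solve 6 (λ τ q₁ q₃ q₂ t D → τ :* (q₁ :* (q₃ :* q₂)) :* (t :* D) := t :* τ :* (q₃ :* q₂) :* (D :* q₁)) refl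
           τ q₁ q₃ q₂ τ₁′ D₁ ⟩
    τ₁′ * τ * (q₃ * q₂) * (D₁ * q₁)
      ≡⟨ cong (τ₁′ * τ * (q₃ * q₂) *_) den ⟩
    τ₁′ * τ * (q₃ * q₂) * (u * D)
      ≡⟨ solve 5 (λ t τ q u D → t :* τ :* q :* (u :* D) := t :* τ :* (q :* u) :* D) refl τ₁′ τ (q₃ * q₂) u D ⟩
    τ₁′ * τ * (q₃ * q₂ * u) * D
      ≡⟨ cong (_* D) cross ⟩
    τ₁ * τ′ * (z * v * q₁) * D
      ≡⟨ solve 5 (λ t s p q D → t :* s :* (p :* q) :* D := t :* (p :* q) :* (s :* D)) refl τ₁ τ′ (z * v) q₁ D ⟩
    τ₁ * (z * v * q₁) * (τ′ * D)
      ≡⟨ cong (τ₁ * (z * v * q₁) *_) ih ⟩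
    τ₁ * (z * v * q₁) * (τ * N)
      ≡⟨ solve 5 (λ t p q τ N → t :* (p :* q) :* (τ :* N) := t :* τ :* q :* (p :* N)) refl τ₁ (z * v) q₁ τ N ⟩
    τ₁ * τ * q₁ * (z * v * N)
      ≡⟨ cong (τ₁ * τ * q₁ *_) (sym num) ⟩
    τ₁ * τ * q₁ * (N₁ * (q₃ * q₂))
      ≡⟨ solve 6 (λ t τ q₁ N q₃ q₂ → t :* τ :* q₁ :* (N :* (q₃ :* q₂)) := τ :* (q₁ :* (q₃ :* q₂)) :* (t :* N)) refl
           τ₁ τ q₁ N₁ q₃ q₂ ⟩
    τ * (q₁ * (q₃ * q₂)) * (τ₁ * N₁) ∎)
    where open ≡-Reasoning

  -- The quotient of the two counts for a ≤ b.

  module Compare (a b : ℕ) (a≤b : a ≤ b) where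

    t : ℕ
    t = suc a ℕ.+ suc b

    A B : ℚ
    A = ⟦ a ⟧
    B = ⟦ b ⟧

    δ ν : ℕ → ℚ
    δ c = 1ℚ + (⟦ c ⟧ + B)
    ν c = 1ℚ + (⟦ c ⟧ + ⟦ c ⟧ + B)

    L : ℕ → ℕ
    L c = t ℕ.+ 2 ℕ.* c ℕ.+ 1

    ⟦L⟧ : ∀ c → ⟦ L c ⟧ ≡ 1ℚ + (1ℚ + (A + ν c))
    ⟦L⟧ c = begin
      ⟦ L c ⟧                                        ≡⟨ cong ⟦_⟧ (e a b c) ⟩
      1ℚ + (1ℚ + ⟦ a ℕ.+ suc (c ℕ.+ c ℕ.+ b) ⟧)       ≡⟨ cong (λ z → 1ℚ + (1ℚ + z)) (trans (⟦+⟧ a (suc (c ℕ.+ c ℕ.+ b)))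
                                                          (cong (λ z → A + (1ℚ + z)) (trans (⟦+⟧ (c ℕ.+ c) b) (cong (λ z → z + B) (⟦+⟧ c c))))) ⟩
      1ℚ + (1ℚ + (A + ν c))                          ∎
      where
      open ≡-Reasoning
      e : ∀ a b c → suc a ℕ.+ suc b ℕ.+ 2 ℕ.* c ℕ.+ 1 ≡ suc (suc (a ℕ.+ suc (c ℕ.+ c ℕ.+ b)))
      e = ℕ-Ring.solve-∀

    ⟦δ⟧ : ∀ c → ⟦ suc (c ℕ.+ b) ⟧ ≡ δ c
    ⟦δ⟧ c = cong (λ z → 1ℚ + z) (⟦+⟧ c b)

    ⟦ν⟧ : ∀ c → ⟦ suc (c ℕ.+ c ℕ.+ b) ⟧ ≡ ν c
    ⟦ν⟧ c = cong (λ z → 1ℚ + z) (trans (⟦+⟧ (c ℕ.+ c) b) (cong (λ z → z + B) (⟦+⟧ c c)))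

    private
      e<L : ∀ c {e} → e < 2 ℕ.+ a ℕ.+ c → e ≤ L c
      e<L c {e} e< = linear (b ℕ.+ c ℕ.+ 2) e< (q a b c e)
        where
        q : ∀ a b c e → suc a ℕ.+ suc b ℕ.+ 2 ℕ.* c ℕ.+ 1 ℕ.+ suc e ≡ e ℕ.+ (2 ℕ.+ a ℕ.+ c) ℕ.+ (b ℕ.+ c ℕ.+ 2)
        q = ℕ-Ring.solve-∀

      2e<M : ∀ c {e} → e < 2 ℕ.+ a ℕ.+ c → e ℕ.+ e < suc (L c)
      2e<M c {e} e< = linear 1 (ℕₚ.+-mono-≤ (ℕₚ.+-mono-≤ e< e<) a≤b) (q a b c e)
        where
        q : ∀ a b c e → suc (suc a ℕ.+ suc b ℕ.+ 2 ℕ.* c ℕ.+ 1) ℕ.+ (suc e ℕ.+ suc e ℕ.+ a) ≡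
            suc (e ℕ.+ e) ℕ.+ (2 ℕ.+ a ℕ.+ c ℕ.+ (2 ℕ.+ a ℕ.+ c) ℕ.+ b) ℕ.+ 1
        q = ℕ-Ring.solve-∀

      bound : ∀ c → 2 ℕ.+ a ℕ.+ (2 ℕ.+ a) ℕ.+ 2 ℕ.* c ≤ suc (L c)
      bound c = linear 0 a≤b (q a b c)
        where
        q : ∀ a b c → suc (suc a ℕ.+ suc b ℕ.+ 2 ℕ.* c ℕ.+ 1) ℕ.+ a ≡ 2 ℕ.+ a ℕ.+ (2 ℕ.+ a) ℕ.+ 2 ℕ.* c ℕ.+ b ℕ.+ 0
        q = ℕ-Ring.solve-∀

      tilt-≢0 : ∀ m j → j ℕ.+ j < m → tilt m j ≢ 0ℚ
      tilt-≢0 m j 2j<m = *-≢0 (subst (λ z → ⟦ m ⟧ - z ≢ 0ℚ) (⟦+⟧ j j) (sub-≢0 2j<m))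
        (bin-≢0 m j (ℕₚ.≤-trans (ℕₚ.m≤m+n j j) (ℕₚ.<⇒≤ 2j<m)))

    bin-product : ∀ c → Bin.Product a c t
    bin-product c = Bin.minor-product (2 ℕ.+ a) c t
      (All.map (λ {e} e< → bin-≢0 (L c) e (e<L c e<)) (range-upper (2 ℕ.+ a) c)) (bound c)

    ballot-product : ∀ c → Ballot.Product a c t
    ballot-product c = Ballot.minor-product (2 ℕ.+ a) c t
      (All.map (λ {e} e< → tilt-≢0 (suc (L c)) e (2e<M c e<)) (range-upper (2 ℕ.+ a) c)) (ℕₚ.m≤n⇒m≤1+n (bound c))

    τ τ′ : ℕ → ℚ
    τ  c = Ballot.minor (2 ℕ.+ a) c t 0
    τ′ c = Bin.minor (2 ℕ.+ a) c t 0

    private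
      module Step (c : ℕ) where
        ℓ C K K′ : ℚ
        ℓ = ⟦ L c ⟧
        C = ⟦ c ⟧
        K  = proj₁ (ballot-product c)
        K′ = proj₁ (bin-product c)

        g : ℚ → ℚ
        g = Bin.gaps (2 ℕ.+ a) c

        q₁ q₂ q₃ : ℚ
        q₁ = δ c - A
        q₂ = ν c - A
        q₃ = 1ℚ + ν c - A

        -- The mass is L c for binomials and L c + 1 for ballot numbers, so the mirrored gaps of the
        -- two counts differ by a unit translation and telescope against each other; the same holds
        -- for `h₂` at a + 1.
        h₁ : g (1ℚ + ℓ - 0ℚ) * (1ℚ + δ c) ≡ (1ℚ + ν c) * g (ℓ - 0ℚ)
        h₁ = trans (cong (g (1ℚ + ℓ - 0ℚ) *_) (sym (trans (cong (λ z → z - 0ℚ - (1ℚ + (A + C))) (⟦L⟧ c))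
               (solve 3 (λ A C B → (con 1ℚ :+ (con 1ℚ :+ (A :+ (con 1ℚ :+ (C :+ C :+ B))))) :- con 0ℚ :- (con 1ℚ :+ (A :+ C))
                 := con 1ℚ :+ (con 1ℚ :+ (C :+ B))) refl A C B))))
             (trans (Bin.gaps-shift a c (ℓ - 0ℚ) (1ℚ + ℓ - 0ℚ) (solve 1 (λ l → con 1ℚ :+ l :- con 0ℚ := con 1ℚ :+ (l :- con 0ℚ)) refl ℓ))
             (cong (λ z → z * g (ℓ - 0ℚ)) (trans (cong (λ z → z - 0ℚ - (1ℚ + A)) (⟦L⟧ c))
               (solve 2 (λ A n → (con 1ℚ :+ (con 1ℚ :+ (A :+ n))) :- con 0ℚ :- (con 1ℚ :+ A) := con 1ℚ :+ n) refl A (ν c)))))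

        h₂ : g (1ℚ + ℓ - (1ℚ + A)) * q₁ ≡ q₂ * g (ℓ - (1ℚ + A))
        h₂ = trans (cong (g (1ℚ + ℓ - (1ℚ + A)) *_) (sym (trans (cong (λ z → z - (1ℚ + A) - (1ℚ + (A + C))) (⟦L⟧ c))
               (solve 3 (λ A C B → (con 1ℚ :+ (con 1ℚ :+ (A :+ (con 1ℚ :+ (C :+ C :+ B))))) :- (con 1ℚ :+ A) :- (con 1ℚ :+ (A :+ C))
                 := (con 1ℚ :+ (C :+ B)) :- A) refl A C B))))
             (trans (Bin.gaps-shift a c (ℓ - (1ℚ + A)) (1ℚ + ℓ - (1ℚ + A))
                 (solve 2 (λ l A → con 1ℚ :+ l :- (con 1ℚ :+ A) := con 1ℚ :+ (l :- (con 1ℚ :+ A))) refl ℓ A))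
             (cong (λ z → z * g (ℓ - (1ℚ + A))) (trans (cong (λ z → z - (1ℚ + A) - (1ℚ + A)) (⟦L⟧ c))
               (solve 2 (λ A n → (con 1ℚ :+ (con 1ℚ :+ (A :+ n))) :- (con 1ℚ :+ A) :- (con 1ℚ :+ A) := n :- A) refl A (ν c)))))

        h₃ : (1ℚ + (1ℚ + ν c)) * bin (suc (L c)) (suc a) ≡ (1ℚ + ℓ) * bin (L c) (suc a)
        h₃ = trans (cong (_* bin (suc (L c)) (suc a)) (sym (trans (cong (λ z → 1ℚ + z - (1ℚ + A)) (⟦L⟧ c))
               (solve 2 (λ A n → con 1ℚ :+ (con 1ℚ :+ (con 1ℚ :+ (A :+ n))) :- (con 1ℚ :+ A) := con 1ℚ :+ (con 1ℚ :+ n)) refl A (ν c)))))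
             (bin-absorb′ (L c) (suc a))

        q₃≡ : 1ℚ + ℓ - ((1ℚ + A) + (1ℚ + A)) ≡ q₃
        q₃≡ = trans (cong (λ z → 1ℚ + z - ((1ℚ + A) + (1ℚ + A))) (⟦L⟧ c))
          (solve 2 (λ A n → con 1ℚ :+ (con 1ℚ :+ (con 1ℚ :+ (A :+ n))) :- ((con 1ℚ :+ A) :+ (con 1ℚ :+ A)) := con 1ℚ :+ n :- A) refl A (ν c))

        BL BM gₐ : ℚ
        BL = bin (L c) (suc a)
        BM = bin (suc (L c)) (suc a)
        gₐ = g (1ℚ + A)

        τ≡ : τ c ≡ (1ℚ + ℓ) * (K * (g 0ℚ * g (1ℚ + ℓ - 0ℚ)))
        τ≡ = trans (proj₂ (ballot-product c) 0) (cong (_* (K * (g 0ℚ * g (1ℚ + ℓ - 0ℚ))))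
          (solve 1 (λ m → (m :- (con 0ℚ :+ con 0ℚ)) :* con 1ℚ := m) refl (1ℚ + ℓ)))

        τ′≡ : τ′ c ≡ 1ℚ * (K′ * (g 0ℚ * g (ℓ - 0ℚ)))
        τ′≡ = proj₂ (bin-product c) 0

        τ-suc : τ (suc c) ≡ q₃ * BM * (K * (gₐ * g (1ℚ + ℓ - (1ℚ + A))))
        τ-suc = trans (Ballot.minor-suc a c t) (trans (proj₂ (ballot-product c) (suc a))
          (cong (λ z → z * BM * (K * (gₐ * g (1ℚ + ℓ - (1ℚ + A))))) q₃≡))

        τ′-suc : τ′ (suc c) ≡ BL * (K′ * (gₐ * g (ℓ - (1ℚ + A))))
        τ′-suc = trans (Bin.minor-suc a c t) (proj₂ (bin-product c) (suc a))

        cross : τ′ (suc c) * τ c * (q₃ * q₂ * (1ℚ + δ c)) ≡ τ (suc c) * τ′ c * ((1ℚ + (1ℚ + ν c)) * (1ℚ + ν c) * q₁)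
        cross = trans (cong₂ (λ x y → x * y * (q₃ * q₂ * (1ℚ + δ c))) τ′-suc τ≡)
          (trans (cross-ratio {K} {K′} {g 0ℚ} {gₐ} {g (ℓ - 0ℚ)} {g (1ℚ + ℓ - 0ℚ)} {g (ℓ - (1ℚ + A))} {g (1ℚ + ℓ - (1ℚ + A))}
                    {BL} {BM} {1ℚ + ℓ} {1ℚ + δ c} {1ℚ + ν c} {1ℚ + (1ℚ + ν c)} {q₁} {q₂} q₃ h₁ h₂ h₃)
            (sym (cong₂ (λ x y → x * y * ((1ℚ + (1ℚ + ν c)) * (1ℚ + ν c) * q₁)) τ-suc τ′≡)))

        q₁≢0 : q₁ ≢ 0ℚ
        q₁≢0 = subst (λ z → z - A ≢ 0ℚ) (⟦δ⟧ c) (sub-≢0 (s≤s (ℕₚ.≤-trans a≤b (ℕₚ.m≤n+m b c))))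

        q₂≢0 : q₂ ≢ 0ℚ
        q₂≢0 = subst (λ z → z - A ≢ 0ℚ) (⟦ν⟧ c) (sub-≢0 (s≤s (ℕₚ.≤-trans a≤b (ℕₚ.m≤n+m b (c ℕ.+ c)))))

        q₃≢0 : q₃ ≢ 0ℚ
        q₃≢0 = subst (λ z → 1ℚ + z - A ≢ 0ℚ) (⟦ν⟧ c)
          (sub-≢0 {suc (suc (c ℕ.+ c ℕ.+ b))} (s≤s (ℕₚ.m≤n⇒m≤1+n (ℕₚ.≤-trans a≤b (ℕₚ.m≤n+m b (c ℕ.+ c))))))

        -- `K` is non-zero because it divides τ c. The gaps are non-zero because a + 1 lies below
        -- the end points a + 2, ..., a + c + 1 and its mirror image lies above them.
        τ-suc-≢0 : τ c ≢ 0ℚ → τ (suc c) ≢ 0ℚ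
        τ-suc-≢0 τ≢0 = subst (_≢ 0ℚ) (sym τ-suc) (*-≢0 (*-≢0 q₃≢0 (bin-≢0 (suc (L c)) (suc a) (suc-a≤ a b c)))
          (*-≢0 (≢0-factorˡ {K} (≢0-factorʳ {1ℚ + ℓ} (subst (_≢ 0ℚ) τ≡ τ≢0)))
            (*-≢0 (prod-≢0 (All.map (λ {e} 2+a≤e → λ eq → sub-≢0 {e} {suc a} 2+a≤e
                     (trans (solve 2 (λ x y → y :- x := con 0ℚ :- (x :- y)) refl (1ℚ + A) ⟦ e ⟧) (cong (λ z → 0ℚ - z) eq)))
                     (range-lower (2 ℕ.+ a) c)))
                  (prod-≢0 (All.map (λ {e} e< → subst (_≢ 0ℚ) (trans (cong (λ z → 1ℚ + ℓ - z) (⟦+⟧ (suc a) e))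
                      (solve 3 (λ m x y → m :- (x :+ y) := m :- x :- y) refl (1ℚ + ℓ) (1ℚ + A) ⟦ e ⟧))
                    (sub-≢0 {suc (L c)} {suc a ℕ.+ e} (linear (c ℕ.+ 1) (ℕₚ.+-mono-≤ e< a≤b) (p a b c e))))
                    (range-upper (2 ℕ.+ a) c))))))
          where
          suc-a≤ : ∀ a b c → suc a ≤ suc (suc a ℕ.+ suc b ℕ.+ 2 ℕ.* c ℕ.+ 1)
          suc-a≤ a b c = s≤s (ℕₚ.≤-trans (ℕₚ.n≤1+n a) (ℕₚ.≤-trans (ℕₚ.m≤m+n (suc a) (suc b))
            (ℕₚ.≤-trans (ℕₚ.m≤m+n (suc a ℕ.+ suc b) (2 ℕ.* c)) (ℕₚ.m≤m+n _ 1))))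
          p : ∀ a b c e → suc (suc a ℕ.+ suc b ℕ.+ 2 ℕ.* c ℕ.+ 1) ℕ.+ (suc e ℕ.+ a) ≡
              suc (suc a ℕ.+ e) ℕ.+ (2 ℕ.+ a ℕ.+ c ℕ.+ b) ℕ.+ (c ℕ.+ 1)
          p = ℕ-Ring.solve-∀

        den : δ (suc c) * fall (δ (suc c)) a * q₁ ≡ (1ℚ + δ c) * (δ c * fall (δ c) a)
        den = trans (cong (λ z → z * fall z a * q₁) (solve 2 (λ C B → con 1ℚ :+ (con 1ℚ :+ C :+ B) := con 1ℚ :+ (con 1ℚ :+ (C :+ B))) refl C B))
          (trans (*-assoc (1ℚ + δ c) (fall (1ℚ + δ c) a) q₁) (cong ((1ℚ + δ c) *_) (fall-telescope (δ c) a)))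

        num : ν (suc c) * fall (ν (suc c)) a * (q₃ * q₂) ≡ (1ℚ + (1ℚ + ν c)) * (1ℚ + ν c) * (ν c * fall (ν c) a)
        num = begin
          ν (suc c) * fall (ν (suc c)) a * (q₃ * q₂)
            ≡⟨ cong (λ z → z * fall z a * (q₃ * q₂)) (solve 2 (λ C B → con 1ℚ :+ ((con 1ℚ :+ C) :+ (con 1ℚ :+ C) :+ B)
                 := con 1ℚ :+ (con 1ℚ :+ (con 1ℚ :+ (C :+ C :+ B)))) refl C B) ⟩
          (1ℚ + (1ℚ + ν c)) * fall (1ℚ + (1ℚ + ν c)) a * (q₃ * q₂)
            ≡⟨ solve 4 (λ z f p q → z :* f :* (p :* q) := z :* (f :* p) :* q) refl (1ℚ + (1ℚ + ν c)) (fall (1ℚ + (1ℚ + ν c)) a) q₃ q₂ ⟩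
          (1ℚ + (1ℚ + ν c)) * (fall (1ℚ + (1ℚ + ν c)) a * q₃) * q₂
            ≡⟨ cong (λ z → (1ℚ + (1ℚ + ν c)) * z * q₂) (fall-telescope (1ℚ + ν c) a) ⟩
          (1ℚ + (1ℚ + ν c)) * ((1ℚ + ν c) * fall (1ℚ + ν c) a) * q₂
            ≡⟨ solve 4 (λ z v f q → z :* (v :* f) :* q := z :* v :* (f :* q)) refl (1ℚ + (1ℚ + ν c)) (1ℚ + ν c) (fall (1ℚ + ν c) a) q₂ ⟩
          (1ℚ + (1ℚ + ν c)) * (1ℚ + ν c) * (fall (1ℚ + ν c) a * q₂)
            ≡⟨ cong ((1ℚ + (1ℚ + ν c)) * (1ℚ + ν c) *_) (fall-telescope (ν c) a) ⟩
          (1ℚ + (1ℚ + ν c)) * (1ℚ + ν c) * (ν c * fall (ν c) a) ∎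
          where open ≡-Reasoning

    τ-≢0 : ∀ c → τ c ≢ 0ℚ
    τ-≢0 zero    = λ ()
    τ-≢0 (suc c) = Step.τ-suc-≢0 c (τ-≢0 c)

    -- For c = 0 both minors are 1 and δ 0 = ν 0. The factor in front of `fall` is the one with i =
    -- 0, so the quotient is the product of (2c+b+1-i)/(c+b+1-i) over i = 0, ..., a.
    τ-ratio : ∀ c → τ′ c * (δ c * fall (δ c) a) ≡ τ c * (ν c * fall (ν c) a)
    τ-ratio zero    = cong (λ z → 1ℚ * (z * fall z a)) (solve 1 (λ B → con 1ℚ :+ (con 0ℚ :+ B) := con 1ℚ :+ (con 0ℚ :+ con 0ℚ :+ B)) refl B)
    τ-ratio (suc c) = ratio-step {τ c} {τ′ c} {τ (suc c)} {τ′ (suc c)} {δ c * fall (δ c) a} {δ (suc c) * fall (δ (suc c)) a}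
      {ν c * fall (ν c) a} {ν (suc c) * fall (ν (suc c)) a} {1ℚ + δ c} {1ℚ + ν c} {1ℚ + (1ℚ + ν c)} {q₁} {q₂} {q₃}
      (τ-≢0 c) q₁≢0 q₂≢0 q₃≢0 cross (τ-ratio c) den num
      where open Step c

    X X′ : ℕ → ℚ
    X  c = det (Ballot.row c (suc b) 1 ∷ map (Ballot.row c t) (range (2 ℕ.+ a) c)) (range 0 (suc c))
    X′ c = det (Bin.row c (suc b) 1 ∷ map (Bin.row c t) (range (2 ℕ.+ a) c)) (range 0 (suc c))

    private
      -- `Q c` equals (b+1)(b+2c+2) - ac, the factor that does not split.
      s Q : ℕ → ℚ
      s c = 1ℚ + (A + ⟦ c ⟧)
      Q c = δ c * (1ℚ + (1ℚ + (A + ν c))) - s c * ν c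

    X′-τ′ : ∀ c → X′ c * (s c * ν c) ≡ τ′ c * ((1ℚ + A) * Q c)
    X′-τ′ c = excess {X′ c} {τ′ c} {p₁} (1ℚ + A) (s c) (ν c) (δ c) (1ℚ + (1ℚ + (A + ν c))) (Bin.minor-dent (2 ℕ.+ a) c (suc b) (suc a)) (begin
      p₁ * (s c * ν c)
        ≡⟨ cong (λ z → p₁ * (s c * z)) (sym (trans (cong (λ z → z - 1ℚ - (1ℚ + A)) (⟦L⟧ c))
             (solve 2 (λ A n → (con 1ℚ :+ (con 1ℚ :+ (A :+ n))) :- con 1ℚ :- (con 1ℚ :+ A) := n) refl A (ν c)))) ⟩
      p₁ * (s c * (⟦ L c ⟧ - 1ℚ - (1ℚ + A)))
        ≡⟨ sym (*-identityʳ _) ⟩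
      p₁ * (s c * (⟦ L c ⟧ - 1ℚ - (1ℚ + A))) * 1ℚ
        ≡⟨ Bin.minor-ratio a c t (bin-product c) ⟩
      τ′ c * ((1ℚ + A) * (⟦ L c ⟧ - 1ℚ - s c)) * bin (L c) 1
        ≡⟨ cong₂ (λ x y → τ′ c * ((1ℚ + A) * x) * y) (trans (cong (λ z → z - 1ℚ - s c) (⟦L⟧ c))
             (solve 3 (λ A C B → (con 1ℚ :+ (con 1ℚ :+ (A :+ (con 1ℚ :+ (C :+ C :+ B))))) :- con 1ℚ :- (con 1ℚ :+ (A :+ C))
               := con 1ℚ :+ (C :+ B)) refl A ⟦ c ⟧ B)) (trans (bin-1 (L c)) (⟦L⟧ c)) ⟩
      τ′ c * ((1ℚ + A) * δ c) * (1ℚ + (1ℚ + (A + ν c))) ∎)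
      where
      open ≡-Reasoning
      p₁ : ℚ
      p₁ = Bin.minor (2 ℕ.+ a) c t 1

    X-τ : ∀ c → X c * (s c * (1ℚ + ν c)) ≡ τ c * ((1ℚ + A) * Q c)
    X-τ c = trans
      (excess {X c} {τ c} {p₁} (1ℚ + A) (s c) (1ℚ + ν c) (1ℚ + δ c) (1ℚ + (A + ν c)) (Ballot.minor-dent (2 ℕ.+ a) c (suc b) (suc a))
        (*-cancelˡ-≢0 (⟦suc⟧≢0 (L c)) (begin
          μ * (p₁ * (s c * (1ℚ + ν c)))
            ≡⟨ solve 4 (λ m p s u → m :* (p :* (s :* u)) := p :* (s :* u) :* ((m :- (con 0ℚ :+ con 0ℚ)) :* con 1ℚ)) refl μ p₁ (s c) (1ℚ + ν c) ⟩
          p₁ * (s c * (1ℚ + ν c)) * tilt (suc (L c)) 0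
            ≡⟨ cong (λ z → p₁ * (s c * z) * tilt (suc (L c)) 0) (sym (trans (cong (λ z → 1ℚ + z - 1ℚ - (1ℚ + A)) (⟦L⟧ c))
                 (solve 2 (λ A n → con 1ℚ :+ (con 1ℚ :+ (con 1ℚ :+ (A :+ n))) :- con 1ℚ :- (con 1ℚ :+ A) := con 1ℚ :+ n) refl A (ν c)))) ⟩
          p₁ * (s c * (μ - 1ℚ - (1ℚ + A))) * tilt (suc (L c)) 0
            ≡⟨ Ballot.minor-ratio a c t (ballot-product c) ⟩
          τ c * ((1ℚ + A) * (μ - 1ℚ - s c)) * tilt (suc (L c)) 1
            ≡⟨ cong₂ (λ x y → τ c * ((1ℚ + A) * x) * y) (trans (cong (λ z → 1ℚ + z - 1ℚ - s c) (⟦L⟧ c))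
                 (solve 3 (λ A C B → con 1ℚ :+ (con 1ℚ :+ (con 1ℚ :+ (A :+ (con 1ℚ :+ (C :+ C :+ B))))) :- con 1ℚ :- (con 1ℚ :+ (A :+ C))
                   := con 1ℚ :+ (con 1ℚ :+ (C :+ B))) refl A ⟦ c ⟧ B))
                 (cong₂ _*_ (trans (cong (λ z → 1ℚ + z - (⟦ 1 ⟧ + ⟦ 1 ⟧)) (⟦L⟧ c))
                   (solve 2 (λ A n → con 1ℚ :+ (con 1ℚ :+ (con 1ℚ :+ (A :+ n))) :- (con 1ℚ :+ con 1ℚ) := con 1ℚ :+ (A :+ n)) refl A (ν c)))
                   (bin-1 (suc (L c)))) ⟩
          τ c * ((1ℚ + A) * (1ℚ + δ c)) * ((1ℚ + (A + ν c)) * μ)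
            ≡⟨ solve 4 (λ t p w m → t :* p :* (w :* m) := m :* (t :* p :* w)) refl (τ c) ((1ℚ + A) * (1ℚ + δ c)) (1ℚ + (A + ν c)) μ ⟩
          μ * (τ c * ((1ℚ + A) * (1ℚ + δ c)) * (1ℚ + (A + ν c))) ∎)))
      -- The ballot expression agrees with `Q c` because ν c + a + 1 = δ c + s c.
      (cong (λ z → τ c * ((1ℚ + A) * z))
        (solve 3 (λ A C B → let d = con 1ℚ :+ (C :+ B); n = con 1ℚ :+ (C :+ C :+ B); s = con 1ℚ :+ (A :+ C) in
           (con 1ℚ :+ d) :* (con 1ℚ :+ (A :+ n)) :- s :* (con 1ℚ :+ n) := d :* (con 1ℚ :+ (con 1ℚ :+ (A :+ n))) :- s :* n)
           refl A ⟦ c ⟧ B))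
      where
      open ≡-Reasoning
      p₁ μ : ℚ
      p₁ = Ballot.minor (2 ℕ.+ a) c t 1
      μ  = ⟦ suc (L c) ⟧

    -- `Q c` enters both relations as a multiplier, so only s c and ν c are cancelled. Compared with
    -- `τ-ratio` the quotient gains (1 + ν c)/ν c, which turns the factor with i = 0 into
    -- (2c+b+2)/(c+b+1).
    X-ratio : ∀ c → X′ c * (δ c * fall (δ c) a) ≡ X c * ((1ℚ + ν c) * fall (ν c) a)
    X-ratio c = *-cancelˡ-≢0 {s c * ν c} (*-≢0 s≢0 ν≢0) (begin
      s c * ν c * (X′ c * D)
        ≡⟨ solve 4 (λ s n x d → s :* n :* (x :* d) := x :* (s :* n) :* d) refl (s c) (ν c) (X′ c) D ⟩
      X′ c * (s c * ν c) * D
        ≡⟨ cong (_* D) (X′-τ′ c) ⟩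
      τ′ c * ((1ℚ + A) * Q c) * D
        ≡⟨ solve 3 (λ t q d → t :* q :* d := t :* d :* q) refl (τ′ c) ((1ℚ + A) * Q c) D ⟩
      τ′ c * D * ((1ℚ + A) * Q c)
        ≡⟨ cong (_* ((1ℚ + A) * Q c)) (τ-ratio c) ⟩
      τ c * (ν c * F) * ((1ℚ + A) * Q c)
        ≡⟨ solve 3 (λ t q d → t :* d :* q := t :* q :* d) refl (τ c) ((1ℚ + A) * Q c) (ν c * F) ⟩
      τ c * ((1ℚ + A) * Q c) * (ν c * F)
        ≡⟨ cong (_* (ν c * F)) (sym (X-τ c)) ⟩
      X c * (s c * (1ℚ + ν c)) * (ν c * F)
        ≡⟨ solve 5 (λ x s v n f → x :* (s :* v) :* (n :* f) := s :* n :* (x :* (v :* f))) refl (X c) (s c) (1ℚ + ν c) (ν c) F ⟩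
      s c * ν c * (X c * ((1ℚ + ν c) * F)) ∎)
      where
      open ≡-Reasoning
      D F : ℚ
      D = δ c * fall (δ c) a
      F = fall (ν c) a
      s≢0 : s c ≢ 0ℚ
      s≢0 = subst (λ z → 1ℚ + z ≢ 0ℚ) (⟦+⟧ a c) (⟦suc⟧≢0 (a ℕ.+ c))
      ν≢0 : ν c ≢ 0ℚ
      ν≢0 = subst (_≢ 0ℚ) (⟦ν⟧ c) (⟦suc⟧≢0 (c ℕ.+ c ℕ.+ b))

    module _ (c : ℕ) where
      factor : ℕ → ℚ
      factor i = + (2 ℕ.* c ℕ.+ b ℕ.+ 1 ∸ i) / suc (c ℕ.+ b ∸ i)

      δ-sub : ∀ n → suc n ≤ b → δ c - ⟦ suc n ⟧ ≡ ⟦ suc (c ℕ.+ b ∸ suc n) ⟧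
      δ-sub n n<b = trans (cong (λ z → z - ⟦ suc n ⟧) (sym (⟦δ⟧ c)))
        (trans (sym (⟦∸⟧ {suc (c ℕ.+ b)} {suc n} (s≤s (ℕₚ.<⇒≤ n<c+b)))) (cong ⟦_⟧ (ℕₚ.+-∸-assoc 1 n<c+b)))
        where
        n<c+b : suc n ≤ c ℕ.+ b
        n<c+b = ℕₚ.≤-trans n<b (ℕₚ.m≤n+m b c)

      ⟦ν⟧′ : ⟦ 2 ℕ.* c ℕ.+ b ℕ.+ 1 ⟧ ≡ ν c
      ⟦ν⟧′ = trans (cong ⟦_⟧ (e b c)) (⟦ν⟧ c)
        where
        e : ∀ b c → 2 ℕ.* c ℕ.+ b ℕ.+ 1 ≡ suc (c ℕ.+ c ℕ.+ b)
        e = ℕ-Ring.solve-∀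

      -- For i ≤ b the truncated subtractions in `factor` are genuine, so its denominators are the
      -- factors of `fall (δ c)`.
      factor-fall : ∀ n → n ≤ b → prodℚ n factor * fall (δ c) n ≡ fall (ν c) n
      factor-fall zero    _   = refl
      factor-fall (suc n) n<b = begin
        prodℚ n factor * factor (suc n) * (fall (δ c) n * (δ c - ⟦ suc n ⟧))
          ≡⟨ solve 4 (λ p f d x → p :* f :* (d :* x) := p :* d :* (f :* x)) refl
               (prodℚ n factor) (factor (suc n)) (fall (δ c) n) (δ c - ⟦ suc n ⟧) ⟩
        prodℚ n factor * fall (δ c) n * (factor (suc n) * (δ c - ⟦ suc n ⟧))
          ≡⟨ cong₂ _*_ (factor-fall n (ℕₚ.<⇒≤ n<b)) (trans (cong (factor (suc n) *_) (δ-sub n n<b))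
               (trans (/-cancel (2 ℕ.* c ℕ.+ b ℕ.+ 1 ∸ suc n) (c ℕ.+ b ∸ suc n))
               (trans (⟦∸⟧ {2 ℕ.* c ℕ.+ b ℕ.+ 1} {suc n} (ℕₚ.≤-trans n<b (ℕₚ.≤-trans (ℕₚ.m≤n+m b (2 ℕ.* c)) (ℕₚ.m≤m+n _ 1))))
                      (cong (λ z → z - ⟦ suc n ⟧) ⟦ν⟧′)))) ⟩
        fall (ν c) n * (ν c - ⟦ suc n ⟧) ∎
        where open ≡-Reasoning

      fall-≢0 : ∀ n → n ≤ b → fall (δ c) n ≢ 0ℚ
      fall-≢0 zero    _   = λ ()
      fall-≢0 (suc n) n<b = *-≢0 (fall-≢0 n (ℕₚ.<⇒≤ n<b))
        (subst (_≢ 0ℚ) (sym (δ-sub n n<b)) (⟦suc⟧≢0 (c ℕ.+ b ∸ suc n)))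

      X′-formula : X′ c ≡ X c * (+ (2 ℕ.* c ℕ.+ b ℕ.+ 2) / suc (c ℕ.+ b)) * prodℚ a factor
      X′-formula = *-cancelˡ-≢0 {δ c * fall (δ c) a}
        (*-≢0 (subst (_≢ 0ℚ) (⟦δ⟧ c) (⟦suc⟧≢0 (c ℕ.+ b))) (fall-≢0 a a≤b)) (begin
        δ c * fall (δ c) a * X′ c
          ≡⟨ *-comm (δ c * fall (δ c) a) (X′ c) ⟩
        X′ c * (δ c * fall (δ c) a)
          ≡⟨ X-ratio c ⟩
        X c * ((1ℚ + ν c) * fall (ν c) a)
          ≡⟨ cong₂ (λ x y → X c * (x * y)) (sym first) (sym (factor-fall a a≤b)) ⟩
        X c * ((f * δ c) * (prodℚ a factor * fall (δ c) a))
          ≡⟨ solve 5 (λ x f d p g → x :* ((f :* d) :* (p :* g)) := d :* g :* (x :* f :* p)) refl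
               (X c) f (δ c) (prodℚ a factor) (fall (δ c) a) ⟩
        δ c * fall (δ c) a * (X c * f * prodℚ a factor) ∎)
        where
        open ≡-Reasoning
        f : ℚ
        f = + (2 ℕ.* c ℕ.+ b ℕ.+ 2) / suc (c ℕ.+ b)
        first : f * δ c ≡ 1ℚ + ν c
        first = trans (cong (f *_) (sym (⟦δ⟧ c))) (trans (/-cancel (2 ℕ.* c ℕ.+ b ℕ.+ 2) (c ℕ.+ b))
          (trans (cong ⟦_⟧ (ℕₚ.+-suc (2 ℕ.* c ℕ.+ b) 1)) (cong (λ z → 1ℚ + z) ⟦ν⟧′)))

  -- The middle binomials are equal, so θ = 1 and η = 1/2. For `ballot` their difference vanishes,
  -- so θ = 0 and η = 1.
  module Weighted = Count bin 1ℚ ½ refl (λ _ → refl) (λ _ _ → refl)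
    (λ j → trans (bin-middle j) (sym (*-identityˡ (bin (2 ℕ.* j ℕ.+ 1) j))))

  module Unweighted = Count ballot 0ℚ 1ℚ refl (λ _ → refl) ballot-pascal
    (λ j → trans (cong (λ z → z - bin (2 ℕ.* j ℕ.+ 1) j) (bin-middle j))
      (trans (+-inverseʳ (bin (2 ℕ.* j ℕ.+ 1) j)) (sym (*-zeroˡ (ballot (2 ℕ.* j ℕ.+ 1) j)))))

  module Region-S′ (a b c : ℕ) = Weighted.Count′ a b c (weightS' a) (λ _ _ → refl) (λ _ _ → refl)
    (λ j t on → if-cong (West.west-wall a b c j t on))

  if-same : ∀ {A : Set} {y : A} x → (if x then y else y) ≡ y
  if-same true  = refl
  if-same false = refl

  module Region-S (a b c : ℕ) = Unweighted.Count′ a b c unweighted (λ _ _ → refl) (λ _ _ → refl)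
    (λ j t _ → sym (if-same (atWall c (suc t) j)))

  1^ℚ : ∀ n → 1ℚ ^ℚ n ≡ 1ℚ
  1^ℚ zero    = refl
  1^ℚ (suc n) = cong (_* 1ℚ) (1^ℚ n)

  private
    top≡ : ∀ a b → suc (suc b ℕ.+ a) ≡ suc a ℕ.+ suc b
    top≡ = ℕ-Ring.solve-∀

  MS-det : ∀ a b c (a≤b : a ≤ b) → MS a b c ≡ Compare.X a b a≤b c
  MS-det a b c a≤b = trans (Region-S.M-generic a b c a≤b)
    (trans (cong₂ (λ w d → w * d) (1^ℚ (suc a))
      (cong₂ (λ t lo → det (Ballot.row c (suc b) 1 ∷ map (Ballot.row c t) (range lo c)) (range 0 (suc c))) (top≡ a b) (ℕₚ.+-comm a 2)))
    (*-identityˡ (Compare.X a b a≤b c)))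

  MS'-det : ∀ a b c (a≤b : a ≤ b) → MS' a b c ≡ (½ ^ℚ suc a) * Compare.X′ a b a≤b c
  MS'-det a b c a≤b = trans (Region-S′.M-generic a b c a≤b)
    (cong ((½ ^ℚ suc a) *_)
      (cong₂ (λ t lo → det (Bin.row c (suc b) 1 ∷ map (Bin.row c t) (range lo c)) (range 0 (suc c))) (top≡ a b) (ℕₚ.+-comm a 2)))

  MS'-formula : ∀ a b c → a ≤ b → MS' a b c ≡
    ((MS a b c * (½ ^ℚ suc a)) * (+ (2 ℕ.* c ℕ.+ b ℕ.+ 2) / suc (c ℕ.+ b)))
    * prodℚ a (λ i → + (2 ℕ.* c ℕ.+ b ℕ.+ 1 ∸ i) / suc (c ℕ.+ b ∸ i))
  MS'-formula a b c a≤b = begin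
    MS' a b c
      ≡⟨ MS'-det a b c a≤b ⟩
    (½ ^ℚ suc a) * X′ c
      ≡⟨ cong ((½ ^ℚ suc a) *_) (X′-formula c) ⟩
    (½ ^ℚ suc a) * (X c * f * p)
      ≡⟨ solve 4 (λ h x f p → h :* (x :* f :* p) := x :* h :* f :* p) refl (½ ^ℚ suc a) (X c) f p ⟩
    X c * (½ ^ℚ suc a) * f * p
      ≡⟨ cong (λ z → z * (½ ^ℚ suc a) * f * p) (sym (MS-det a b c a≤b)) ⟩
    MS a b c * (½ ^ℚ suc a) * f * p ∎
    where
    open ≡-Reasoning
    open Compare a b a≤b
    f p : ℚ
    f = + (2 ℕ.* c ℕ.+ b ℕ.+ 2) / suc (c ℕ.+ b)
    p = prodℚ a (factor c)

  -- Both sides reduce to the same determinant, with end points b + 2, ..., b + c + 1 at height 2b +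
  -- 2, and to the same power of 1/2.
  MS'-edge : ∀ b c → MS' (suc b) b c ≡ MS' b b c
  MS'-edge b c = trans (Region-S′.M-edge (suc b) b c refl) (sym (trans (Region-S′.M-generic b b c ℕₚ.≤-refl)
    (cong₂ (λ t lo → (½ ^ℚ suc b) * det (Bin.row c (suc b) 1 ∷ map (Bin.row c t) (range lo c)) (range 0 (suc c)))
      (cong suc (sym (ℕₚ.+-suc b b))) (ℕₚ.+-comm b 2))))

open import Data.Nat using (_+_; _*_)
open import Data.Integer using (+_)
open import Data.Rational using () renaming (_*_ to _*ℚ_)

theorem2p2 : ((a b c : ℕ) → a ≤ b →
    MS' a b c ≡
    ((MS a b c *ℚ (½ ^ℚ suc a))
    *ℚ (+ (2 * c + b + 2) / suc (c + b)))
    *ℚ prodℚ a (λ i → + (2 * c + b + 1 ∸ i) / suc (c + b ∸ i)))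
    × ((b c : ℕ) → MS' (suc b) b c ≡ MS' b b c)
theorem2p2 = Comparison.MS'-formula , Comparison.MS'-edge
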